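{- For every $n\ge 1$ and every partition $\lambda=(\lambda_1\ge\lambda_2\ge\cdots\ge\lambda_n\ge 0)$ with at most $n$ nonzero parts, there exist two bijections $\psi_{\mathrm{inv}}=\psi_{\mathrm{inv}}^{(n,\lambda)}$ and $\psi_{\mathrm{quinv}}=\psi_{\mathrm{quinv}}^{(n,\lambda)}$ from $\mathrm{CSF}_n(\lambda)$ to $\mathrm{POP}_n(\lambda)$ (two families of bijections, indexed by all such pairs $(n,\lambda)$) with the following properties. 1. For $v\in\{\mathrm{inv},\mathrm{quinv}\}$ and $F\in\mathrm{CSF}_n(\lambda)$, if $\psi_v(F)=(T,\Lambda)$ then $x^F=x^T$ and $v(F)=|\Lambda|$. 2. For $v\in\{\mathrm{inv},\mathrm{quinv}\}$: (A) $\mathrm{pr}\circ\psi_v=\mathrm{rsort}$ as maps $\mathrm{CSF}_n(\lambda)\to\mathrm{GT}_n(\lambda)$. (B) $\mathrm{br}\circ\psi_v=\psi_v\circ\mathrm{dsplice}$ as maps $\mathrm{CSF}_n(\lambda)\to\bigsqcup_{\mu\prec\lambda}\mathrm{POP}_{n-1}(\mu)$, where on the right-hand side $\psi_v:\bigsqcup_{\mu\prec\lambda}\mathrm{CSF}_{n-1}(\mu)\to\bigsqcup_{\mu\prec\lambda}\mathrm{POP}_{n-1}(\mu)$ is given by $\psi_v^{(n-1,\mu)}$ on the component indexed by $\mu$. 3. $\psi_{\mathrm{quinv}}=\mathrm{boxcomp}\circ\psi_{\mathrm{inv}}$.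
   Context: Diagrams and fillings. $[n]=\{1,\dots,n\}$. The Young diagram of a partition $\lambda$ is $\mathrm{dg}(\lambda)=\{(r,c):1\le c\le\lambda_r\}$, with $r$ the row index from the top and $c$ the column index from the left. $\mathrm{CSF}_n(\lambda)$ is the set of column strict fillings: maps $F:\mathrm{dg}(\lambda)\to[n]$ strictly increasing down each column. $x^F=\prod_{c\in\mathrm{dg}(\lambda)}x_{F(c)}$. Statistics. For a cell $u=(i,j)$ with $i>1$ let $u^\uparrow=(i-1,j)$; $\mathrm{Des}(F)$ is the set of cells $u$ not in the first row with $F(u)>F(u^\uparrow)$; $\mathrm{arm}(u)$ is the number of cells of $\mathrm{dg}(\lambda)$ strictly to the right of $u$ in its row. A cell $u$ Inv-attacks $v$ if they are in the same row with $u$ strictly left of $v$, or $u$ is in the row immediately below that of $v$, in a column strictly to the right of that of $v$. A cell $u$ Quinv-attacks $v$ if they are in the same row with $u$ strictly right of $v$, or $u$ is in the row immediately below that of $v$, in a column strictly to the left of that of $v$. $\mathrm{Inv}(F)$ (resp. $\mathrm{Quinv}(F)$) is the set of pairs $(u,v)$ such that $u$ Inv-attacks (resp. Quinv-attacks) $v$ and $F(u)>F(v)$. Then $\mathrm{inv}(F)=|\mathrm{Inv}(F)|-\sum_{u\in\mathrm{Des}(F)}\mathrm{arm}(u)$ and $\mathrm{quinv}(F)=|\mathrm{Quinv}(F)|-\sum_{u\in\mathrm{Des}(F)}\mathrm{arm}(u^\uparrow)$. Gelfand-Tsetlin patterns. $\mathrm{GT}_n(\lambda)$ is the set of integer arrays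 $T=(T^j_i:1\le i\le j\le n)$ with $T^n_i=\lambda_i$ and, for $1\le i\le j<n$, $\mathrm{NE}_{ij}(T):=T^{j+1}_i-T^j_i\ge 0$ and $\mathrm{SE}_{ij}(T):=T^j_i-T^{j+1}_{i+1}\ge 0$. It is identified with the set of semistandard Young tableaux of shape $\lambda$ with entries in $[n]$ by letting $T^j_i$ be the number of cells of the $i$th row containing entries $\le j$; $x^T$ is the monomial weight of the tableau. Partition overlaid patterns. $\mathrm{POP}_n(\lambda)$ is the set of pairs $(T,\Lambda)$ with $T\in\mathrm{GT}_n(\lambda)$ and $\Lambda=(\Lambda_{ij}:1\le i\le j<n)$ a tuple of partitions such that $\Lambda_{ij}$ fits in an $\mathrm{NE}_{ij}(T)\times\mathrm{SE}_{ij}(T)$ rectangle, i.e. has at most $\mathrm{NE}_{ij}(T)$ nonzero parts, each $\le\mathrm{SE}_{ij}(T)$. $|\Lambda|=\sum_{i,j}|\Lambda_{ij}|$. Projection: $\mathrm{pr}(T,\Lambda)=T$. For $\mu=(\mu_1,\dots,\mu_{n-1})$, write $\mu\prec\lambda$ if $\lambda_i\ge\mu_i\ge\lambda_{i+1}$ for $1\le i<n$. Branching: $\mathrm{br}:\mathrm{POP}_n(\lambda)\to\bigsqcup_{\mu\prec\lambda}\mathrm{POP}_{n-1}(\mu)$, $\mathrm{br}(T,\Lambda)=(T^\dagger,\Lambda^\dagger)$, where $T^\dagger$ is $T$ with the row $(T^n_i)_i$ deleted and $\Lambda^\dagger$ is $\Lambda$ with all $\Lambda_{i,n-1}$ deleted.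 Box complementation: $\mathrm{boxcomp}(T,\Lambda)=(T,\Lambda^c)$, where $(\Lambda^c)_{ij}$ is the complement of $\Lambda_{ij}$ in its $k\times\ell=\mathrm{NE}_{ij}(T)\times\mathrm{SE}_{ij}(T)$ rectangle; the complement of $(\pi_1\ge\dots\ge\pi_k\ge0)$ is $(\ell-\pi_k\ge\dots\ge\ell-\pi_1)$. For $n=1$ the only $\mu\prec\lambda$ is the empty tuple, and $\mathrm{CSF}_0$ and $\mathrm{POP}_0$ of it are one-element sets. Rowsort. $\mathrm{rsort}(F)$ is obtained from $F$ by sorting the entries of each row in ascending order from left to right; it is a semistandard Young tableau, regarded as an element of $\mathrm{GT}_n(\lambda)$. Splice. A column tuple is a (possibly empty) strictly increasing sequence $a=(a_1<\dots<a_p)$ of positive integers, $\mathrm{len}(a)=p$, with convention $a_0=0$. For column tuples $\sigma,\tau$ of lengths $k<\ell$ let $m=\max\{1\le i\le k+1:\sigma_{i-1}<\tau_i\}$ and $\mathrm{splice}(\sigma,\tau)=(\overline\sigma,\overline\tau)$, where $\overline\sigma_i=\sigma_i$ for $1\le i<m$, $\overline\sigma_i=\tau_i$ for $m\le i\le\ell$, $\overline\tau_i=\tau_i$ for $1\le i<m$, $\overline\tau_i=\sigma_i$ for $m\le i\le k$. Delete-and-splice. $\mathrm{dsplice}:\mathrm{CSF}_n(\lambda)\to\bigsqcup_{\mu\prec\lambda}\mathrm{CSF}_{n-1}(\mu)$ is defined as follows: delete all cells of $F$ containing $n$. While the resulting filling is not of partition shape, choose any $j$ such that its $(j+1)$th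 column is longer than its $j$th column, and replace this pair of columns (read top to bottom as column tuples $\sigma^{(j)},\sigma^{(j+1)}$) by $\mathrm{splice}(\sigma^{(j)},\sigma^{(j+1)})$. The process terminates and the final filling, $\mathrm{dsplice}(F)$, does not depend on the choices of $j$. -}

module Defs where

open import Data.Bool.Base using (if_then_else_)
open import Data.Empty using (⊥-elim)
open import Data.Fin.Base as Fin
  using (Fin; zero; suc; toℕ; fromℕ<; inject₁; inject≤; lower₁; opposite)
import Data.Fin.Properties as Fin
open import Data.Integer.Base as ℤ using (ℤ; +_)
open import Data.List.Base as List
  using (List; []; _∷_; _++_; length; take; drop; mapMaybe; filter; allFin; applyUpTo)
open import Data.List.Properties using (length-tabulate; filter-all; filter-accept; filter-reject; map-id)
open import Data.List.Relation.Binary.Permutation.Propositional.Properties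
  using (↭-length; filter-↭)
open import Data.List.Relation.Unary.All as All using (All; []; _∷_)
import Data.List.Relation.Unary.All.Properties as All
open import Data.List.Relation.Unary.AllPairs as AllPairs using (AllPairs; []; _∷_)
import Data.List.Relation.Unary.AllPairs.Properties as AllPairs
open import Data.List.Sort using (sort; sort-↭)
open import Data.Maybe.Base using (Maybe; just; nothing; maybe)
open import Data.Nat.Base
open import Data.Nat.Properties
open import Data.Product.Base using (Σ-syntax; _×_; _,_; proj₁; proj₂)
open import Data.Sum.Base using (_⊎_; inj₁; inj₂)
open import Data.Vec.Base as Vec using (Vec; lookup)
open import Data.Vec.Properties using (lookup∘tabulate; tabulate∘lookup; tabulate-cong)
open import Data.Vec.Relation.Binary.Equality.Propositional using (_≋_; ≋-refl; ≋-sym; ≋-trans)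
open import Function.Base using (_∘_; id)
open import Level using (0ℓ)
open import Relation.Binary.Bundles using (Setoid)
open import Relation.Binary.Construct.Closure.ReflexiveTransitive using (Star; ε; _◅_; _◅◅_; gmap)
open import Relation.Binary.PropositionalEquality
open import Relation.Nullary.Decidable using (Dec; yes; no; does; recompute; _×-dec_; _⊎-dec_)
open import Relation.Nullary.Negation using (¬_)
open import Relation.Unary using (Decidable)

open import Algebra.Properties.CommutativeMonoid.Sum +-0-commutativeMonoid using (sum-syntax)

private
  variable
    A B : Set
    m n : ℕ

-- Partitions with at most n nonzero parts, padded with zeros to length n.
-- All indices run from 0, so that `lookup parts i` is the (i+1)-st part.

record Partition (n : ℕ) : Set where
  constructor mkPartition
  field
    parts       : Vec ℕ n
    .decreasing : ∀ {i j} → i Fin.≤ j → lookup parts j ≤ lookup parts i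

open Partition public using (parts)

part : Partition n → Fin n → ℕ
part ν = lookup (parts ν)

part-mono : (ν : Partition n) → ∀ {i j} → i Fin.≤ j → part ν j ≤ part ν i
part-mono (mkPartition p d) i≤j = recompute (_ ≤? _) (d i≤j)

size : Partition n → ℕ
size = Vec.sum ∘ parts

infix 4 _≺_

_≺_ : Vec ℕ n → Vec ℕ (suc n) → Set
μ ≺ ν = ∀ i → lookup μ i ≤ lookup ν (inject₁ i) × lookup ν (suc i) ≤ lookup μ i

-- A partition with at most k nonzero parts, each at most ℓ.

record Box (k ℓ : ℕ) : Set where
  field
    partition : Partition k
    bounded   : ∀ i → part partition i ≤ ℓ

open Box public

complement : ∀ {k ℓ} → Box k ℓ → Box k ℓ
complement {k} {ℓ} π = record
  { partition = mkPartition (Vec.tabulate part′)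
      λ {i} {j} i≤j → subst₂ _≤_ (sym (lookup∘tabulate part′ j)) (sym (lookup∘tabulate part′ i))
        (∸-monoʳ-≤ ℓ (part-mono (partition π) (opposite-anti i≤j)))
  ; bounded   = λ i → subst (_≤ ℓ) (sym (lookup∘tabulate part′ i))
                        (m∸n≤m ℓ (part (partition π) (opposite i)))
  }
  where
  part′ : Fin k → ℕ
  part′ i = ℓ ∸ part (partition π) (opposite i)

  opposite-anti : ∀ {i j} → i Fin.≤ j → opposite j Fin.≤ opposite i
  opposite-anti {i} {j} i≤j = subst₂ _≤_ (sym (Fin.opposite-prop j)) (sym (Fin.opposite-prop i))
    (∸-monoʳ-≤ k (s≤s i≤j))

record Cell (ν : Partition n) : Set where
  constructor cell
  field
    row : Fin n
    col : Fin (part ν row)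

open Cell public

∑Cell : (ν : Partition n) → (Cell ν → ℕ) → ℕ
∑Cell {n} ν f = ∑[ r < n ] ∑[ c < part ν r ] f (cell r c)

#Cell : (ν : Partition n) {P : Cell ν → Set} → Decidable P → ℕ
#Cell ν P? = ∑Cell ν λ u → if does (P? u) then 1 else 0

-- The element x of Fin n stands for the entry x + 1 of {1,…,n}.

record CSF (n : ℕ) (ν : Partition n) : Set where
  field
    entry      : Cell ν → Fin n
    increasing : ∀ {r r′} {c : Fin (part ν r)} {c′ : Fin (part ν r′)} →
                 toℕ c ≡ toℕ c′ → r Fin.< r′ → entry (cell r c) Fin.< entry (cell r′ c′)

open CSF public

CSF-setoid : (n : ℕ) → Partition n → Setoid 0ℓ 0ℓ
CSF-setoid n ν = record
  { Carrier       = CSF n ν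
  ; _≈_           = λ F G → ∀ u → entry F u ≡ entry G u
  ; isEquivalence = record
    { refl  = λ u → refl
    ; sym   = λ F≈G u → sym (F≈G u)
    ; trans = λ F≈G G≈H u → trans (F≈G u) (G≈H u)
    }
  }

-- Monomials in x_1,…,x_n are given by their exponent vectors.

weight : {ν : Partition n} → CSF n ν → Fin n → ℕ
weight {ν = ν} F k = #Cell ν λ u → entry F u Fin.≟ k

data Statistic : Set where
  inv quinv : Statistic

Attacks : Statistic → {ν : Partition n} → Cell ν → Cell ν → Set
Attacks inv   u v = (row u ≡ row v × toℕ (col u) < toℕ (col v)) ⊎
                    (toℕ (row u) ≡ suc (toℕ (row v)) × toℕ (col v) < toℕ (col u))
Attacks quinv u v = (row u ≡ row v × toℕ (col v) < toℕ (col u)) ⊎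
                    (toℕ (row u) ≡ suc (toℕ (row v)) × toℕ (col u) < toℕ (col v))

attacks? : (s : Statistic) {ν : Partition n} (u v : Cell ν) → Dec (Attacks s u v)
attacks? inv   u v = (row u Fin.≟ row v ×-dec toℕ (col u) <? toℕ (col v)) ⊎-dec
                     (toℕ (row u) ≟ suc (toℕ (row v)) ×-dec toℕ (col v) <? toℕ (col u))
attacks? quinv u v = (row u Fin.≟ row v ×-dec toℕ (col v) <? toℕ (col u)) ⊎-dec
                     (toℕ (row u) ≟ suc (toℕ (row v)) ×-dec toℕ (col u) <? toℕ (col v))

#Inversions : Statistic → {ν : Partition n} → CSF n ν → ℕ
#Inversions s {ν} F = ∑Cell ν λ u → #Cell ν λ v → attacks? s u v ×-dec entry F v Fin.<? entry F u

arm : {ν : Partition n} → Cell ν → ℕ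
arm {ν = ν} u = #Cell ν λ v → row v Fin.≟ row u ×-dec toℕ (col u) <? toℕ (col v)

infix 8 _↑

_↑ : {ν : Partition n} → Cell ν → Maybe (Cell ν)
_↑         (cell zero    c) = nothing
_↑ {ν = ν} (cell (suc r) c) =
  just (cell (inject₁ r) (inject≤ c (part-mono ν (<⇒≤ (s≤s (≤-reflexive (Fin.toℕ-inject₁ r)))))))

-- The sum of f u u↑ over the descents u of F.

∑Des : {ν : Partition n} → CSF n ν → (Cell ν → Cell ν → ℕ) → ℕ
∑Des {ν = ν} F f = ∑Cell ν λ u →
  maybe (λ u↑ → if does (entry F u↑ Fin.<? entry F u) then f u u↑ else 0) 0 (u ↑)

statistic : Statistic → {ν : Partition n} → CSF n ν → ℤ
statistic inv   F = + #Inversions inv   F ℤ.- + ∑Des F (λ u u↑ → arm u)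
statistic quinv F = + #Inversions quinv F ℤ.- + ∑Des F (λ u u↑ → arm u↑)

-- T j is the row (T^j_1,…,T^j_j).  Entries in ℕ are no restriction: `top` and
-- `interlace` bound every integer entry below by a part of ν.  The inequalities
-- NE ≥ 0 and SE ≥ 0 are `interlace`, so NE and SE below are exact differences.

record GT (n : ℕ) (ν : Partition n) : Set where
  field
    T         : ∀ j → .(j ≤ n) → Vec ℕ j
    top       : T n ≤-refl ≡ parts ν
    interlace : ∀ j .(j<n : j < n) → T j (<⇒≤ j<n) ≺ T (suc j) j<n

  NE SE : ∀ j → .(j < n) → Fin j → ℕ
  NE j j<n i = lookup (T (suc j) j<n) (inject₁ i) ∸ lookup (T j (<⇒≤ j<n)) i
  SE j j<n i = lookup (T j (<⇒≤ j<n)) i ∸ lookup (T (suc j) j<n) (suc i)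

open GT public

infix 4 _≈GT_

_≈GT_ : {ν ν′ : Partition n} → GT n ν → GT n ν′ → Set
_≈GT_ {n} S S′ = ∀ j .(j≤n : j ≤ n) → T S j j≤n ≡ T S′ j j≤n

-- The weight of the tableau whose ith row has T^j_i entries ≤ j: such a tableau
-- has T^j_1 + ⋯ + T^j_j entries ≤ j altogether.

weightGT : {ν : Partition n} → GT n ν → Fin n → ℕ
weightGT S k = Vec.sum (T S (suc (toℕ k)) (Fin.toℕ<n k)) ∸ Vec.sum (T S (toℕ k) (<⇒≤ (Fin.toℕ<n k)))

record POP (n : ℕ) (ν : Partition n) : Set where
  field
    pr : GT n ν
    Λ  : ∀ j .(j<n : j < n) (i : Fin j) → Box (NE pr j j<n i) (SE pr j j<n i)

open POP public

-- _≋_ compares vectors of possibly different lengths (and fails if they differ):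
-- here the lengths NE agree only by the first component.

infix 4 _≈POP_

_≈POP_ : {ν ν′ : Partition n} → POP n ν → POP n ν′ → Set
_≈POP_ {n} P P′ =
  pr P ≈GT pr P′ ×
  (∀ j .(j<n : j < n) i → parts (partition (Λ P j j<n i)) ≋ parts (partition (Λ P′ j j<n i)))

POP-setoid : (n : ℕ) → Partition n → Setoid 0ℓ 0ℓ
POP-setoid n ν = record
  { Carrier       = POP n ν
  ; _≈_           = _≈POP_
  ; isEquivalence = record
    { refl  = (λ j j≤n → refl) , λ j j<n i → ≋-refl
    ; sym   = λ (S , L) → (λ j j≤n → sym (S j j≤n)) , λ j j<n i → ≋-sym (L j j<n i)
    ; trans = λ (S , L) (S′ , L′) →
        (λ j j≤n → trans (S j j≤n) (S′ j j≤n)) , λ j j<n i → ≋-trans (L j j<n i) (L′ j j<n i)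
    }
  }

∣_∣Λ : {ν : Partition n} → POP n ν → ℕ
∣_∣Λ {n} P = ∑[ j < n ] ∑[ i < toℕ j ] size (partition (Λ P (toℕ j) (Fin.toℕ<n j) i))

boxcomp : {ν : Partition n} → POP n ν → POP n ν
boxcomp P = record
  { pr = pr P
  ; Λ  = λ j j<n i → complement (Λ P j j<n i)
  }

record ⨆≺ (ν : Partition (suc n)) (X : Partition n → Set) : Set where
  constructor over
  field
    index     : Partition n
    index≺    : parts index ≺ parts ν
    component : X index

infix 4 _≈⨆_

_≈⨆_ : {ν : Partition (suc n)} → ⨆≺ ν (POP n) → ⨆≺ ν (POP n) → Set
over μ _ P ≈⨆ over μ′ _ P′ = μ ≡ μ′ × P ≈POP P′

⨆-map : {ν : Partition (suc n)} {X Y : Partition n → Set} →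
        (∀ μ → X μ → Y μ) → ⨆≺ ν X → ⨆≺ ν Y
⨆-map f (over μ μ≺ν x) = over μ μ≺ν (f μ x)

≺⇒decreasing : {μ : Vec ℕ n} (ν : Partition (suc n)) → μ ≺ parts ν →
               ∀ {i j} → i Fin.≤ j → lookup μ j ≤ lookup μ i
≺⇒decreasing {μ = μ} ν μ≺ν {i} {j} i≤j with toℕ i ≟ toℕ j
... | yes i≡j = ≤-reflexive (cong (lookup μ) (sym (Fin.toℕ-injective i≡j)))
... | no  i≢j = ≤-trans (proj₁ (μ≺ν j)) (≤-trans (part-mono ν 1+i≤j) (proj₂ (μ≺ν i)))
  where
  1+i≤j : suc i Fin.≤ inject₁ j
  1+i≤j = subst (suc (toℕ i) ≤_) (sym (Fin.toℕ-inject₁ j)) (≤∧≢⇒< i≤j i≢j)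

br : {ν : Partition (suc n)} → POP (suc n) ν → ⨆≺ ν (POP n)
br {n} {ν} P = over (mkPartition μ (≺⇒decreasing {μ = μ} ν μ≺ν)) μ≺ν record
  { pr = record
    { T         = λ j j≤n → T (pr P) j (m≤n⇒m≤1+n j≤n)
    ; top       = refl
    ; interlace = λ j j<n → interlace (pr P) j (m≤n⇒m≤1+n j<n)
    }
  ; Λ  = λ j j<n → Λ P j (m≤n⇒m≤1+n j<n)
  }
  where
  μ : Vec ℕ n
  μ = T (pr P) n (n≤1+n n)

  μ≺ν : μ ≺ parts ν
  μ≺ν = subst (μ ≺_) (top (pr P)) (interlace (pr P) n ≤-refl)

rowEntries : {ν : Partition n} → CSF n ν → Fin n → List (Fin n)
rowEntries F r = List.tabulate λ c → entry F (cell r c)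

sortedRow : {ν : Partition n} → CSF n ν → Fin n → List (Fin n)
sortedRow {n} F r = sort (Fin.≤-decTotalOrder n) (rowEntries F r)

-- The identification of tableaux with GT patterns: T^j_i is the number of
-- entries ≤ j in row i, an entry being suc (toℕ x).

atMost? : (j : ℕ) → Decidable {A = Fin n} (λ x → suc (toℕ x) ≤ j)
atMost? j x = suc (toℕ x) ≤? j

#atMost : ℕ → List (Fin n) → ℕ
#atMost j xs = length (filter (atMost? j) xs)

#atMost-sorted : {ν : Partition n} (F : CSF n ν) (j : ℕ) (r : Fin n) →
                 #atMost j (sortedRow F r) ≡ #atMost j (rowEntries F r)
#atMost-sorted {n} F j r =
  ↭-length (filter-↭ _ (sort-↭ (Fin.≤-decTotalOrder n) (rowEntries F r)))

#atMost-mono : ∀ {j k a b} (f : Fin a → Fin n) (g : Fin b → Fin n) (a≤b : a ≤ b) →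
               (∀ c → toℕ (f c) < j → toℕ (g (inject≤ c a≤b)) < k) →
               #atMost j (List.tabulate f) ≤ #atMost k (List.tabulate g)
#atMost-mono {a = zero} f g a≤b h = z≤n
#atMost-mono {j = j} {k} {suc a} {suc b} f g a≤b h
  with suc (toℕ (f zero)) ≤? j | suc (toℕ (g zero)) ≤? k
     | #atMost-mono {j = j} {k} (f ∘ suc) (g ∘ suc) (s≤s⁻¹ a≤b) (h ∘ suc)
... | yes p | yes q | ih
  rewrite filter-accept (atMost? j) {xs = List.tabulate (f ∘ suc)} p
        | filter-accept (atMost? k) {xs = List.tabulate (g ∘ suc)} q = s≤s ih
... | yes p | no ¬q | ih = ⊥-elim (¬q (h zero p))
... | no ¬p | yes q | ih
  rewrite filter-reject (atMost? j) {xs = List.tabulate (f ∘ suc)} ¬p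
        | filter-accept (atMost? k) {xs = List.tabulate (g ∘ suc)} q = m≤n⇒m≤1+n ih
... | no ¬p | no ¬q | ih
  rewrite filter-reject (atMost? j) {xs = List.tabulate (f ∘ suc)} ¬p
        | filter-reject (atMost? k) {xs = List.tabulate (g ∘ suc)} ¬q = ih

#atMost-all : (xs : List (Fin n)) → #atMost n xs ≡ length xs
#atMost-all {n} xs = cong length (filter-all (atMost? n) (All.universal Fin.toℕ<n xs))

rsort : {ν : Partition n} → CSF n ν → GT n ν
rsort {n} {ν} F = record
  { T         = pattern′
  ; top       = trans (tabulate-cong top′) (tabulate∘lookup (parts ν))
  ; interlace = λ j j<n i → ne j j<n i , se j j<n i
  }
  where
  pattern′ : ∀ j → .(j ≤ n) → Vec ℕ j
  pattern′ j j≤n = Vec.tabulate λ i → #atMost j (sortedRow F (inject≤ i j≤n))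

  lookup-pattern : ∀ j .(j≤n : j ≤ n) i r → toℕ i ≡ toℕ r →
                   lookup (pattern′ j j≤n) i ≡ #atMost j (rowEntries F r)
  lookup-pattern j j≤n i r i≡r =
    trans (lookup∘tabulate _ i)
      (trans (#atMost-sorted F j (inject≤ i j≤n))
        (cong (#atMost j ∘ rowEntries F)
          (Fin.toℕ-injective (trans (Fin.toℕ-inject≤ i j≤n) i≡r))))

  top′ : ∀ i → #atMost n (sortedRow F (inject≤ i ≤-refl)) ≡ part ν i
  top′ i = trans (#atMost-sorted F n _)
    (trans (cong (#atMost n ∘ rowEntries F) (Fin.toℕ-injective (Fin.toℕ-inject≤ i ≤-refl)))
      (trans (#atMost-all (rowEntries F i)) (length-tabulate _)))

  ne : ∀ j .(j<n : j < n) i →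
       lookup (pattern′ j (<⇒≤ j<n)) i ≤ lookup (pattern′ (suc j) j<n) (inject₁ i)
  ne j j<n i = subst₂ _≤_
    (sym (lookup-pattern j (<⇒≤ j<n) i r (sym (Fin.toℕ-inject≤ i _))))
    (sym (lookup-pattern (suc j) j<n (inject₁ i) r
      (trans (Fin.toℕ-inject₁ i) (sym (Fin.toℕ-inject≤ i _)))))
    (#atMost-mono {j = j} {suc j} (λ c → entry F (cell r c)) (λ c → entry F (cell r c)) ≤-refl
      λ c p → subst (λ c′ → toℕ (entry F (cell r c′)) < suc j)
        (Fin.toℕ-injective (sym (Fin.toℕ-inject≤ c ≤-refl))) (m≤n⇒m≤1+n p))
    where
    r : Fin n
    r = inject≤ i (<⇒≤ j<n)

  se : ∀ j .(j<n : j < n) i →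
       lookup (pattern′ (suc j) j<n) (suc i) ≤ lookup (pattern′ j (<⇒≤ j<n)) i
  se j j<n i = subst₂ _≤_
    (sym (lookup-pattern (suc j) j<n (suc i) r′ (sym (Fin.toℕ-inject≤ (suc i) j<n))))
    (sym (lookup-pattern j (<⇒≤ j<n) i r (sym (Fin.toℕ-inject≤ i _))))
    (#atMost-mono {j = suc j} {j} (λ c → entry F (cell r′ c)) (λ c → entry F (cell r c))
      (part-mono ν (<⇒≤ r<r′))
      λ c p → <-≤-trans (increasing F (Fin.toℕ-inject≤ c _) r<r′) (s≤s⁻¹ p))
    where
    r r′ : Fin n
    r  = inject≤ i (<⇒≤ j<n)
    r′ = inject≤ (suc i) j<n

    r<r′ : r Fin.< r′
    r<r′ = ≤-reflexive
      (trans (cong suc (Fin.toℕ-inject≤ i (<⇒≤ j<n))) (sym (Fin.toℕ-inject≤ (suc i) j<n)))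

Column : ℕ → Set
Column n = List (Fin n)

-- a ⟨ i ⟩ is the positive integer a_i for 1 ≤ i ≤ length a; a ⟨ 0 ⟩ = 0 is
-- the convention a_0 = 0, and the value 0 beyond the end is not used when
-- splicing σ and τ with length σ < length τ.

infix 8 _⟨_⟩

_⟨_⟩ : Column n → ℕ → ℕ
a       ⟨ zero ⟩        = 0
[]      ⟨ suc i ⟩       = 0
(x ∷ a) ⟨ suc zero ⟩    = suc (toℕ x)
(x ∷ a) ⟨ suc (suc i) ⟩ = a ⟨ suc i ⟩

-- The greatest p ≤ k such that p = 0 or σ_p < τ_{p+1}.  As σ_0 = 0 < τ_1, for
-- k = length σ this is m - 1 with m = max {1 ≤ i ≤ k + 1 : σ_{i-1} < τ_i}.

spliceIndex : Column n → Column n → ℕ → ℕ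
spliceIndex σ τ zero    = zero
spliceIndex σ τ (suc p) with σ ⟨ suc p ⟩ <? τ ⟨ suc (suc p) ⟩
... | yes _ = suc p
... | no  _ = spliceIndex σ τ p

splice : Column n → Column n → Column n × Column n
splice σ τ = take p σ ++ drop p τ , take p τ ++ drop p σ
  where
  p : ℕ
  p = spliceIndex σ τ (length σ)

entryAt : {ν : Partition n} → CSF n ν → ℕ → Fin n → Maybe (Fin n)
entryAt {ν = ν} F c r with c <? part ν r
... | yes c<νr = just (entry F (cell r (fromℕ< c<νr)))
... | no  _    = nothing

columns : {ν : Partition (suc n)} → CSF (suc n) ν → List (Column (suc n))
columns {ν = ν} F = applyUpTo (λ c → mapMaybe (entryAt F c) (allFin _)) (part ν zero)

notMax : Fin (suc n) → Maybe (Fin n)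
notMax {n} x with n ≟ toℕ x
... | yes _   = nothing
... | no  n≢x = just (lower₁ x n≢x)

deleteMax : Column (suc n) → Column n
deleteMax = mapMaybe notMax

infix 4 _⟶_

data _⟶_ {n} : List (Column n) → List (Column n) → Set where
  here  : ∀ {σ τ cs} → length σ < length τ →
          σ ∷ τ ∷ cs ⟶ proj₁ (splice σ τ) ∷ proj₂ (splice σ τ) ∷ cs
  there : ∀ {σ cs cs′} → cs ⟶ cs′ → σ ∷ cs ⟶ σ ∷ cs′

-- Columns arranged in partition shape (apart from empty columns at the end).

PartitionShaped : List (Column n) → Set
PartitionShaped = AllPairs λ σ τ → length τ ≤ length σ

-- The result of splicing until the shape is a partition does not depend on the
-- choices made; here the greatest possible j is chosen at each step.  That this
-- is a run of the process, ending in partition shape, is `spliceAll-⟶` together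
-- with `spliceAll-shaped`.

insert : Column n → List (Column n) → List (Column n)
insert σ []       = σ ∷ []
insert σ (τ ∷ cs) with length σ <? length τ
... | yes _ = proj₁ (splice σ τ) ∷ insert (proj₂ (splice σ τ)) cs
... | no  _ = σ ∷ τ ∷ cs

spliceAll : List (Column n) → List (Column n)
spliceAll []       = []
spliceAll (σ ∷ cs) = insert σ (spliceAll cs)

insert-⟶ : (σ : Column n) (cs : List (Column n)) → Star _⟶_ (σ ∷ cs) (insert σ cs)
insert-⟶ σ []       = ε
insert-⟶ σ (τ ∷ cs) with length σ <? length τ
... | yes k<ℓ = here k<ℓ ◅ gmap (_ ∷_) there (insert-⟶ _ cs)
... | no  _   = ε

spliceAll-⟶ : (cs : List (Column n)) → Star _⟶_ cs (spliceAll cs)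
spliceAll-⟶ []       = ε
spliceAll-⟶ (σ ∷ cs) = gmap (σ ∷_) there (spliceAll-⟶ cs) ◅◅ insert-⟶ σ (spliceAll cs)

_!?_ : List A → ℕ → Maybe A
[]       !? i     = nothing
(x ∷ xs) !? zero  = just x
(x ∷ xs) !? suc i = xs !? i

-- As the column lengths decrease, collecting the entries at height i of all the
-- columns leaves each of them in its own column.

rowAt : ℕ → List (Column n) → List (Fin n)
rowAt i = mapMaybe (_!? i)

Increasing : Column n → Set
Increasing a = ∀ {i j} → i < j → j ≤ length a → a ⟨ i ⟩ < a ⟨ j ⟩

increasing-≤ : {a : Column n} → Increasing a → ∀ {i j} → i ≤ j → j ≤ length a → a ⟨ i ⟩ ≤ a ⟨ j ⟩
increasing-≤ {a = a} inc i≤j j≤a with m≤n⇒m<n∨m≡n i≤j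
... | inj₁ i<j  = <⇒≤ (inc i<j j≤a)
... | inj₂ refl = ≤-refl

positive : (a : Column n) → ∀ {j} → 0 < j → j ≤ length a → 0 < a ⟨ j ⟩
positive (x ∷ a) {suc zero}    _ _         = s≤s z≤n
positive (x ∷ a) {suc (suc j)} _ (s≤s j≤a) = positive a (s≤s z≤n) j≤a

all⟨⟩ : {P : Fin n → Set} (Q : ℕ → Set) → (∀ x → P x → Q (suc (toℕ x))) →
        {a : Column n} → All P a → ∀ {j} → suc j ≤ length a → Q (a ⟨ suc j ⟩)
all⟨⟩ Q f {x ∷ a} (px ∷ pa) {zero}  _         = f x px
all⟨⟩ Q f {x ∷ a} (px ∷ pa) {suc j} (s≤s j<a) = all⟨⟩ Q f pa j<a

fromAllPairs : {a : Column n} → AllPairs Fin._<_ a → Increasing a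
fromAllPairs {a = a} _ {zero} 0<j j≤a = positive a 0<j j≤a
fromAllPairs {a = x ∷ _} (p ∷ ps) {suc zero} {suc (suc j)} _ (s≤s j≤a) =
  all⟨⟩ (suc (toℕ x) <_) (λ _ x<y → s≤s x<y) p j≤a
fromAllPairs (p ∷ ps) {suc (suc i)} {suc (suc j)} (s≤s i<j) (s≤s j≤a) = fromAllPairs ps i<j j≤a
fromAllPairs {a = []} _ {suc i} {suc j} _ ()
fromAllPairs (p ∷ ps) {suc i} {suc zero} (s≤s ()) _

!?-⟨⟩ : (a : Column n) (i : ℕ) {x : Fin n} → a !? i ≡ just x →
        suc i ≤ length a × a ⟨ suc i ⟩ ≡ suc (toℕ x)
!?-⟨⟩ (x ∷ a) zero    refl = s≤s z≤n , refl
!?-⟨⟩ (x ∷ a) (suc i) eq   = let p , q = !?-⟨⟩ a i eq in s≤s p , q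

!?-just : (a : List A) (i : ℕ) → i < length a → Σ[ x ∈ A ] a !? i ≡ just x
!?-just (x ∷ a) zero    _         = x , refl
!?-just (x ∷ a) (suc i) (s≤s i<a) = !?-just a i i<a

!?-nothing : (a : List A) (i : ℕ) → length a ≤ i → a !? i ≡ nothing
!?-nothing []      i       _         = refl
!?-nothing (x ∷ a) (suc i) (s≤s a≤i) = !?-nothing a i a≤i

!?-increasing : {a : Column n} → Increasing a → ∀ {i j x y} → i < j →
                a !? i ≡ just x → a !? j ≡ just y → x Fin.< y
!?-increasing {a = a} inc {i} {j} i<j ei ej with !?-⟨⟩ a i ei | !?-⟨⟩ a j ej
... | _ , eqᵢ | j<a , eqⱼ = s≤s⁻¹ (subst₂ _<_ eqᵢ eqⱼ (inc (s≤s i<j) j<a))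

spliceIndex-≤ : (σ τ : Column n) (k : ℕ) → spliceIndex σ τ k ≤ k
spliceIndex-≤ σ τ zero    = z≤n
spliceIndex-≤ σ τ (suc k) with σ ⟨ suc k ⟩ <? τ ⟨ suc (suc k) ⟩
... | yes _ = ≤-refl
... | no  _ = m≤n⇒m≤1+n (spliceIndex-≤ σ τ k)

spliceIndex-holds : (σ τ : Column n) (k : ℕ) → 0 < length τ →
  let p = spliceIndex σ τ k in σ ⟨ p ⟩ < τ ⟨ suc p ⟩
spliceIndex-holds σ τ zero    0<τ = positive τ (s≤s z≤n) 0<τ
spliceIndex-holds σ τ (suc k) 0<τ with σ ⟨ suc k ⟩ <? τ ⟨ suc (suc k) ⟩
... | yes q = q
... | no  _ = spliceIndex-holds σ τ k 0<τ

spliceIndex-max : (σ τ : Column n) (k : ℕ) → ∀ {q} → spliceIndex σ τ k < q → q ≤ k →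
                  τ ⟨ suc q ⟩ ≤ σ ⟨ q ⟩
spliceIndex-max σ τ zero    p<q q≤k = ⊥-elim (<⇒≱ p<q (≤-trans q≤k z≤n))
spliceIndex-max σ τ (suc k) p<q q≤k with σ ⟨ suc k ⟩ <? τ ⟨ suc (suc k) ⟩
... | yes _ = ⊥-elim (<⇒≱ p<q q≤k)
... | no ¬q with m≤n⇒m<n∨m≡n q≤k
...   | inj₁ q<1+k = spliceIndex-max σ τ k p<q (s≤s⁻¹ q<1+k)
...   | inj₂ refl  = ≮⇒≥ ¬q

length-graft : (p : ℕ) (a b : List A) → p ≤ length a → p ≤ length b →
               length (take p a ++ drop p b) ≡ length b
length-graft zero    a       b       _         _         = refl
length-graft (suc p) (x ∷ a) (y ∷ b) (s≤s p≤a) (s≤s p≤b) = cong suc (length-graft p a b p≤a p≤b)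

graft-low : (p : ℕ) (a b : Column n) → p ≤ length a → ∀ {i} → i ≤ p →
            (take p a ++ drop p b) ⟨ i ⟩ ≡ a ⟨ i ⟩
graft-low p       a       b _         {zero}        _         = refl
graft-low (suc p) (x ∷ a) b _         {suc zero}    _         = refl
graft-low (suc p) (x ∷ a) [] (s≤s p≤a) {suc (suc i)} (s≤s i≤p) =
  trans (cong (λ b → (take p a ++ b) ⟨ suc i ⟩) (sym (drop-[] p))) (graft-low p a [] p≤a i≤p)
  where
  drop-[] : ∀ p → drop {A = A} p [] ≡ []
  drop-[] zero    = refl
  drop-[] (suc p) = refl
graft-low (suc p) (x ∷ a) (y ∷ b) (s≤s p≤a) {suc (suc i)} (s≤s i≤p) = graft-low p a b p≤a i≤p

graft-high : (p : ℕ) (a b : Column n) → p ≤ length a → p ≤ length b → ∀ {i} → p < i →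
             (take p a ++ drop p b) ⟨ i ⟩ ≡ b ⟨ i ⟩
graft-high zero    a       b       _         _         {i}           _         = refl
graft-high (suc p) (x ∷ a) (y ∷ b) (s≤s p≤a) (s≤s p≤b) {suc zero}    (s≤s ())
graft-high (suc p) (x ∷ a) (y ∷ b) (s≤s p≤a) (s≤s p≤b) {suc (suc i)} (s≤s p<i) =
  graft-high p a b p≤a p≤b p<i

graft-increasing : (p : ℕ) (a b : Column n) → p ≤ length a → p ≤ length b →
  Increasing a → Increasing b → (suc p ≤ length b → a ⟨ p ⟩ < b ⟨ suc p ⟩) →
  Increasing (take p a ++ drop p b)
graft-increasing p a b p≤a p≤b incᵃ incᵇ junction {i} {j} i<j j≤ with j ≤? p | i ≤? p
... | yes j≤p | _ = subst₂ _<_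
  (sym (graft-low p a b p≤a (≤-trans (<⇒≤ i<j) j≤p))) (sym (graft-low p a b p≤a j≤p))
  (incᵃ i<j (≤-trans j≤p p≤a))
... | no j≰p | no i≰p = subst₂ _<_
  (sym (graft-high p a b p≤a p≤b (≰⇒> i≰p))) (sym (graft-high p a b p≤a p≤b (≰⇒> j≰p)))
  (incᵇ i<j (subst (_ ≤_) (length-graft p a b p≤a p≤b) j≤))
... | no j≰p | yes i≤p = subst₂ _<_
  (sym (graft-low p a b p≤a i≤p)) (sym (graft-high p a b p≤a p≤b p<j))
  (≤-<-trans (increasing-≤ incᵃ i≤p p≤a)
    (<-≤-trans (junction (≤-trans p<j j≤b)) (increasing-≤ incᵇ p<j j≤b)))
  where
  p<j = ≰⇒> j≰p
  j≤b = subst (j ≤_) (length-graft p a b p≤a p≤b) j≤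

module _ (σ τ : Column n) (k<ℓ : length σ < length τ) where

  private
    p : ℕ
    p = spliceIndex σ τ (length σ)

    p≤k : p ≤ length σ
    p≤k = spliceIndex-≤ σ τ (length σ)

    p≤ℓ : p ≤ length τ
    p≤ℓ = ≤-trans p≤k (<⇒≤ k<ℓ)

  splice-length₁ : length (proj₁ (splice σ τ)) ≡ length τ
  splice-length₁ = length-graft p σ τ p≤k p≤ℓ

  splice-length₂ : length (proj₂ (splice σ τ)) ≡ length σ
  splice-length₂ = length-graft p τ σ p≤ℓ p≤k

  splice-increasing₁ : Increasing σ → Increasing τ → Increasing (proj₁ (splice σ τ))
  splice-increasing₁ incˢ incᵗ = graft-increasing p σ τ p≤k p≤ℓ incˢ incᵗ
    λ _ → spliceIndex-holds σ τ (length σ) (≤-<-trans z≤n k<ℓ)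

  splice-increasing₂ : Increasing σ → Increasing τ → Increasing (proj₂ (splice σ τ))
  splice-increasing₂ incˢ incᵗ = graft-increasing p τ σ p≤ℓ p≤k incᵗ incˢ
    λ p<k → <-≤-trans (incᵗ (m≤n⇒m≤1+n ≤-refl) (≤-trans (s≤s p<k) k<ℓ))
      (spliceIndex-max σ τ (length σ) ≤-refl p<k)

insert-increasing : (σ : Column n) (cs : List (Column n)) → Increasing σ →
                    All Increasing cs → All Increasing (insert σ cs)
insert-increasing σ []       p _        = p ∷ []
insert-increasing σ (τ ∷ cs) p (q ∷ qs) with length σ <? length τ
... | yes k<ℓ = splice-increasing₁ σ τ k<ℓ p q
              ∷ insert-increasing _ cs (splice-increasing₂ σ τ k<ℓ p q) qs
... | no _    = p ∷ q ∷ qs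

spliceAll-increasing : (cs : List (Column n)) → All Increasing cs → All Increasing (spliceAll cs)
spliceAll-increasing []       _        = []
spliceAll-increasing (σ ∷ cs) (p ∷ ps) =
  insert-increasing σ (spliceAll cs) p (spliceAll-increasing cs ps)

insert-bound : ∀ {b} (σ : Column n) (cs : List (Column n)) → length σ ≤ b →
               All (λ c → length c ≤ b) cs → All (λ c → length c ≤ b) (insert σ cs)
insert-bound σ []       p _        = p ∷ []
insert-bound σ (τ ∷ cs) p (q ∷ qs) with length σ <? length τ
... | yes k<ℓ = subst (_≤ _) (sym (splice-length₁ σ τ k<ℓ)) q
              ∷ insert-bound _ cs (subst (_≤ _) (sym (splice-length₂ σ τ k<ℓ)) p) qs
... | no _    = p ∷ q ∷ qs

insert-shaped : (σ : Column n) (cs : List (Column n)) → PartitionShaped cs →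
                PartitionShaped (insert σ cs)
insert-shaped σ []       _        = [] ∷ []
insert-shaped σ (τ ∷ cs) (q ∷ qs) with length σ <? length τ
... | yes k<ℓ = subst (λ ℓ → All (λ c → length c ≤ ℓ) (insert (proj₂ (splice σ τ)) cs))
                  (sym (splice-length₁ σ τ k<ℓ))
                  (insert-bound _ cs
                    (subst (_≤ length τ) (sym (splice-length₂ σ τ k<ℓ)) (<⇒≤ k<ℓ)) q)
              ∷ insert-shaped _ cs qs
... | no k≮ℓ  = (≮⇒≥ k≮ℓ ∷ All.map (λ c≤ℓ → ≤-trans c≤ℓ (≮⇒≥ k≮ℓ)) q) ∷ q ∷ qs

spliceAll-shaped : (cs : List (Column n)) → PartitionShaped (spliceAll cs)
spliceAll-shaped []       = []
spliceAll-shaped (σ ∷ cs) = insert-shaped σ (spliceAll cs) (spliceAll-shaped cs)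

rowLength-yes : ∀ {i} (a : Column n) (cs : List (Column n)) → i < length a →
                length (rowAt i (a ∷ cs)) ≡ suc (length (rowAt i cs))
rowLength-yes {i = i} a cs i<a rewrite proj₂ (!?-just a i i<a) = refl

rowLength-no : ∀ {i} (a : Column n) (cs : List (Column n)) → ¬ (i < length a) →
               length (rowAt i (a ∷ cs)) ≡ length (rowAt i cs)
rowLength-no {i = i} a cs i≮a rewrite !?-nothing a i (≮⇒≥ i≮a) = refl

rowLength-cons : ∀ i (a : Column n) {b : Column n} {cs ds : List (Column n)} →
  length a ≡ length b → length (rowAt i cs) ≡ length (rowAt i ds) →
  length (rowAt i (a ∷ cs)) ≡ length (rowAt i (b ∷ ds))
rowLength-cons i a {b} {cs} {ds} eq eq′ with i <? length a
... | yes i<a = trans (rowLength-yes a cs i<a)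
  (trans (cong suc eq′) (sym (rowLength-yes b ds (subst (i <_) eq i<a))))
... | no  i≮a = trans (rowLength-no a cs i≮a)
  (trans eq′ (sym (rowLength-no b ds (i≮a ∘ subst (i <_) (sym eq)))))

rowLength-swap : ∀ i (a b : Column n) (cs : List (Column n)) →
                 length (rowAt i (a ∷ b ∷ cs)) ≡ length (rowAt i (b ∷ a ∷ cs))
rowLength-swap i a b cs with a !? i in eqᵃ | b !? i in eqᵇ
... | just _  | just _  rewrite eqᵃ | eqᵇ = refl
... | just _  | nothing rewrite eqᵃ | eqᵇ = refl
... | nothing | just _  rewrite eqᵃ | eqᵇ = refl
... | nothing | nothing rewrite eqᵃ | eqᵇ = refl

insert-rowLength : (i : ℕ) (σ : Column n) (cs : List (Column n)) →
                   length (rowAt i (insert σ cs)) ≡ length (rowAt i (σ ∷ cs))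
insert-rowLength i σ []       = refl
insert-rowLength i σ (τ ∷ cs) with length σ <? length τ
... | no _    = refl
... | yes k<ℓ = trans
  (rowLength-cons i σ̄ {τ} {insert τ̄ cs} {σ ∷ cs} (splice-length₁ σ τ k<ℓ)
    (trans (insert-rowLength i τ̄ cs) (rowLength-cons i τ̄ {σ} {cs} {cs} (splice-length₂ σ τ k<ℓ) refl)))
  (rowLength-swap i τ σ cs)
  where
  σ̄ = proj₁ (splice σ τ)
  τ̄ = proj₂ (splice σ τ)

spliceAll-rowLength : (i : ℕ) (cs : List (Column n)) →
                      length (rowAt i (spliceAll cs)) ≡ length (rowAt i cs)
spliceAll-rowLength i []       = refl
spliceAll-rowLength i (σ ∷ cs) = trans (insert-rowLength i σ (spliceAll cs))
  (rowLength-cons i σ {σ} {spliceAll cs} {cs} refl (spliceAll-rowLength i cs))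

rowLength-mono : ∀ {i j} (f : Column m → Column n) (cs : List (Column m)) →
  All (λ c → i < length c → j < length (f c)) cs →
  length (rowAt i cs) ≤ length (rowAt j (List.map f cs))
rowLength-mono f [] _ = z≤n
rowLength-mono {i = i} {j} f (c ∷ cs) (h ∷ hs)
  with i <? length c | j <? length (f c) | rowLength-mono {i = i} {j} f cs hs
... | yes p | yes q | ih
  rewrite rowLength-yes c cs p | rowLength-yes (f c) (List.map f cs) q = s≤s ih
... | yes p | no ¬q | ih = ⊥-elim (¬q (h p))
... | no ¬p | yes q | ih
  rewrite rowLength-no c cs ¬p | rowLength-yes (f c) (List.map f cs) q = m≤n⇒m≤1+n ih
... | no ¬p | no ¬q | ih
  rewrite rowLength-no c cs ¬p | rowLength-no (f c) (List.map f cs) ¬q = ih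

rowLength-mono⁻ : ∀ {i j} (f : Column m → Column n) (cs : List (Column m)) →
  All (λ c → j < length (f c) → i < length c) cs →
  length (rowAt j (List.map f cs)) ≤ length (rowAt i cs)
rowLength-mono⁻ f [] _ = z≤n
rowLength-mono⁻ {i = i} {j} f (c ∷ cs) (h ∷ hs)
  with i <? length c | j <? length (f c) | rowLength-mono⁻ {i = i} {j} f cs hs
... | yes p | yes q | ih
  rewrite rowLength-yes c cs p | rowLength-yes (f c) (List.map f cs) q = s≤s ih
... | no ¬p | yes q | ih = ⊥-elim (¬p (h q))
... | yes p | no ¬q | ih
  rewrite rowLength-yes c cs p | rowLength-no (f c) (List.map f cs) ¬q = m≤n⇒m≤1+n ih
... | no ¬p | no ¬q | ih
  rewrite rowLength-no c cs ¬p | rowLength-no (f c) (List.map f cs) ¬q = ih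

rowLength-applyUpTo : ∀ {i v} (f : ℕ → Column n) (k : ℕ) → v ≤ k →
  (∀ c → c < v → i < length (f c)) → (∀ c → i < length (f c) → c < v) →
  length (rowAt i (applyUpTo f k)) ≡ v
rowLength-applyUpTo f zero z≤n _ _ = refl
rowLength-applyUpTo {v = zero} f (suc k) _ to from =
  trans (rowLength-no (f 0) (applyUpTo (f ∘ suc) k) (n≮0 ∘ from 0))
    (rowLength-applyUpTo (f ∘ suc) k z≤n (λ _ ()) (λ c q → ⊥-elim (n≮0 (from (suc c) q))))
rowLength-applyUpTo {v = suc v} f (suc k) (s≤s v≤k) to from =
  trans (rowLength-yes (f 0) (applyUpTo (f ∘ suc) k) (to 0 (s≤s z≤n)))
    (cong suc (rowLength-applyUpTo (f ∘ suc) k v≤k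
      (λ c q → to (suc c) (s≤s q)) (λ c q → s≤s⁻¹ (from (suc c) q))))

mapMaybe-all : {P : A → Set} {Q : B → Set} (f : A → Maybe B) →
  (∀ {x y} → P x → f x ≡ just y → Q y) → ∀ {xs} → All P xs → All Q (mapMaybe f xs)
mapMaybe-all f h {[]} _ = []
mapMaybe-all f h {x ∷ xs} (p ∷ ps) with f x in eq
... | just y  = h p eq ∷ mapMaybe-all f h ps
... | nothing = mapMaybe-all f h ps

mapMaybe-allPairs : {R : A → A → Set} {S : B → B → Set} (f : A → Maybe B) →
  (∀ {x x′ y y′} → R x x′ → f x ≡ just y → f x′ ≡ just y′ → S y y′) →
  ∀ {xs} → AllPairs R xs → AllPairs S (mapMaybe f xs)
mapMaybe-allPairs f h {[]} _ = []
mapMaybe-allPairs f h {x ∷ xs} (p ∷ ps) with f x in eq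
... | just y  = mapMaybe-all f (λ r eq′ → h r eq eq′) p ∷ mapMaybe-allPairs f h ps
... | nothing = mapMaybe-allPairs f h ps

mapMaybe-none : (f : A → Maybe B) (g : Fin n → A) → (∀ i → f (g i) ≡ nothing) →
                mapMaybe f (List.tabulate g) ≡ []
mapMaybe-none {n = zero}  f g h = refl
mapMaybe-none {n = suc n} f g h rewrite h zero = mapMaybe-none f (g ∘ suc) (h ∘ suc)

mapMaybe-prefix : (f : A → Maybe B) (g : Fin n → A) (P : Fin n → Set) →
  (∀ i → P i → Σ[ y ∈ B ] f (g i) ≡ just y) → (∀ i → ¬ P i → f (g i) ≡ nothing) →
  Decidable P → (∀ {i j} → i Fin.≤ j → P j → P i) →
  ∀ i → (P i → toℕ i < length (mapMaybe f (List.tabulate g))) ×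
        (toℕ i < length (mapMaybe f (List.tabulate g)) → P i)
mapMaybe-prefix {n = suc n} f g P yes′ no′ P? down i with P? zero
... | no ¬p rewrite no′ zero ¬p
                  | mapMaybe-none f (g ∘ suc) (λ j → no′ (suc j) λ q → ¬p (down z≤n q)) =
  (λ q → ⊥-elim (¬p (down z≤n q))) , λ ()
mapMaybe-prefix {n = suc n} f g P yes′ no′ P? down zero | yes p
  rewrite proj₂ (yes′ zero p) = (λ _ → s≤s z≤n) , λ _ → p
mapMaybe-prefix {n = suc n} f g P yes′ no′ P? down (suc i) | yes p
  rewrite proj₂ (yes′ zero p) =
    let to , from = mapMaybe-prefix f (g ∘ suc) (P ∘ suc) (yes′ ∘ suc) (no′ ∘ suc) (P? ∘ suc)
                      (λ i≤j → down (s≤s i≤j)) i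
    in (λ q → s≤s (to q)) , λ q → from (s≤s⁻¹ q)

entryAt-just : {ν : Partition n} (F : CSF n ν) → ∀ {c r x} → entryAt F c r ≡ just x →
               Σ[ q ∈ c < part ν r ] x ≡ entry F (cell r (fromℕ< q))
entryAt-just {ν = ν} F {c} {r} eq with c <? part ν r
entryAt-just F refl | yes q = q , refl

module _ {ν : Partition (suc n)} (F : CSF (suc n) ν) where

  column-allPairs : ∀ c → AllPairs Fin._<_ (mapMaybe (entryAt F c) (allFin _))
  column-allPairs c = mapMaybe-allPairs (entryAt F c) mono (AllPairs.tabulate⁺-< id)
    where
    mono : ∀ {r r′ x y} → r Fin.< r′ → entryAt F c r ≡ just x → entryAt F c r′ ≡ just y →
           x Fin.< y
    mono r<r′ eq eq′ with entryAt-just F eq | entryAt-just F eq′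
    ... | q , refl | q′ , refl =
      increasing F (trans (Fin.toℕ-fromℕ< q) (sym (Fin.toℕ-fromℕ< q′))) r<r′

  column-length : ∀ c i →
    (c < part ν i → toℕ i < length (mapMaybe (entryAt F c) (allFin _))) ×
    (toℕ i < length (mapMaybe (entryAt F c) (allFin _)) → c < part ν i)
  column-length c = mapMaybe-prefix (entryAt F c) id (λ r → c < part ν r) yes′ no′
    (λ r → c <? part ν r) (λ i≤j c<νj → <-≤-trans c<νj (part-mono ν i≤j))
    where
    yes′ : ∀ r → c < part ν r → Σ[ x ∈ _ ] entryAt F c r ≡ just x
    yes′ r q with c <? part ν r
    ... | yes _ = _ , refl
    ... | no ¬q = ⊥-elim (¬q q)

    no′ : ∀ r → ¬ (c < part ν r) → entryAt F c r ≡ nothing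
    no′ r ¬q with c <? part ν r
    ... | yes q = ⊥-elim (¬q q)
    ... | no _  = refl

  columns-rowLength : ∀ i → length (rowAt (toℕ i) (columns F)) ≡ part ν i
  columns-rowLength i = rowLength-applyUpTo _ (part ν zero) (part-mono ν z≤n)
    (λ c → proj₁ (column-length c i)) (λ c → proj₂ (column-length c i))

  columns-allPairs : All (AllPairs Fin._<_) (columns F)
  columns-allPairs = All.applyUpTo⁺₂ _ _ column-allPairs

notMax-just : {x : Fin (suc n)} {y : Fin n} → notMax x ≡ just y → toℕ y ≡ toℕ x
notMax-just {n} {x} eq with n ≟ toℕ x
notMax-just {x = x} refl | no n≢x = Fin.toℕ-lower₁ x n≢x

deleteMax-increasing : {a : Column (suc n)} → AllPairs Fin._<_ a → Increasing (deleteMax a)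
deleteMax-increasing = fromAllPairs ∘ mapMaybe-allPairs notMax λ x<x′ eq eq′ →
  subst₂ _<_ (sym (notMax-just eq)) (sym (notMax-just eq′)) x<x′

deleteMax-length≤ : (a : Column (suc n)) → length (deleteMax a) ≤ length a
deleteMax-length≤ []      = z≤n
deleteMax-length≤ (x ∷ a) with notMax x
... | just _  = s≤s (deleteMax-length≤ a)
... | nothing = m≤n⇒m≤1+n (deleteMax-length≤ a)

deleteMax-length≥ : {a : Column (suc n)} → AllPairs Fin._<_ a → length a ≤ suc (length (deleteMax a))
deleteMax-length≥ [] = z≤n
deleteMax-length≥ {n} {x ∷ a} (p ∷ ps) with n ≟ toℕ x
... | no _ = s≤s (deleteMax-length≥ ps)
deleteMax-length≥ {n} {x ∷ []}    (p ∷ ps)        | yes _   = s≤s z≤n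
deleteMax-length≥ {n} {x ∷ y ∷ a} ((x<y ∷ _) ∷ _) | yes n≡x =
  ⊥-elim (<⇒≱ x<y (subst (toℕ y ≤_) n≡x (s≤s⁻¹ (Fin.toℕ<n y))))

rowLength-anti : ∀ {i j} → i ≤ j → (cs : List (Column n)) →
                 length (rowAt j cs) ≤ length (rowAt i cs)
rowLength-anti {i = i} {j} i≤j cs = subst (λ ds → length (rowAt j ds) ≤ length (rowAt i cs)) (map-id cs)
  (rowLength-mono⁻ id cs (All.universal (λ _ j<c → ≤-<-trans i≤j j<c) cs))

rowAt-empty : ∀ {i} (cs : List (Column n)) → All (λ c → length c ≤ i) cs → rowAt i cs ≡ []
rowAt-empty []       _        = refl
rowAt-empty {i = i} (c ∷ cs) (p ∷ ps) rewrite !?-nothing c i p = rowAt-empty cs ps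

⊥-Fin[] : ∀ {xs : List A} → xs ≡ [] → ¬ Fin (length xs)
⊥-Fin[] refl ()

rowAt-increasing : ∀ {i j} → i < j → (cs : List (Column n)) → PartitionShaped cs →
  All Increasing cs → (c : Fin (length (rowAt i cs))) (c′ : Fin (length (rowAt j cs))) →
  toℕ c ≡ toℕ c′ → List.lookup (rowAt i cs) c Fin.< List.lookup (rowAt j cs) c′
rowAt-increasing {i = i} {j} i<j (a ∷ cs) (s ∷ ss) (p ∷ ps) c c′ eq with j <? length a
... | no j≮a rewrite !?-nothing a j (≮⇒≥ j≮a) =
  ⊥-elim (⊥-Fin[] (rowAt-empty cs (All.map (λ b≤a → ≤-trans b≤a (≮⇒≥ j≮a)) s)) c′)
... | yes j<a with a !? i in eqᵢ | a !? j in eqⱼ | !?-just a i (<-trans i<j j<a) | !?-just a j j<a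
rowAt-increasing i<j (a ∷ cs) (s ∷ ss) (p ∷ ps) zero zero eq
  | yes j<a | just x | just y | _ | _ = !?-increasing p i<j eqᵢ eqⱼ
rowAt-increasing i<j (a ∷ cs) (s ∷ ss) (p ∷ ps) (suc c) (suc c′) eq
  | yes j<a | just x | just y | _ | _ = rowAt-increasing i<j cs ss ps c c′ (suc-injective eq)

shape : List (Column n) → Partition n
shape cs = mkPartition (Vec.tabulate λ i → length (rowAt (toℕ i) cs))
  λ {i} {j} i≤j → subst₂ _≤_ (sym (lookup∘tabulate _ j)) (sym (lookup∘tabulate _ i))
    (rowLength-anti i≤j cs)

part-shape : (cs : List (Column n)) (i : Fin n) → part (shape cs) i ≡ length (rowAt (toℕ i) cs)
part-shape cs = lookup∘tabulate _

fromColumns : (cs : List (Column n)) → PartitionShaped cs → All Increasing cs → CSF n (shape cs)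
fromColumns cs shaped inc = record
  { entry      = λ (cell r c) → List.lookup (rowAt (toℕ r) cs) (Fin.cast (part-shape cs r) c)
  ; increasing = λ {r} {r′} {c} {c′} c≡c′ r<r′ → rowAt-increasing r<r′ cs shaped inc _ _
      (trans (Fin.toℕ-cast (part-shape cs r) c) (trans c≡c′ (sym (Fin.toℕ-cast (part-shape cs r′) c′))))
  }

dsplice : {ν : Partition (suc n)} → CSF (suc n) ν → ⨆≺ ν (CSF n)
dsplice {n} {ν} F = over (shape cs) shape≺ν (fromColumns cs (spliceAll-shaped ds)
    (spliceAll-increasing ds (All.map⁺ (All.map deleteMax-increasing (columns-allPairs F)))))
  where
  ds cs : List (Column n)
  ds = List.map deleteMax (columns F)
  cs = spliceAll ds

  shape-ds : ∀ i → part (shape cs) i ≡ length (rowAt (toℕ i) ds)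
  shape-ds i = trans (part-shape cs i) (spliceAll-rowLength (toℕ i) ds)

  shape≺ν : parts (shape cs) ≺ parts ν
  shape≺ν i =
    subst₂ _≤_
      (trans (cong (λ j → length (rowAt j ds)) (Fin.toℕ-inject₁ i)) (sym (shape-ds i)))
      (columns-rowLength F (inject₁ i))
      (rowLength-mono⁻ deleteMax (columns F)
        (All.map (λ {a} _ q → <-≤-trans q (deleteMax-length≤ a)) (columns-allPairs F))) ,
    subst₂ _≤_ (columns-rowLength F (suc i)) (sym (shape-ds i))
      (rowLength-mono deleteMax (columns F)
        (All.map (λ ps q → s≤s⁻¹ (≤-trans q (deleteMax-length≥ ps))) (columns-allPairs F)))

module Submission where

open import Defs
open import Data.Bool.Base using (Bool; true; false; if_then_else_)
open import Data.Empty using (⊥-elim)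
open import Data.Fin.Base as Fin using (Fin; zero; suc; toℕ)
open import Data.Fin.Permutation using (reverse)
import Data.Fin.Properties as Fin
import Data.Integer.Base as ℤ
import Data.Integer.Properties as ℤ
open import Data.List.Base as List
  using (List; []; _∷_; _++_; length; take; drop; applyUpTo; mapMaybe; allFin; filter)
open import Data.List.Properties
  using (∷-injective; take++drop≡id; mapMaybe-cong; map-applyUpTo; length-map; length-applyUpTo)
open import Data.List.Relation.Unary.All as All using (All; []; _∷_)
import Data.List.Relation.Unary.All.Properties as All
open import Data.List.Relation.Unary.AllPairs as AllPairs using (AllPairs; []; _∷_)
import Data.List.Relation.Unary.AllPairs.Properties as AllPairs
open import Data.Maybe.Base using (Maybe; just; nothing; maybe)
open import Data.Nat.Base
open import Data.Nat.Properties
open import Data.Nat.Tactic.RingSolver using (solve-∀)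
open import Data.Product.Base using (Σ-syntax; _×_; _,_; proj₁; proj₂; uncurry)
open import Data.Sum.Base using (_⊎_; inj₁; inj₂)
open import Data.Unit.Base using (⊤; tt)
open import Data.Vec.Base as Vec using (Vec; lookup)
open import Data.Vec.Properties using (lookup∘tabulate; tabulate∘lookup; tabulate-cong)
open import Data.Vec.Relation.Binary.Equality.Propositional using (_≋_; ≋-refl; ≋-sym; ≋-trans; ≋⇒≡)
open import Data.Vec.Relation.Binary.Pointwise.Inductive using ([]; _∷_)
open import Function.Base using (_∘_; id)
open import Function.Bundles using (Bijection)
open import Relation.Binary.Definitions using (tri<; tri≈; tri>)
open import Relation.Binary.PropositionalEquality
open import Relation.Nullary.Decidable
  using (Dec; yes; no; does; dec-true; dec-false; recompute; _×-dec_; _⊎-dec_)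
open import Relation.Nullary.Negation using (¬_)

open import Algebra.Properties.CommutativeMonoid.Sum +-0-commutativeMonoid
  using (sum; sum-cong-≗; ∑-distrib-+; ∑-comm; sum-replicate-zero; sum-permute; sum-init-last)

private
  variable
    A B : Set
    P Q : Set
    m n : ℕ

-- Entries are 0,…,n−1, and n stands for ∞ below the end of a column.  Every cell below
-- the first row of a column strict filling is a descent; subtracting the arms leaves
-- sums over pairs of columns σ, τ with σ to the left of τ: inv counts the rows r with
-- σ_{r−1} < τ_r < σ_r, and quinv the rows r with σ_r < τ_r < σ_{r+1}.  Deleting the
-- maximal entries truncates the values.  This does not change the count for inv, and the
-- one for quinv loses the pairs of columns of equal length of which only the right one
-- ends in the maximum.  A splice lowers the count for inv by exactly one and preserves
-- the one for quinv: the rows keep their multisets of entries, and at the cut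
-- two intervals exchange their right ends.  Splicing merely sorts the column lengths, so
-- inv drops by the number of pairs of columns of equal length of which only the left one
-- ends in the maximum.  These are counted by the partitions traced by the words
-- that record, for each length, which columns end in the maximum; they form the top
-- row of Λ, and the pairs lost by quinv are counted by their complements.
-- As splice (σ , τ) = (σ̄ , τ̄) implies splice (τ̄ , σ̄) = (τ , σ), the filling is recovered
-- from dsplice F and the words, and induction on n gives the bijections.

-- Finite sums

-- A splice exchanges the tails of two columns, so undoing it requires knowing that it took place.
-- `insert` decides this by comparing lengths alone; hence the column lengths just after the
-- deletion determine the whole pattern of splices, and these lengths are what the words store: in
-- each row they say which columns still reach it. Conversely, any rearrangement of the lengths of
-- the final columns can be prescribed as the lengths before splicing, which gives surjectivity.
--
-- The sums over pairs come from triples: an entry a, the entry p above it, and an entry b in a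
-- column further right. As p < a, at least one of b < a and p < b holds. Each is an inversion, and
-- the arm removes one of them, so what survives is p < b < a.
--
-- `br` and `dsplice` produce shapes and boxes that agree only propositionally. Fillings are
-- therefore compared through their columns, across shapes, and the parts of Λ are handled as plain
-- lists.

χ : Dec P → ℕ
χ P? = if does P? then 1 else 0

χ-yes : (P? : Dec P) → P → χ P? ≡ 1
χ-yes P? p rewrite dec-true P? p = refl

χ-no : (P? : Dec P) → ¬ P → χ P? ≡ 0
χ-no P? ¬p rewrite dec-false P? ¬p = refl

χ-⇔ : (P? : Dec P) (Q? : Dec Q) → (P → Q) → (Q → P) → χ P? ≡ χ Q?
χ-⇔ (yes p) Q? to from = sym (χ-yes Q? (to p))
χ-⇔ (no ¬p) Q? to from = sym (χ-no Q? (¬p ∘ from))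

-- The summand lives on all of ℕ, so that sums over rows of different lengths can be extended by
-- zero terms to one common rectangle.
∑ : ℕ → (ℕ → ℕ) → ℕ
∑ n f = sum {n} (f ∘ toℕ)

∑-cong : ∀ n {f g : ℕ → ℕ} → (∀ i → i < n → f i ≡ g i) → ∑ n f ≡ ∑ n g
∑-cong n h = sum-cong-≗ {n} (λ i → h (toℕ i) (Fin.toℕ<n i))

∑-zero : ∀ n {f : ℕ → ℕ} → (∀ i → i < n → f i ≡ 0) → ∑ n f ≡ 0
∑-zero n h = trans (∑-cong n h) (sum-replicate-zero n)

∑-+ : ∀ n (f g : ℕ → ℕ) → ∑ n (λ i → f i + g i) ≡ ∑ n f + ∑ n g
∑-+ n f g = ∑-distrib-+ {n} (f ∘ toℕ) (g ∘ toℕ)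

∑-swap : ∀ m n (f : ℕ → ℕ → ℕ) → ∑ m (λ i → ∑ n (f i)) ≡ ∑ n (λ j → ∑ m (λ i → f i j))
∑-swap m n f = ∑-comm {m} {n} (λ i j → f (toℕ i) (toℕ j))

∑-extend : ∀ {n N} (f : ℕ → ℕ) → n ≤ N → (∀ i → n ≤ i → i < N → f i ≡ 0) → ∑ n f ≡ ∑ N f
∑-extend {N = N} f z≤n       h = sym (∑-zero N (λ i → h i z≤n))
∑-extend         f (s≤s n≤N) h = cong (f 0 +_)
    (∑-extend (f ∘ suc) n≤N λ i n≤i i<N → h (suc i) (s≤s n≤i) (s≤s i<N))

∑-if : ∀ n b (f : ℕ → ℕ) → ∑ n (λ i → if b then f i else 0) ≡ (if b then ∑ n f else 0)
∑-if n true  f = refl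
∑-if n false f = ∑-zero n λ _ _ → refl

if-zero : ∀ b → (if b then 0 else 0) ≡ 0
if-zero true  = refl
if-zero false = refl

∑-last : ∀ n (f : ℕ → ℕ) → ∑ (suc n) f ≡ ∑ n f + f n
∑-last zero    f = +-identityʳ (f 0)
∑-last (suc n) f = trans (cong (f 0 +_) (∑-last n (f ∘ suc))) (sym (+-assoc (f 0) _ _))

∑-single : ∀ {n} k (f : ℕ → ℕ) → k < n → (∀ i → i ≢ k → f i ≡ 0) → ∑ n f ≡ f k
∑-single {suc n} zero f _ h = trans (cong (f 0 +_) (∑-zero n λ i _ → h (suc i) λ ())) (+-identityʳ (f 0))
∑-single {suc n} (suc k) f (s≤s k<n) h =
  trans (cong (_+ ∑ n (f ∘ suc)) (h 0 λ ()))
    (∑-single k (f ∘ suc) k<n λ i i≢k → h (suc i) (i≢k ∘ suc-injective))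

∑-χ< : ∀ {k n} → k ≤ n → ∑ n (λ i → χ (i <? k)) ≡ k
∑-χ< {k} k≤n = trans (sym (∑-extend _ k≤n λ i k≤i _ → χ-no (i <? k) (≤⇒≯ k≤i))) (ones k)
  where
  ones : ∀ k → ∑ k (λ i → χ (i <? k)) ≡ k
  ones k = trans (∑-cong k {g = λ _ → 1} λ i i<k → χ-yes (i <? k) i<k) (const k)
    where
    const : ∀ k → ∑ k (λ _ → 1) ≡ k
    const zero    = refl
    const (suc k) = cong suc (const k)

∑-mono : ∀ n {f g : ℕ → ℕ} → (∀ i → f i ≤ g i) → ∑ n f ≤ ∑ n g
∑-mono zero    h = z≤n
∑-mono (suc n) h = +-mono-≤ (h 0) (∑-mono n (h ∘ suc))

∑ᴸ : (A → ℕ) → List A → ℕ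
∑ᴸ f []       = 0
∑ᴸ f (x ∷ xs) = f x + ∑ᴸ f xs

pairs : (A → A → ℕ) → List A → ℕ
pairs h []       = 0
pairs h (x ∷ xs) = ∑ᴸ (h x) xs + pairs h xs

∑ᴸ-zero : {f : A → ℕ} → (∀ x → f x ≡ 0) → (xs : List A) → ∑ᴸ f xs ≡ 0
∑ᴸ-zero h []       = refl
∑ᴸ-zero h (x ∷ xs) = cong₂ _+_ (h x) (∑ᴸ-zero h xs)

∑ᴸ-+ : (f g : A → ℕ) (xs : List A) → ∑ᴸ (λ x → f x + g x) xs ≡ ∑ᴸ f xs + ∑ᴸ g xs
∑ᴸ-+ f g []       = refl
∑ᴸ-+ f g (x ∷ xs) rewrite ∑ᴸ-+ f g xs = interchange (f x) (g x) (∑ᴸ f xs) (∑ᴸ g xs)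
  where
  interchange : ∀ a b c d → a + b + (c + d) ≡ a + c + (b + d)
  interchange = solve-∀

∑ᴸ-cong : {f g : A → ℕ} → f ≗ g → (xs : List A) → ∑ᴸ f xs ≡ ∑ᴸ g xs
∑ᴸ-cong h []       = refl
∑ᴸ-cong h (x ∷ xs) = cong₂ _+_ (h x) (∑ᴸ-cong h xs)

∑ᴸ-∑ : ∀ n (f : ℕ → A → ℕ) (xs : List A) →
       ∑ᴸ (λ x → ∑ n (λ i → f i x)) xs ≡ ∑ n (λ i → ∑ᴸ (f i) xs)
∑ᴸ-∑ n f []       = sym (∑-zero n λ _ _ → refl)
∑ᴸ-∑ n f (x ∷ xs) = trans (cong (∑ n (λ i → f i x) +_) (∑ᴸ-∑ n f xs))
    (sym (∑-+ n (λ i → f i x) (λ i → ∑ᴸ (f i) xs)))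

∑ᴸ-map : (f : B → ℕ) (g : A → B) (xs : List A) → ∑ᴸ f (List.map g xs) ≡ ∑ᴸ (f ∘ g) xs
∑ᴸ-map f g []       = refl
∑ᴸ-map f g (x ∷ xs) = cong (f (g x) +_) (∑ᴸ-map f g xs)

∑ᴸ-applyUpTo : (f : A → ℕ) (g : ℕ → A) (n : ℕ) → ∑ᴸ f (applyUpTo g n) ≡ ∑ n (f ∘ g)
∑ᴸ-applyUpTo f g zero    = refl
∑ᴸ-applyUpTo f g (suc n) = cong (f (g 0) +_) (∑ᴸ-applyUpTo f (g ∘ suc) n)

∑< : ℕ → (ℕ → ℕ → ℕ) → ℕ
∑< n h = ∑ n λ c → ∑ n λ d → if does (c <? d) then h c d else 0

pairs-applyUpTo : (h : A → A → ℕ) (g : ℕ → A) (n : ℕ) →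
                  pairs h (applyUpTo g n) ≡ ∑< n (λ c d → h (g c) (g d))
pairs-applyUpTo h g zero    = refl
pairs-applyUpTo h g (suc n) =
  cong₂ _+_ (∑ᴸ-applyUpTo (h (g 0)) (g ∘ suc) n) (pairs-applyUpTo h (g ∘ suc) n)

-- Columns and their splicing

-- val a i is the entry of the column a in row i, and n (playing the role of ∞)
-- in the rows below the column.

val : Column n → ℕ → ℕ
val {n} []      i       = n
val     (x ∷ a) zero    = toℕ x
val     (x ∷ a) (suc i) = val a i

val-≥ : (a : Column n) {i : ℕ} → length a ≤ i → val a i ≡ n
val-≥ []      _         = refl
val-≥ (x ∷ a) (s≤s a≤i) = val-≥ a a≤i

val-< : (a : Column n) {i : ℕ} → i < length a → val a i < n
val-< (x ∷ a) {zero}  _         = Fin.toℕ<n x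
val-< (x ∷ a) {suc i} (s≤s i<a) = val-< a i<a

val-<⁻¹ : (a : Column n) {i : ℕ} → val a i < n → i < length a
val-<⁻¹ a {i} v<n with i <? length a
... | yes i<a = i<a
... | no  i≮a = ⊥-elim (<⇒≢ v<n (val-≥ a (≮⇒≥ i≮a)))

val-≤ : (a : Column n) (i : ℕ) → val a i ≤ n
val-≤ []      i       = ≤-refl
val-≤ (x ∷ a) zero    = <⇒≤ (Fin.toℕ<n x)
val-≤ (x ∷ a) (suc i) = val-≤ a i

val-injective : (a b : Column n) → (∀ i → val a i ≡ val b i) → a ≡ b
val-injective []      []      h = refl
val-injective []      (y ∷ b) h = ⊥-elim (<⇒≢ (Fin.toℕ<n y) (sym (h 0)))
val-injective (x ∷ a) []      h = ⊥-elim (<⇒≢ (Fin.toℕ<n x) (h 0))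
val-injective (x ∷ a) (y ∷ b) h = cong₂ _∷_ (Fin.toℕ-injective (h 0)) (val-injective a b (h ∘ suc))

val-⟨⟩ : (a : Column n) {i : ℕ} → i < length a → a ⟨ suc i ⟩ ≡ suc (val a i)
val-⟨⟩ (x ∷ a) {zero}  _         = refl
val-⟨⟩ (x ∷ a) {suc i} (s≤s i<a) = val-⟨⟩ a i<a

-- The column a with the convention a_0 = 0, and with n + 1 in place of ∞.

E : Column n → ℕ → ℕ
E a zero    = 0
E a (suc i) = suc (val a i)

E-⟨⟩ : (a : Column n) {i : ℕ} → i ≤ length a → a ⟨ i ⟩ ≡ E a i
E-⟨⟩ a {zero}  _   = refl
E-⟨⟩ a {suc i} i<a = val-⟨⟩ a i<a

E-≥ : (a : Column n) {i : ℕ} → length a < i → E a i ≡ suc n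
E-≥ a {suc i} (s≤s a≤i) = cong suc (val-≥ a a≤i)

E-≤ : (a : Column n) (i : ℕ) → E a i ≤ suc n
E-≤ a zero    = z≤n
E-≤ a (suc i) = s≤s (val-≤ a i)

E-< : (a : Column n) {i : ℕ} → i ≤ length a → E a i < suc n
E-< a {zero}  _   = s≤s z≤n
E-< a {suc i} i<a = s≤s (val-< a i<a)

-- `j` may lie below the column: there `E` is n + 1, above every entry. Thus ∞ takes part in the
-- later inequalities like any other value.
E-increasing : {a : Column n} → Increasing a → ∀ {i j} → i < j → i ≤ length a → E a i < E a j
E-increasing {a = a} inc {i} {j} i<j i≤a with j ≤? length a
... | yes j≤a = subst₂ _<_ (E-⟨⟩ a i≤a) (E-⟨⟩ a j≤a) (inc i<j j≤a)
... | no  j≰a = subst (E a i <_) (sym (E-≥ a (≰⇒> j≰a))) (E-< a i≤a)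

E-≥-index : {a : Column n} → Increasing a → ∀ i → i ≤ length a → i ≤ E a i
E-≥-index inc zero    _   = z≤n
E-≥-index inc (suc i) i<a = ≤-<-trans (E-≥-index inc i (<⇒≤ i<a)) (E-increasing inc ≤-refl (<⇒≤ i<a))

increasing-length : {a : Column n} → Increasing a → length a ≤ n
increasing-length {a = a} inc = s≤s⁻¹ (≤-<-trans (E-≥-index inc (length a) ≤-refl) (E-< a ≤-refl))

val-graft : (p : ℕ) (a b : Column n) → p ≤ length a → p ≤ length b → ∀ i →
            val (take p a ++ drop p b) i ≡ (if does (i <? p) then val a i else val b i)
val-graft zero    a       b       _         _         i       = refl
val-graft (suc p) (x ∷ a) (y ∷ b) _         _         zero    = refl
val-graft (suc p) (x ∷ a) (y ∷ b) (s≤s p≤a) (s≤s p≤b) (suc i)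
  with i <? p | val-graft p a b p≤a p≤b i
... | yes _ | eq = eq
... | no  _ | eq = eq

graft-take : (p : ℕ) (a b : List A) → p ≤ length a → take p (take p a ++ b) ≡ take p a
graft-take zero    a       b _         = refl
graft-take (suc p) (x ∷ a) b (s≤s p≤a) = cong (x ∷_) (graft-take p a b p≤a)

graft-drop : (p : ℕ) (a b : List A) → p ≤ length a → drop p (take p a ++ b) ≡ b
graft-drop zero    a       b _         = refl
graft-drop (suc p) (x ∷ a) b (s≤s p≤a) = graft-drop p a b p≤a

spliceIndex-unique : (σ τ : Column n) (k : ℕ) {p : ℕ} → 0 < length τ → p ≤ k →
  σ ⟨ p ⟩ < τ ⟨ suc p ⟩ → (∀ {q} → p < q → q ≤ k → τ ⟨ suc q ⟩ ≤ σ ⟨ q ⟩) →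
  spliceIndex σ τ k ≡ p
spliceIndex-unique σ τ k {p} 0<τ p≤k holds max with <-cmp (spliceIndex σ τ k) p
... | tri< s<p _ _ = ⊥-elim (<⇒≱ holds (spliceIndex-max σ τ k s<p p≤k))
... | tri≈ _ s≡p _ = s≡p
... | tri> _ _ p<s = ⊥-elim (<⇒≱ (spliceIndex-holds σ τ k 0<τ) (max p<s (spliceIndex-≤ σ τ k)))

module Splice (σ τ : Column n) (k<ℓ : length σ < length τ)
              (incˢ : Increasing σ) (incᵗ : Increasing τ) where

  p : ℕ
  p = spliceIndex σ τ (length σ)

  σ̄ τ̄ : Column n
  σ̄ = proj₁ (splice σ τ)
  τ̄ = proj₂ (splice σ τ)

  p≤k : p ≤ length σ
  p≤k = spliceIndex-≤ σ τ (length σ)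

  p<ℓ : p < length τ
  p<ℓ = ≤-<-trans p≤k k<ℓ

  val-σ̄ : ∀ i → val σ̄ i ≡ (if does (i <? p) then val σ i else val τ i)
  val-σ̄ = val-graft p σ τ p≤k (<⇒≤ p<ℓ)

  val-τ̄ : ∀ i → val τ̄ i ≡ (if does (i <? p) then val τ i else val σ i)
  val-τ̄ = val-graft p τ σ (<⇒≤ p<ℓ) p≤k

  E-low : ∀ {i} → i ≤ p → E σ̄ i ≡ E σ i × E τ̄ i ≡ E τ i
  E-low {zero}  _   = refl , refl
  E-low {suc i} i<p rewrite val-σ̄ i | val-τ̄ i | dec-true (i <? p) i<p = refl , refl

  E-high : ∀ {i} → p < i → E σ̄ i ≡ E τ i × E τ̄ i ≡ E σ i
  E-high {suc i} (s≤s p≤i) rewrite val-σ̄ i | val-τ̄ i | dec-false (i <? p) (≤⇒≯ p≤i) = refl , refl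

  E-holds : E σ p < E τ (suc p)
  E-holds = subst₂ _<_ (E-⟨⟩ σ p≤k) (E-⟨⟩ τ p<ℓ) (spliceIndex-holds σ τ (length σ) (≤-<-trans z≤n k<ℓ))

  -- Maximality of the cut, for every row beyond it: where σ has ended, its value ∞ is the largest
  -- possible.
  E-max : ∀ {q} → p < q → E τ (suc q) ≤ E σ q
  E-max {q} p<q with q ≤? length σ
  ... | yes q≤k = subst₂ _≤_ (E-⟨⟩ τ (≤-trans (s≤s q≤k) k<ℓ)) (E-⟨⟩ σ q≤k)
                    (spliceIndex-max σ τ (length σ) p<q q≤k)
  ... | no  q≰k = subst (E τ (suc q) ≤_) (sym (E-≥ σ (≰⇒> q≰k))) (E-≤ τ (suc q))

  -- As τ increases, τ_q ≤ τ_{q+1} ≤ σ_q: beyond the cut the left column dominates.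
  E-weak : ∀ {q} → p < q → E τ q ≤ E σ q
  E-weak {q} p<q with q ≤? length τ
  ... | yes q≤ℓ = ≤-trans (<⇒≤ (E-increasing incᵗ ≤-refl q≤ℓ)) (E-max p<q)
  ... | no  q≰ℓ = ≤-trans (E-≤ τ q) (≤-reflexive (sym (E-≥ σ (<-trans k<ℓ (≰⇒> q≰ℓ)))))

  E-junction : E τ p < E σ (suc p)
  E-junction = <-≤-trans (E-increasing incᵗ ≤-refl (<⇒≤ p<ℓ)) (E-weak ≤-refl)

  E-strict : E τ (suc p) < E σ (suc p)
  E-strict = <-≤-trans (E-increasing incᵗ ≤-refl p<ℓ) (E-max ≤-refl)

  -- At p the condition for the new pair reads τ_p < τ_{p+1}, which holds because τ increases.
  -- Further down, σ̄ and τ̄ agree with τ and σ, so maximality for the new pair is maximality for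
  -- the old one.
  spliceIndex-swap : spliceIndex τ̄ σ̄ (length τ̄) ≡ p
  spliceIndex-swap = spliceIndex-unique τ̄ σ̄ (length τ̄)
    (subst (0 <_) (sym (splice-length₁ σ τ k<ℓ)) (≤-<-trans z≤n k<ℓ))
    (subst (p ≤_) (sym len₂) p≤k)
    (subst₂ _<_ (sym (graft-low p τ σ (<⇒≤ p<ℓ) ≤-refl)) (sym (graft-high p σ τ p≤k (<⇒≤ p<ℓ) ≤-refl))
      (incᵗ ≤-refl p<ℓ))
    λ {q} p<q q≤ → subst₂ _≤_
      (sym (graft-high p σ τ p≤k (<⇒≤ p<ℓ) (m≤n⇒m≤1+n p<q)))
      (sym (graft-high p τ σ (<⇒≤ p<ℓ) p≤k p<q))
      (spliceIndex-max σ τ (length σ) p<q (subst (q ≤_) len₂ q≤))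
    where
    len₂ : length τ̄ ≡ length σ
    len₂ = splice-length₂ σ τ k<ℓ

  splice-involutive : splice τ̄ σ̄ ≡ (τ , σ)
  splice-involutive rewrite spliceIndex-swap = cong₂ _,_
    (trans (cong₂ _++_ (graft-take p τ _ (<⇒≤ p<ℓ)) (graft-drop p σ _ p≤k)) (take++drop≡id p τ))
    (trans (cong₂ _++_ (graft-take p σ _ p≤k) (graft-drop p τ _ (<⇒≤ p<ℓ))) (take++drop≡id p σ))

-- Pairs of columns

-- Abstract, so that unification does not unfold the comparisons.

abstract

  between : ℕ → ℕ → ℕ → ℕ
  between a x b = χ (a <? x ×-dec x <? b)

  between-≡ : ∀ a x b → between a x b ≡ χ (a <? x ×-dec x <? b)
  between-≡ a x b = refl

between-no : ∀ {a x b} → ¬ (a < x × x < b) → between a x b ≡ 0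
between-no {a} {x} {b} ¬p = trans (between-≡ a x b) (χ-no (a <? x ×-dec x <? b) ¬p)

between-yes : ∀ {a x b} → a < x → x < b → between a x b ≡ 1
between-yes {a} {x} {b} a<x x<b = trans (between-≡ a x b) (χ-yes (a <? x ×-dec x <? b) (a<x , x<b))

between-⇔ : ∀ {a x b a′ x′ b′} → (a < x × x < b → a′ < x′ × x′ < b′) →
            (a′ < x′ × x′ < b′ → a < x × x < b) → between a x b ≡ between a′ x′ b′
between-⇔ {a} {x} {b} {a′} {x′} {b′} to from = trans (between-≡ a x b)
  (trans (χ-⇔ (a <? x ×-dec x <? b) (a′ <? x′ ×-dec x′ <? b′) to from) (sym (between-≡ a′ x′ b′)))

between-≥ : ∀ {a b} x → a < b → between a x b + χ (b ≤? x) ≡ χ (a <? x)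
between-≥ {a} {b} x a<b with b ≤? x | a <? x
... | yes b≤x | yes a<x = trans
  (cong₂ _+_ (between-no λ (_ , x<b) → <⇒≱ x<b b≤x) (χ-yes (b ≤? x) b≤x)) (sym (χ-yes (a <? x) a<x))
... | yes b≤x | no  a≮x = ⊥-elim (a≮x (<-≤-trans a<b b≤x))
... | no  b≰x | yes a<x = trans
  (cong₂ _+_ (between-yes a<x (≰⇒> b≰x)) (χ-no (b ≤? x) b≰x)) (sym (χ-yes (a <? x) a<x))
... | no  b≰x | no  a≮x = trans
  (cong₂ _+_ (between-no (a≮x ∘ proj₁)) (χ-no (b ≤? x) b≰x)) (sym (χ-no (a <? x) a≮x))

between-cong : ∀ {a a′ x x′ b b′} → a ≡ a′ → x ≡ x′ → b ≡ b′ → between a x b ≡ between a′ x′ b′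
between-cong refl refl refl = refl

-- By `between-≥` an interval contributes the indicator of lying above its left end minus that of
-- reaching its right end. The sum over two intervals thus ignores how the ends are matched, as long
-- as all four intervals have their ends in order.
between-exchange : ∀ {a b c d} x → a < b → c < d → a < d → c < b →
                   between a x b + between c x d ≡ between a x d + between c x b
between-exchange {a} {b} {c} {d} x a<b c<d a<d c<b =
  +-cancelʳ-≡ (χ (b ≤? x) + χ (d ≤? x)) _ _ (begin
    between a x b + between c x d + (χ (b ≤? x) + χ (d ≤? x))
      ≡⟨ interchange (between a x b) (between c x d) (χ (b ≤? x)) (χ (d ≤? x)) ⟩
    (between a x b + χ (b ≤? x)) + (between c x d + χ (d ≤? x))
      ≡⟨ cong₂ _+_ (between-≥ x a<b) (between-≥ x c<d) ⟩
    χ (a <? x) + χ (c <? x)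
      ≡⟨ cong₂ _+_ (between-≥ x a<d) (between-≥ x c<b) ⟨
    (between a x d + χ (d ≤? x)) + (between c x b + χ (b ≤? x))
      ≡⟨ interchange′ (between a x d) (between c x b) (χ (b ≤? x)) (χ (d ≤? x)) ⟩
    between a x d + between c x b + (χ (b ≤? x) + χ (d ≤? x)) ∎)
  where
  open ≡-Reasoning
  interchange : ∀ s t u v → s + t + (u + v) ≡ (s + u) + (t + v)
  interchange = solve-∀
  interchange′ : ∀ s t u v → (s + v) + (t + u) ≡ s + t + (u + v)
  interchange′ = solve-∀

-- The contribution of the columns σ and τ, σ to the left of τ, to inv for δ = 0
-- and to quinv for δ = 1.

pairStat : ℕ → Column n → Column n → ℕ
pairStat {n} δ σ τ = ∑ n λ r → between (E σ (δ + r)) (E τ (suc r)) (E σ (suc (δ + r)))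

-- A step of the splicing process rewrites two columns of a list, so this is what keeps the sum of
-- `g` over the list constant.
Exchange : (Column n → ℕ) → Set
Exchange {n} g = (σ τ : Column n) → length σ < length τ → Increasing σ → Increasing τ →
  g (proj₁ (splice σ τ)) + g (proj₂ (splice σ τ)) ≡ g σ + g τ

∑ᴸ-insert : {g : Column n → ℕ} → Exchange g → (σ : Column n) (cs : List (Column n)) →
            Increasing σ → All Increasing cs → ∑ᴸ g (insert σ cs) ≡ g σ + ∑ᴸ g cs
∑ᴸ-insert ex σ [] _ _ = refl
∑ᴸ-insert {g = g} ex σ (τ ∷ cs) p (q ∷ qs) with length σ <? length τ
... | no  _   = refl
... | yes k<ℓ = begin
  g σ̄ + ∑ᴸ g (insert τ̄ cs) ≡⟨ cong (g σ̄ +_) (∑ᴸ-insert ex τ̄ cs (splice-increasing₂ σ τ k<ℓ p q) qs) ⟩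
  g σ̄ + (g τ̄ + ∑ᴸ g cs)    ≡⟨ +-assoc (g σ̄) (g τ̄) _ ⟨
  g σ̄ + g τ̄ + ∑ᴸ g cs      ≡⟨ cong (_+ ∑ᴸ g cs) (ex σ τ k<ℓ p q) ⟩
  g σ + g τ + ∑ᴸ g cs      ≡⟨ +-assoc (g σ) (g τ) _ ⟩
  g σ + (g τ + ∑ᴸ g cs)    ∎
  where
  open ≡-Reasoning
  σ̄ = proj₁ (splice σ τ)
  τ̄ = proj₂ (splice σ τ)

∑ᴸ-spliceAll : {g : Column n → ℕ} → Exchange g → (cs : List (Column n)) →
               All Increasing cs → ∑ᴸ g (spliceAll cs) ≡ ∑ᴸ g cs
∑ᴸ-spliceAll ex []       _        = refl
∑ᴸ-spliceAll {g = g} ex (σ ∷ cs) (p ∷ ps) =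
  trans (∑ᴸ-insert ex σ (spliceAll cs) p (spliceAll-increasing cs ps))
    (cong (g σ +_) (∑ᴸ-spliceAll ex cs ps))

-- Within one row a splice either keeps the two values or swaps them.
exchange-val : (f : ℕ → ℕ) (r : ℕ) → Exchange {n} λ σ → f (val σ r)
exchange-val f r σ τ k<ℓ p q rewrite Splice.val-σ̄ σ τ k<ℓ p q r | Splice.val-τ̄ σ τ k<ℓ p q r
  with does (r <? Splice.p σ τ k<ℓ p q)
... | true  = refl
... | false = +-comm (f (val τ r)) _

exchange-length : (f : ℕ → ℕ) → Exchange {n} (f ∘ length)
exchange-length f σ τ k<ℓ _ _ rewrite splice-length₁ σ τ k<ℓ | splice-length₂ σ τ k<ℓ =
  +-comm (f (length τ)) _

-- The right column enters `pairStat` through one row at a time, so this reduces to `exchange-val`.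
exchange-stˡ : (δ : ℕ) (ρ : Column n) → Exchange (pairStat δ ρ)
exchange-stˡ {n} δ ρ σ τ k<ℓ p q = trans (sym (∑-+ n (g σ̄) (g τ̄))) (trans
  (∑-cong n λ r _ → exchange-val (λ x → between (E ρ (δ + r)) (suc x) (E ρ (suc (δ + r)))) r σ τ k<ℓ p q)
  (∑-+ n (g σ) (g τ)))
  where
  open Splice σ τ k<ℓ p q using (σ̄; τ̄)
  g : Column n → ℕ → ℕ
  g τ r = between (E ρ (δ + r)) (E τ (suc r)) (E ρ (suc (δ + r)))

-- The left column enters through two consecutive rows. Away from the cut a splice treats both rows
-- alike; only the step from row p to p + 1 mixes the columns.
exchange-stʳ : (δ : ℕ) (ρ : Column n) → Exchange (λ σ → pairStat δ σ ρ)
exchange-stʳ {n} δ ρ σ τ k<ℓ incˢ incᵗ = trans (sym (∑-+ n (g σ̄) (g τ̄))) (trans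
  (∑-cong n λ r _ → term (δ + r) (E ρ (suc r))) (∑-+ n (g σ) (g τ)))
  where
  open Splice σ τ k<ℓ incˢ incᵗ
  g : Column n → ℕ → ℕ
  g σ r = between (E σ (δ + r)) (E ρ (suc r)) (E σ (suc (δ + r)))

  term : ∀ i x → between (E σ̄ i) x (E σ̄ (suc i)) + between (E τ̄ i) x (E τ̄ (suc i)) ≡
                between (E σ i) x (E σ (suc i)) + between (E τ i) x (E τ (suc i))
  term i x with <-cmp i p
  ... | tri< i<p _ _ rewrite proj₁ (E-low (<⇒≤ i<p)) | proj₂ (E-low (<⇒≤ i<p))
                           | proj₁ (E-low i<p) | proj₂ (E-low i<p) = refl
  ... | tri> _ _ p<i rewrite proj₁ (E-high p<i) | proj₂ (E-high p<i)
                           | proj₁ (E-high (m≤n⇒m≤1+n p<i)) | proj₂ (E-high (m≤n⇒m≤1+n p<i)) =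
    +-comm (between (E τ i) x (E τ (suc i))) _
  ... | tri≈ _ refl _ rewrite proj₁ (E-low {p} ≤-refl) | proj₂ (E-low {p} ≤-refl)
                            | proj₁ (E-high {suc p} ≤-refl) | proj₂ (E-high {suc p} ≤-refl) =
    -- Two of the four intervals are in order because the columns increase, the other two by the
    -- inequalities at the cut.
    between-exchange x E-holds E-junction (E-increasing incˢ ≤-refl p≤k)
      (E-increasing incᵗ ≤-refl (<⇒≤ p<ℓ))

-- Before the cut nothing changes, and beyond it neither pair contributes. At the cut the old pair
-- has σ_p < τ_{p+1} < σ_{p+1}, while the new pair has the last two values in the wrong order.
pairStat-splice-inv : (σ τ : Column n) → length σ < length τ → Increasing σ → Increasing τ →
                pairStat 0 σ τ ≡ 1 + pairStat 0 (proj₁ (splice σ τ)) (proj₂ (splice σ τ))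
pairStat-splice-inv {n} σ τ k<ℓ incˢ incᵗ = begin
  ∑ n old                                 ≡⟨ ∑-cong n (λ r _ → term r) ⟩
  ∑ n (λ r → χ (r ≟ p) + new r)           ≡⟨ ∑-+ n (λ r → χ (r ≟ p)) new ⟩
  ∑ n (λ r → χ (r ≟ p)) + ∑ n new         ≡⟨ cong (_+ ∑ n new)
      (∑-single p (λ r → χ (r ≟ p)) p<n λ i i≢p → χ-no (i ≟ p) i≢p) ⟩
  χ (p ≟ p) + ∑ n new                     ≡⟨ cong (_+ ∑ n new) (χ-yes (p ≟ p) refl) ⟩
  1 + ∑ n new                             ∎
  where
  open ≡-Reasoning
  open Splice σ τ k<ℓ incˢ incᵗ
  old new : ℕ → ℕ
  old r = between (E σ r) (E τ (suc r)) (E σ (suc r))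
  new r = between (E σ̄ r) (E τ̄ (suc r)) (E σ̄ (suc r))

  p<n : p < n
  p<n = <-≤-trans p<ℓ (increasing-length incᵗ)

  term : ∀ r → old r ≡ χ (r ≟ p) + new r
  term r with <-cmp r p
  ... | tri< r<p r≢p _ = trans
    (between-cong (sym (proj₁ (E-low (<⇒≤ r<p)))) (sym (proj₂ (E-low r<p))) (sym (proj₁ (E-low r<p))))
    (cong (_+ new r) (sym (χ-no (r ≟ p) r≢p)))
  ... | tri> _ r≢p p<r = trans
    (between-no λ (σ<τ , _) → <⇒≱ σ<τ (E-max p<r))
    (sym (cong₂ _+_ (χ-no (r ≟ p) r≢p) (trans
      (between-cong (proj₁ (E-high p<r)) (proj₂ (E-high p<1+r)) (proj₁ (E-high p<1+r)))
      (between-no λ (_ , σ<τ) → <⇒≱ σ<τ (E-weak p<1+r)))))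
    where p<1+r = m≤n⇒m≤1+n p<r
  ... | tri≈ _ refl _ = trans
    (between-yes E-holds E-strict)
    (sym (cong₂ _+_ (χ-yes (p ≟ p) refl) (trans
      (between-cong (proj₁ (E-low ≤-refl)) (proj₂ (E-high ≤-refl)) (proj₁ (E-high ≤-refl)))
      (between-no λ (_ , σ<τ) → <⇒≱ σ<τ (E-weak ≤-refl)))))

-- At the cut only the right end changes, from σ_{p+1} to τ_{p+1}, and both exceed τ_p. Beyond the
-- cut neither pair contributes.
pairStat-splice-quinv : (σ τ : Column n) → length σ < length τ → Increasing σ → Increasing τ →
                  pairStat 1 σ τ ≡ pairStat 1 (proj₁ (splice σ τ)) (proj₂ (splice σ τ))
pairStat-splice-quinv {n} σ τ k<ℓ incˢ incᵗ = ∑-cong n λ r _ → term (suc r)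
  where
  open Splice σ τ k<ℓ incˢ incᵗ
  term : ∀ i → between (E σ i) (E τ i) (E σ (suc i)) ≡ between (E σ̄ i) (E τ̄ i) (E σ̄ (suc i))
  term i with <-cmp i p
  ... | tri< i<p _ _ rewrite proj₁ (E-low (<⇒≤ i<p)) | proj₂ (E-low (<⇒≤ i<p))
                           | proj₁ (E-low i<p) = refl
  ... | tri> _ _ p<i rewrite proj₁ (E-high p<i) | proj₂ (E-high p<i)
                           | proj₁ (E-high (m≤n⇒m≤1+n p<i)) =
    trans (between-no λ (σ<τ , _) → <⇒≱ σ<τ (E-weak p<i))
      (sym (between-no λ (_ , σ<τ) → <⇒≱ σ<τ (E-max p<i)))
  ... | tri≈ _ refl _ rewrite proj₁ (E-low {p} ≤-refl) | proj₂ (E-low {p} ≤-refl)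
                            | proj₁ (E-high {suc p} ≤-refl) =
    between-⇔ (λ (σ<τ , _) → σ<τ , E-increasing incᵗ ≤-refl (<⇒≤ p<ℓ))
              (λ (σ<τ , _) → σ<τ , E-junction)

longer : Column n → Column n → ℕ
longer σ τ = χ (length σ <? length τ)

module _ (δ e : ℕ)
  (pairStat-splice : (σ τ : Column n) → length σ < length τ → Increasing σ → Increasing τ →
               pairStat δ σ τ ≡ e + pairStat δ (proj₁ (splice σ τ)) (proj₂ (splice σ τ)))
  where

  -- `insert` carries a column of the length of σ past every longer column, with one splice for
  -- each; as `cs` is sorted by length, `longer σ` counts them. Each splice costs `e`, and the
  -- exchange properties show that the contributions of the two columns paired with all others are
  -- preserved.
  pairs-insert : (σ : Column n) (cs : List (Column n)) → PartitionShaped cs →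
    Increasing σ → All Increasing cs →
    pairs (pairStat δ) (σ ∷ cs) ≡ e * ∑ᴸ (longer σ) cs + pairs (pairStat δ) (insert σ cs)
  pairs-insert σ []       _        _ _        = cong (_+ 0) (sym (*-zeroʳ e))
  pairs-insert σ (τ ∷ cs) (s ∷ ss) p (q ∷ qs) with length σ <? length τ
  ... | no k≮ℓ = cong (_+ pairs (pairStat δ) (σ ∷ τ ∷ cs))
      (sym (trans (cong (e *_) (none (τ ∷ cs) (≤-refl ∷ s))) (*-zeroʳ e)))
    where
    none : ∀ cs → All (λ c → length c ≤ length τ) cs → ∑ᴸ (longer σ) cs ≡ 0
    none []       _        = refl
    none (c ∷ cs) (c≤ℓ ∷ s) =
      cong₂ _+_ (χ-no (length σ <? length c) λ k<c → k≮ℓ (<-≤-trans k<c c≤ℓ)) (none cs s)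
  ... | yes k<ℓ = begin
    (pairStat δ σ τ + S σ) + (S τ + W)         ≡⟨ rearrange₁ (pairStat δ σ τ) (S σ) (S τ) W ⟩
    pairStat δ σ τ + (S σ + S τ) + W           ≡⟨ cong₂ (λ x y → x + y + W) (pairStat-splice σ τ k<ℓ p q)
        third ⟩
    e + pairStat δ σ̄ τ̄ + (S σ̄ + S τ̄) + W       ≡⟨ rearrange₂ e (pairStat δ σ̄ τ̄) (S σ̄) (S τ̄) W ⟩
    e + (pairStat δ σ̄ τ̄ + S σ̄) + (S τ̄
        + W)     ≡⟨ cong (e + (pairStat δ σ̄ τ̄ + S σ̄) +_) (pairs-insert τ̄ cs ss p̄ qs) ⟩
    e + (pairStat δ σ̄ τ̄ + S σ̄) + (e * ∑ᴸ (longer τ̄) cs + W′)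
      ≡⟨ cong₂ (λ x y → e + x + (e * y + W′)) (sym (∑ᴸ-insert (exchange-stˡ δ σ̄) τ̄ cs p̄ qs)) count ⟩
    e + ∑ᴸ (pairStat δ σ̄) (insert τ̄ cs) + (e * ∑ᴸ (longer σ) cs + W′)
      ≡⟨ rearrange₃ e (∑ᴸ (pairStat δ σ̄) (insert τ̄ cs)) (∑ᴸ (longer σ) cs) W′ ⟩
    e * (1 + ∑ᴸ (longer σ) cs) + (∑ᴸ (pairStat δ σ̄) (insert τ̄ cs) + W′)
      ≡⟨ cong (λ k → e * (k + ∑ᴸ (longer σ) cs) + (∑ᴸ (pairStat δ σ̄) (insert τ̄ cs) + W′))
           (sym (χ-yes (length σ <? length τ) k<ℓ)) ⟩
    e * (longer σ τ + ∑ᴸ (longer σ) cs) + (∑ᴸ (pairStat δ σ̄) (insert τ̄ cs) + W′) ∎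
    where
    open ≡-Reasoning
    σ̄ τ̄ : Column n
    σ̄ = proj₁ (splice σ τ)
    τ̄ = proj₂ (splice σ τ)
    W W′ : ℕ
    W  = pairs (pairStat δ) cs
    W′ = pairs (pairStat δ) (insert τ̄ cs)
    S : Column n → ℕ
    S ρ = ∑ᴸ (pairStat δ ρ) cs

    p̄ : Increasing τ̄
    p̄ = splice-increasing₂ σ τ k<ℓ p q

    third : S σ + S τ ≡ S σ̄ + S τ̄
    third = trans (sym (∑ᴸ-+ (pairStat δ σ) (pairStat δ τ) cs))
      (trans (∑ᴸ-cong (λ ρ → sym (exchange-stʳ δ ρ σ τ k<ℓ p q)) cs)
          (∑ᴸ-+ (pairStat δ σ̄) (pairStat δ τ̄) cs))

    count : ∑ᴸ (longer τ̄) cs ≡ ∑ᴸ (longer σ) cs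
    count = ∑ᴸ-cong (λ c → cong (λ k → χ (k <? length c)) (splice-length₂ σ τ k<ℓ)) cs

    rearrange₁ : ∀ a b c d → (a + b) + (c + d) ≡ a + (b + c) + d
    rearrange₁ = solve-∀
    rearrange₂ : ∀ e a b c d → e + a + (b + c) + d ≡ e + (a + b) + (c + d)
    rearrange₂ = solve-∀
    rearrange₃ : ∀ e a b c → e + a + (e * b + c) ≡ e * suc b + (a + c)
    rearrange₃ = solve-∀

  -- When σ is inserted, the columns after it have already been spliced, but both the multiset of
  -- their lengths and the sum of `pairStat δ σ` over them are as before. So the splices are as many
  -- as the pairs whose right column was longer at the start.
  pairs-spliceAll : (cs : List (Column n)) → All Increasing cs →
    pairs (pairStat δ) cs ≡ e * pairs longer cs + pairs (pairStat δ) (spliceAll cs)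
  pairs-spliceAll []       _        = cong (_+ 0) (sym (*-zeroʳ e))
  pairs-spliceAll (σ ∷ cs) (p ∷ ps) = begin
    ∑ᴸ (pairStat δ σ) cs + pairs (pairStat δ) cs
      ≡⟨ cong₂ _+_ (sym (∑ᴸ-spliceAll (exchange-stˡ δ σ) cs ps)) (pairs-spliceAll cs ps) ⟩
    ∑ᴸ (pairStat δ σ) ds + (e * pairs longer cs + pairs (pairStat δ) ds)
      ≡⟨ rearrange₁ (∑ᴸ (pairStat δ σ) ds) (e * pairs longer cs) _ ⟩
    e * pairs longer cs + pairs (pairStat δ) (σ ∷ ds)
      ≡⟨ cong (e * pairs longer cs +_)
          (pairs-insert σ ds (spliceAll-shaped cs) p (spliceAll-increasing cs ps)) ⟩
    e * pairs longer cs + (e * ∑ᴸ (longer σ) ds + pairs (pairStat δ) (insert σ ds))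
      ≡⟨ cong (λ k → e * pairs longer cs + (e * k + pairs (pairStat δ) (insert σ ds)))
           (∑ᴸ-spliceAll (exchange-length λ k → χ (length σ <? k)) cs ps) ⟩
    e * pairs longer cs + (e * ∑ᴸ (longer σ) cs + pairs (pairStat δ) (insert σ ds))
      ≡⟨ rearrange₂ e (pairs longer cs) (∑ᴸ (longer σ) cs) _ ⟩
    e * (∑ᴸ (longer σ) cs + pairs longer cs) + pairs (pairStat δ) (insert σ ds) ∎
    where
    open ≡-Reasoning
    ds = spliceAll cs
    rearrange₁ : ∀ a b c → a + (b + c) ≡ b + (a + c)
    rearrange₁ = solve-∀
    rearrange₂ : ∀ e a b c → e * a + (e * b + c) ≡ e * (b + a) + c
    rearrange₂ = solve-∀

-- Columns of a filling

nth : A → List A → ℕ → A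
nth d []       i       = d
nth d (x ∷ xs) zero    = x
nth d (x ∷ xs) (suc i) = nth d xs i

nth-≥ : (d : A) (xs : List A) {i : ℕ} → length xs ≤ i → nth d xs i ≡ d
nth-≥ d []       _         = refl
nth-≥ d (x ∷ xs) (s≤s x≤i) = nth-≥ d xs x≤i

nth-All : {P : A → Set} {d : A} → P d → {xs : List A} → All P xs → ∀ i → P (nth d xs i)
nth-All pd []       i       = pd
nth-All pd (p ∷ ps) zero    = p
nth-All pd (p ∷ ps) (suc i) = nth-All pd ps i

nth-applyUpTo : (d : A) (f : ℕ → A) {n i : ℕ} → i < n → nth d (applyUpTo f n) i ≡ f i
nth-applyUpTo d f {suc n} {zero}  _         = refl
nth-applyUpTo d f {suc n} {suc i} (s≤s i<n) = nth-applyUpTo d (f ∘ suc) i<n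

≡-applyUpTo : (d : A) (xs : List A) (f : ℕ → A) {n : ℕ} → length xs ≡ n →
              (∀ i → i < n → nth d xs i ≡ f i) → xs ≡ applyUpTo f n
≡-applyUpTo d []       f refl h = refl
≡-applyUpTo d (x ∷ xs) f refl h =
  cong₂ _∷_ (h 0 (s≤s z≤n)) (≡-applyUpTo d xs (f ∘ suc) refl λ i i<n → h (suc i) (s≤s i<n))

applyUpTo-cong : (f g : ℕ → A) (n : ℕ) → (∀ i → i < n → f i ≡ g i) → applyUpTo f n ≡ applyUpTo g n
applyUpTo-cong f g zero    h = refl
applyUpTo-cong f g (suc n) h = cong₂ _∷_ (h 0 (s≤s z≤n))
    (applyUpTo-cong (f ∘ suc) (g ∘ suc) n λ i i<n → h (suc i) (s≤s i<n))

data Below (n : ℕ) : ℕ → Set where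
  inside  : (r : Fin n) → Below n (toℕ r)
  outside : ∀ {i} → n ≤ i → Below n i

below? : ∀ n i → Below n i
below? n i with i <? n
... | yes i<n = subst (Below n) (Fin.toℕ-fromℕ< i<n) (inside (Fin.fromℕ< i<n))
... | no  i≮n = outside (≮⇒≥ i≮n)

val-mapMaybe : ∀ {k} (f : A → Maybe (Fin n)) (g : Fin k → A) →
  (∀ {i j} → i Fin.≤ j → f (g i) ≡ nothing → f (g j) ≡ nothing) → ∀ i →
  val (mapMaybe f (List.tabulate g)) (toℕ i) ≡ maybe toℕ n (f (g i))
val-mapMaybe {k = suc k} f g down i with f (g zero) in eq
val-mapMaybe {k = suc k} f g down i | nothing
  rewrite mapMaybe-none f (g ∘ suc) (λ j → down z≤n eq) | down {zero} {i} z≤n eq = refl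
val-mapMaybe {k = suc k} f g down zero    | just x rewrite eq = refl
val-mapMaybe {k = suc k} f g down (suc i) | just x = val-mapMaybe f (g ∘ suc) (down ∘ s≤s) i

column : {ν : Partition n} → CSF n ν → ℕ → Column n
column F c = mapMaybe (entryAt F c) (allFin _)

grid : {ν : Partition n} → CSF n ν → ℕ → ℕ → ℕ
grid F r c = val (column F c) r

infix 4 _≗ᶜ_

-- Columns carry no shape in their type, so fillings of shapes that are only propositionally equal
-- can be compared. As `c` ranges over ℕ, the columns also determine the shape.
_≗ᶜ_ : {ν ν′ : Partition n} → CSF n ν → CSF n ν′ → Set
F ≗ᶜ G = ∀ c → column F c ≡ column G c

module _ {ν : Partition n} (F : CSF n ν) where

  val-column : ∀ c r → val (column F c) (toℕ r) ≡ maybe toℕ n (entryAt F c r)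
  val-column c = val-mapMaybe (entryAt F c) id down
    where
    down : ∀ {i j} → i Fin.≤ j → entryAt F c i ≡ nothing → entryAt F c j ≡ nothing
    down {i} {j} i≤j eq with c <? part ν i | c <? part ν j
    ... | no c≮νi | yes c<νj = ⊥-elim (c≮νi (<-≤-trans c<νj (part-mono ν i≤j)))
    ... | no c≮νi | no  _    = refl

  val-column-cell : ∀ r (c : Fin (part ν r)) →
                    val (column F (toℕ c)) (toℕ r) ≡ toℕ (entry F (cell r c))
  val-column-cell r c = trans (val-column (toℕ c) r) inner
    where
    inner : maybe toℕ n (entryAt F (toℕ c) r) ≡ toℕ (entry F (cell r c))
    inner with toℕ c <? part ν r
    ... | yes c<νr = cong (λ c → toℕ (entry F (cell r c))) (Fin.fromℕ<-toℕ c c<νr)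
    ... | no  c≮νr = ⊥-elim (c≮νr (Fin.toℕ<n c))

  val-column-≥ : ∀ {c} r → part ν r ≤ c → val (column F c) (toℕ r) ≡ n
  val-column-≥ {c} r νr≤c = trans (val-column c r) inner
    where
    inner : maybe toℕ n (entryAt F c r) ≡ n
    inner with c <? part ν r
    ... | yes c<νr = ⊥-elim (<⇒≱ c<νr νr≤c)
    ... | no  _    = refl

  val-column-< : ∀ {c} r → c < part ν r → val (column F c) (toℕ r) < n
  val-column-< {c} r c<νr = subst (λ c → val (column F c) (toℕ r) < n) (Fin.toℕ-fromℕ< c<νr)
    (subst (_< n) (sym (val-column-cell r (Fin.fromℕ< c<νr))) (Fin.toℕ<n _))

  column-pairs : ∀ c → AllPairs Fin._<_ (column F c)
  column-pairs c = mapMaybe-allPairs (entryAt F c) mono (AllPairs.tabulate⁺-< id)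
    where
    mono : ∀ {r r′ x y} → r Fin.< r′ → entryAt F c r ≡ just x → entryAt F c r′ ≡ just y → x Fin.< y
    mono r<r′ eq eq′ with entryAt-just F eq | entryAt-just F eq′
    ... | q , refl | q′ , refl =
      increasing F (trans (Fin.toℕ-fromℕ< q) (sym (Fin.toℕ-fromℕ< q′))) r<r′

  column-increasing : ∀ c → Increasing (column F c)
  column-increasing c = fromAllPairs (column-pairs c)

  column-length-≤ : ∀ c → length (column F c) ≤ n
  column-length-≤ c = increasing-length (column-increasing c)

  <-column⁺ : ∀ {c} r → c < part ν r → toℕ r < length (column F c)
  <-column⁺ {c} r c<νr = val-<⁻¹ (column F c) (val-column-< r c<νr)

  <-column⁻ : ∀ {c} r → toℕ r < length (column F c) → c < part ν r
  <-column⁻ {c} r r<len with c <? part ν r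
  ... | yes c<νr = c<νr
  ... | no  c≮νr = ⊥-elim (<⇒≢ (val-< (column F c) r<len) (val-column-≥ r (≮⇒≥ c≮νr)))

  -- Otherwise the row just below the end of column c would contain a cell of column d and none of
  -- column c.
  column-shaped : ∀ {c d} → c ≤ d → length (column F d) ≤ length (column F c)
  column-shaped {c} {d} c≤d with length (column F d) ≤? length (column F c)
  ... | yes p = p
  ... | no ¬p = ⊥-elim (go (below? n _) refl)
    where
    go : ∀ {i} → Below n i → i ≢ length (column F c)
    go (outside n≤i) eq = ¬p (≤-trans (column-length-≤ d) (subst (n ≤_) eq n≤i))
    go (inside r)    eq = <-irrefl eq (<-column⁺ r
      (≤-<-trans c≤d (<-column⁻ r (subst (_< length (column F d)) (sym eq) (≰⇒> ¬p)))))

≈⇒≗ᶜ : {ν : Partition n} (F G : CSF n ν) → (∀ u → entry F u ≡ entry G u) → F ≗ᶜ G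
≈⇒≗ᶜ {ν = ν} F G F≈G c = mapMaybe-cong same (allFin _)
  where
  same : entryAt F c ≗ entryAt G c
  same r with c <? part ν r
  ... | yes _ = cong just (F≈G _)
  ... | no  _ = refl

≗ᶜ⇒≈ : {ν : Partition n} (F G : CSF n ν) → F ≗ᶜ G → ∀ u → entry F u ≡ entry G u
≗ᶜ⇒≈ F G F≗G (cell r c) = Fin.toℕ-injective (trans (sym (val-column-cell F r c))
  (trans (cong (λ a → val a (toℕ r)) (F≗G (toℕ c))) (val-column-cell G r c)))

-- Both the entry m and the old ∞ = m + 1 turn into the new ∞ = m.
val-deleteMax : {a : Column (suc m)} → AllPairs Fin._<_ a → ∀ i → val (deleteMax a) i ≡ val a i ⊓ m
val-deleteMax []       i = sym (m≥n⇒m⊓n≡n (n≤1+n _))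
val-deleteMax {m} {x ∷ a} (p ∷ ps) i with m ≟ toℕ x
val-deleteMax {m} {x ∷ a} (p ∷ ps) zero    | no m≢x =
  trans (Fin.toℕ-lower₁ x m≢x) (sym (m≤n⇒m⊓n≡m (s≤s⁻¹ (Fin.toℕ<n x))))
val-deleteMax {m} {x ∷ a} (p ∷ ps) (suc i) | no m≢x = val-deleteMax ps i
val-deleteMax {m} {x ∷ []} (p ∷ ps) zero | yes m≡x = sym (trans (cong (_⊓ m) (sym m≡x)) (⊓-idem m))
val-deleteMax {m} {x ∷ []} (p ∷ ps) (suc i) | yes m≡x = sym (m≥n⇒m⊓n≡n (n≤1+n m))
val-deleteMax {m} {x ∷ y ∷ a} ((x<y ∷ _) ∷ _) i | yes m≡x =
  ⊥-elim (<⇒≱ x<y (subst (toℕ y ≤_) m≡x (s≤s⁻¹ (Fin.toℕ<n y))))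

val-!? : (a : Column n) (i : ℕ) → val a i ≡ maybe toℕ n (a !? i)
val-!? []      i       = refl
val-!? (x ∷ a) zero    = refl
val-!? (x ∷ a) (suc i) = val-!? a i

lookup-rowAt : ∀ i (cs : List (Column n)) → PartitionShaped cs → (c : Fin (length (rowAt i cs))) →
               toℕ (List.lookup (rowAt i cs) c) ≡ val (nth [] cs (toℕ c)) i
lookup-rowAt i (a ∷ cs) (s ∷ ss) c with i <? length a
... | no i≮a rewrite !?-nothing a i (≮⇒≥ i≮a) =
  ⊥-elim (⊥-Fin[] (rowAt-empty cs (All.map (λ b≤a → ≤-trans b≤a (≮⇒≥ i≮a)) s)) c)
... | yes i<a with a !? i in eq | !?-just a i i<a
lookup-rowAt i (a ∷ cs) (s ∷ ss) zero    | yes _ | just x | _ =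
  sym (trans (val-!? a i) (cong (maybe toℕ _) eq))
lookup-rowAt i (a ∷ cs) (s ∷ ss) (suc c) | yes _ | just x | _ = lookup-rowAt i cs ss c

nth-rowAt-≥ : ∀ i (cs : List (Column n)) → PartitionShaped cs → ∀ {c} →
              length (rowAt i cs) ≤ c → val (nth [] cs c) i ≡ n
nth-rowAt-≥ i []       _        _ = refl
nth-rowAt-≥ i (a ∷ cs) (s ∷ ss) {c} len≤c with i <? length a
... | no i≮a = val-≥ (nth [] (a ∷ cs) c)
  (nth-All {P = λ b → length b ≤ i} z≤n (≮⇒≥ i≮a ∷ All.map (λ b≤a → ≤-trans b≤a (≮⇒≥ i≮a)) s) c)
nth-rowAt-≥ i (a ∷ cs) (s ∷ ss) {zero}  len≤c | yes i<a rewrite rowLength-yes a cs i<a =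
  ⊥-elim (n≮0 len≤c)
nth-rowAt-≥ i (a ∷ cs) (s ∷ ss) {suc c} len≤c | yes i<a rewrite rowLength-yes a cs i<a =
  nth-rowAt-≥ i cs ss (s≤s⁻¹ len≤c)

column-fromColumns : (cs : List (Column n)) (shaped : PartitionShaped cs) (inc : All Increasing cs) →
                     ∀ c → column (fromColumns cs shaped inc) c ≡ nth [] cs c
column-fromColumns {n} cs shaped inc c = val-injective _ _ λ i → same (below? n i)
  where
  F = fromColumns cs shaped inc
  nth-inc : Increasing (nth [] cs c)
  nth-inc = nth-All {P = Increasing} (fromAllPairs []) inc c
  same : ∀ {i} → Below n i → val (column F c) i ≡ val (nth [] cs c) i
  same (outside n≤i) = trans (val-≥ (column F c) (≤-trans (column-length-≤ F c) n≤i))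
    (sym (val-≥ (nth [] cs c) (≤-trans (increasing-length nth-inc) n≤i)))
  same (inside r) with c <? part (shape cs) r
  ... | yes c<νr = begin
    val (column F c) (toℕ r)
      ≡⟨ cong (λ c → val (column F c) (toℕ r)) (Fin.toℕ-fromℕ< c<νr) ⟨
    val (column F (toℕ (Fin.fromℕ< c<νr))) (toℕ r)
      ≡⟨ val-column-cell F r (Fin.fromℕ< c<νr) ⟩
    toℕ (List.lookup (rowAt (toℕ r) cs) (Fin.cast (part-shape cs r) (Fin.fromℕ< c<νr)))
      ≡⟨ lookup-rowAt (toℕ r) cs shaped _ ⟩
    val (nth [] cs (toℕ (Fin.cast (part-shape cs r) (Fin.fromℕ< c<νr)))) (toℕ r)
      ≡⟨ cong (λ c → val (nth [] cs c) (toℕ r))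
          (trans (Fin.toℕ-cast (part-shape cs r) _) (Fin.toℕ-fromℕ< c<νr)) ⟩
    val (nth [] cs c) (toℕ r) ∎
    where open ≡-Reasoning
  ... | no c≮νr = trans (val-column-≥ F r (≮⇒≥ c≮νr))
    (sym (nth-rowAt-≥ (toℕ r) cs shaped (subst (_≤ c) (part-shape cs r) (≮⇒≥ c≮νr))))

insert-length : (σ : Column n) (cs : List (Column n)) → length (insert σ cs) ≡ suc (length cs)
insert-length σ []       = refl
insert-length σ (τ ∷ cs) with length σ <? length τ
... | yes _ = cong suc (insert-length _ cs)
... | no  _ = refl

spliceAll-length : (cs : List (Column n)) → length (spliceAll cs) ≡ length cs
spliceAll-length []       = refl
spliceAll-length (σ ∷ cs) = trans (insert-length σ (spliceAll cs)) (cong suc (spliceAll-length cs))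

length-filter-tabulate : {P : A → Set} (P? : ∀ x → Dec (P x)) (f : Fin n → A) →
                         length (filter P? (List.tabulate f)) ≡ sum (λ i → χ (P? (f i)))
length-filter-tabulate {n = zero}  P? f = refl
length-filter-tabulate {n = suc n} P? f with does (P? (f zero))
... | true  = cong suc (length-filter-tabulate P? (f ∘ suc))
... | false = length-filter-tabulate P? (f ∘ suc)

module _ {ν : Partition n} (F : CSF n ν) where

  #atMost-row : ∀ {j N} → j ≤ n → (r : Fin n) → part ν r ≤ N →
                #atMost j (rowEntries F r) ≡ ∑ N (λ c → χ (val (column F c) (toℕ r) <? j))
  #atMost-row {j} {N} j≤n r νr≤N = begin
    #atMost j (rowEntries F r)
      ≡⟨ length-filter-tabulate (atMost? j) (λ c → entry F (cell r c)) ⟩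
    sum (λ c → χ (toℕ (entry F (cell r c)) <? j))
      ≡⟨ sum-cong-≗ (λ c → cong (λ x → χ (x <? j)) (sym (val-column-cell F r c))) ⟩
    ∑ (part ν r) (λ c → χ (val (column F c) (toℕ r) <? j))
      -- Beyond the row the value is ∞ = n, and j ≤ n keeps it out of the count.
      ≡⟨ ∑-extend _ νr≤N (λ c νr≤c _ → χ-no (_ <? j)
           (λ v<j → <⇒≱ v<j (subst (j ≤_) (sym (val-column-≥ F r νr≤c)) j≤n))) ⟩
    ∑ N (λ c → χ (val (column F c) (toℕ r) <? j)) ∎
    where open ≡-Reasoning

  lookup-rsort : ∀ {j N} (j≤n : j ≤ n) → (∀ r → part ν r ≤ N) → ∀ i →
    lookup (T (rsort F) j j≤n) i ≡ ∑ N (λ c → χ (val (column F c) (toℕ i) <? j))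
  lookup-rsort {j} {N} j≤n ν≤N i = trans (lookup∘tabulate _ i) (trans (#atMost-sorted F j r)
    (trans (#atMost-row j≤n r (ν≤N r))
      (cong (λ k → ∑ N (λ c → χ (val (column F c) k <? j))) (Fin.toℕ-inject≤ i j≤n))))
    where r = Fin.inject≤ i j≤n

-- Words and partitions in a box

#true #false : List Bool → ℕ
#true  = ∑ᴸ (λ b → if b then 1 else 0)
#false = ∑ᴸ (λ b → if b then 0 else 1)

-- Read as a lattice path, the word is the boundary of this partition in the box with `#true` rows
-- and `#false` columns.
boxOf : List Bool → List ℕ
boxOf []          = []
boxOf (true  ∷ w) = #false w ∷ boxOf w
boxOf (false ∷ w) = boxOf w

#true+#false : ∀ w → #true w + #false w ≡ length w
#true+#false []          = refl
#true+#false (true  ∷ w) = cong suc (#true+#false w)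
#true+#false (false ∷ w) = trans (+-suc (#true w) (#false w)) (cong suc (#true+#false w))

length-boxOf : ∀ w → length (boxOf w) ≡ #true w
length-boxOf []          = refl
length-boxOf (true  ∷ w) = cong suc (length-boxOf w)
length-boxOf (false ∷ w) = length-boxOf w

boxOf-≤ : ∀ w p → nth 0 (boxOf w) p ≤ #false w
boxOf-≤ []          p       = z≤n
boxOf-≤ (true  ∷ w) zero    = ≤-refl
boxOf-≤ (true  ∷ w) (suc p) = boxOf-≤ w p
boxOf-≤ (false ∷ w) p       = m≤n⇒m≤1+n (boxOf-≤ w p)

boxOf-decreasing : ∀ w {p q} → p ≤ q → nth 0 (boxOf w) q ≤ nth 0 (boxOf w) p
boxOf-decreasing []          _         = z≤n
boxOf-decreasing (true  ∷ w) {zero} {zero}  _         = ≤-refl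
boxOf-decreasing (true  ∷ w) {zero} {suc q} _         = boxOf-≤ w q
boxOf-decreasing (true  ∷ w) (s≤s p≤q) = boxOf-decreasing w p≤q
boxOf-decreasing (false ∷ w) p≤q       = boxOf-decreasing w p≤q

-- Every `true` comes after the first `a` letters, so it misses `a` of the `false` ones. The default
-- letter `true` makes the hypothesis imply that the word has at least `a` letters. With `a` the
-- length of the next row this is the bound by SE.
boxOf-bounded : ∀ a w → (∀ c → c < a → nth true w c ≡ false) → ∀ p → nth 0 (boxOf w) p ≤ #false w ∸ a
boxOf-bounded zero    w           h p = boxOf-≤ w p
boxOf-bounded (suc a) []          h p = z≤n
boxOf-bounded (suc a) (true  ∷ w) h p with () ← h 0 (s≤s z≤n)
boxOf-bounded (suc a) (false ∷ w) h p = boxOf-bounded a w (λ c c<a → h (suc c) (s≤s c<a)) p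

descent : Bool → Bool → ℕ
descent true  b = if b then 0 else 1
descent false b = 0

∑ᴸ-boxOf : ∀ w → ∑ᴸ id (boxOf w) ≡ pairs descent w
∑ᴸ-boxOf []          = refl
∑ᴸ-boxOf (true  ∷ w) = cong (#false w +_) (∑ᴸ-boxOf w)
∑ᴸ-boxOf (false ∷ w) = trans (∑ᴸ-boxOf w) (cong (_+ pairs descent w) (sym (∑ᴸ-zero (λ _ → refl) w)))

lookup-injective : (v w : Vec A n) → (∀ i → lookup v i ≡ lookup w i) → v ≡ w
lookup-injective v w h = trans (sym (tabulate∘lookup v)) (trans (tabulate-cong h) (tabulate∘lookup w))

partℕ : Partition n → ℕ → ℕ
partℕ ν = nth 0 (Vec.toList (parts ν))

nth-toList : (v : Vec A n) (d : A) (i : Fin n) → nth d (Vec.toList v) (toℕ i) ≡ lookup v i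
nth-toList (x Vec.∷ v) d zero    = refl
nth-toList (x Vec.∷ v) d (suc i) = nth-toList v d i

partℕ-toℕ : (ν : Partition n) (i : Fin n) → partℕ ν (toℕ i) ≡ part ν i
partℕ-toℕ ν = nth-toList (parts ν) 0

partℕ-≥ : (ν : Partition n) {i : ℕ} → n ≤ i → partℕ ν i ≡ 0
partℕ-≥ ν n≤i = go (parts ν) n≤i
  where
  go : ∀ {n i} (v : Vec ℕ n) → n ≤ i → nth 0 (Vec.toList v) i ≡ 0
  go Vec.[]      _         = refl
  go (x Vec.∷ v) (s≤s n≤i) = go v n≤i

module _ {ν : Partition n} (F : CSF n ν) where

  val-column-partℕ : ∀ {c} i → partℕ ν i ≤ c → val (column F c) i ≡ n
  val-column-partℕ {c} i νi≤c with below? n i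
  ... | inside r    = val-column-≥ F r (subst (_≤ c) (partℕ-toℕ ν r) νi≤c)
  ... | outside n≤i = val-≥ (column F c) (≤-trans (column-length-≤ F c) n≤i)

module _ {ν : Partition (suc m)} (F : CSF (suc m) ν) where

  width : ℕ
  width = part ν zero

  part≤width : ∀ r → part ν r ≤ width
  part≤width r = part-mono ν {zero} {r} z≤n

  deleted spliced : List (Column m)
  deleted = List.map deleteMax (columns F)
  spliced = spliceAll deleted

  next : CSF m (⨆≺.index (dsplice F))
  next = ⨆≺.component (dsplice F)

  deleted-applyUpTo : deleted ≡ applyUpTo (deleteMax ∘ column F) width
  deleted-applyUpTo = map-applyUpTo (column F) deleteMax width

  deleted-increasing : All Increasing deleted
  deleted-increasing = All.map⁺ (All.map deleteMax-increasing (columns-allPairs F))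

  spliced-length : length spliced ≡ width
  spliced-length = trans (spliceAll-length deleted)
    (trans (cong length deleted-applyUpTo) (length-applyUpTo _ width))

  column-next : ∀ c → column next c ≡ nth [] spliced c
  column-next = column-fromColumns spliced (spliceAll-shaped deleted)
    (spliceAll-increasing deleted deleted-increasing)

  columns-next : spliced ≡ applyUpTo (column next) width
  columns-next = ≡-applyUpTo [] spliced (column next) spliced-length λ c _ → sym (column-next c)

  next-part≤width : ∀ r → part (⨆≺.index (dsplice F)) r ≤ width
  next-part≤width r = ≤-trans (proj₁ (⨆≺.index≺ (dsplice F) r)) (part≤width (Fin.inject₁ r))

  val-deleted : ∀ c i → val (deleteMax (column F c)) i ≡ val (column F c) i ⊓ m
  val-deleted c = val-deleteMax (column-pairs F c)

  -- Truncation at m does not affect comparison with j ≤ m, and splicing permutes the values of each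
  -- row. This is why row sorting is compatible with branching.
  rowCount-next : ∀ {j} r → j ≤ m →
    ∑ width (λ c → χ (val (column F c) r <? j)) ≡ ∑ width (λ c → χ (val (column next c) r <? j))
  rowCount-next {j} r j≤m = begin
    ∑ width (λ c → χ (val (column F c) r <? j))
      ≡⟨ ∑-cong width (λ c _ → χ-⇔ (_ <? j) (_ <? j)
           (λ v<j → subst (_< j) (sym (val-deleted c r)) (≤-<-trans (m⊓n≤m _ m) v<j))
           (λ v<j → uncap (subst (_< j) (val-deleted c r) v<j))) ⟩
    ∑ width (g ∘ deleteMax ∘ column F)     ≡⟨ ∑ᴸ-applyUpTo g (deleteMax ∘ column F) width ⟨
    ∑ᴸ g (applyUpTo (deleteMax ∘ column F) width) ≡⟨ cong (∑ᴸ g) deleted-applyUpTo ⟨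
    ∑ᴸ g deleted                           ≡⟨ ∑ᴸ-spliceAll (exchange-val (λ x → χ (x <? j)) r) deleted
        deleted-increasing ⟨
    ∑ᴸ g spliced                           ≡⟨ cong (∑ᴸ g) columns-next ⟩
    ∑ᴸ g (applyUpTo (column next) width)   ≡⟨ ∑ᴸ-applyUpTo g (column next) width ⟩
    ∑ width (g ∘ column next)              ∎
    where
    open ≡-Reasoning
    g : Column m → ℕ
    g a = χ (val a r <? j)

    uncap : ∀ {v} → v ⊓ m < j → v < j
    uncap {v} v⊓m<j with ⊓-sel v m
    ... | inj₁ eq = subst (_< j) eq v⊓m<j
    ... | inj₂ eq = ⊥-elim (<⇒≱ (subst (_< j) eq v⊓m<j) j≤m)

  T-next : ∀ j .(j≤m : j ≤ m) → T (rsort F) j (m≤n⇒m≤1+n j≤m) ≡ T (rsort next) j j≤m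
  T-next j j≤m = lookup-injective _ _ λ i → begin
    lookup (T (rsort F) j _) i                    ≡⟨ lookup-rsort F (m≤n⇒m≤1+n j≤m′) part≤width i ⟩
    ∑ width (λ c → χ (val (column F c) (toℕ i) <? j))    ≡⟨ rowCount-next (toℕ i) j≤m′ ⟩
    ∑ width (λ c → χ (val (column next c) (toℕ i) <? j)) ≡⟨ lookup-rsort next j≤m′ next-part≤width i ⟨
    lookup (T (rsort next) j _) i                 ∎
    where
    open ≡-Reasoning
    j≤m′ : j ≤ m
    j≤m′ = recompute (j ≤? m) j≤m

  -- Letter c says whether the entry of column c in row i is the maximum m.  The first
  -- part ν (i + 1) letters are false, and boxOf ignores an initial run of false.

  word : ℕ → List Bool
  word i = applyUpTo (λ c → m ≤ᵇ val (column F c) i) (partℕ ν i)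

  -- The default `true` is also the correct letter beyond the row, where the value is ∞ = m + 1.
  nth-word : ∀ i c → nth true (word i) c ≡ (m ≤ᵇ val (column F c) i)
  nth-word i c with c <? partℕ ν i
  ... | yes c<νi = nth-applyUpTo true _ c<νi
  ... | no  c≮νi = trans
    (nth-≥ true (word i) (subst (_≤ c) (sym (length-applyUpTo _ (partℕ ν i))) (≮⇒≥ c≮νi)))
    (sym (trans (cong (m ≤ᵇ_) (val-column-partℕ F i (≮⇒≥ c≮νi))) (dec-true (m ≤? suc m) (n≤1+n m))))

  length-word : ∀ i → length (word i) ≡ partℕ ν i
  length-word i = length-applyUpTo _ (partℕ ν i)

  #false-word : ∀ i → i < suc m → #false (word i) ≡ ∑ width (λ c → χ (val (column F c) i <? m))
  #false-word i i<n = trans (∑ᴸ-applyUpTo _ _ (partℕ ν i)) (trans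
    (∑-cong (partℕ ν i) λ c _ → flip (val (column F c) i))
    (∑-extend _ νi≤width λ c νi≤c _ → χ-no (val (column F c) i <? m)
      λ v<m → <⇒≱ v<m (subst (m ≤_) (sym (val-column-partℕ F i νi≤c)) (n≤1+n m))))
    where
    νi≤width : partℕ ν i ≤ width
    νi≤width = subst (λ k → partℕ ν k ≤ width) (Fin.toℕ-fromℕ< i<n)
      (subst (_≤ width) (sym (partℕ-toℕ ν (Fin.fromℕ< i<n))) (part≤width _))

    flip : ∀ v → (if m ≤ᵇ v then 0 else 1) ≡ χ (v <? m)
    flip v with m ≤? v
    ... | yes m≤v rewrite dec-true (m ≤? v) m≤v = sym (χ-no (v <? m) (≤⇒≯ m≤v))
    ... | no  m≰v rewrite dec-false (m ≤? v) m≰v = sym (χ-yes (v <? m) (≰⇒> m≰v))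

  -- Such a column has a cell in the next row, whose entry is at most m, so the entry above it is
  -- smaller than m.
  word-prefix : ∀ (i : Fin m) c → c < part ν (suc i) → nth true (word (toℕ i)) c ≡ false
  word-prefix i c c<ν = trans (nth-word (toℕ i) c) (dec-false (m ≤? _) (<⇒≱ v<m))
    where
    r′ : Fin (suc m)
    r′ = suc i
    v<m : val (column F c) (toℕ i) < m
    v<m = <-≤-trans
      (s≤s⁻¹ (E-increasing (column-increasing F c) ≤-refl (<⇒≤ (<-column⁺ F r′ c<ν))))
      (s≤s⁻¹ (val-column-< F r′ c<ν))

-- The parts of Λ as a list, whose length is NE only propositionally (rawΛ-length).

rawΛ : {ν : Partition n} → CSF n ν → ℕ → ℕ → List ℕ
rawΛ {zero}  F j i = []
rawΛ {suc m} F j i with j ≟ m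
... | yes _ = boxOf (word F i)
... | no  _ = rawΛ (next F) j i

module _ {ν : Partition (suc m)} (F : CSF (suc m) ν) where

  rawΛ-top : ∀ i → rawΛ F m i ≡ boxOf (word F i)
  rawΛ-top i with m ≟ m
  ... | yes _  = refl
  ... | no m≢m = ⊥-elim (m≢m refl)

  rawΛ-next : ∀ {j} i → j < m → rawΛ F j i ≡ rawΛ (next F) j i
  rawΛ-next {j} i j<m with j ≟ m
  ... | yes j≡m = ⊥-elim (<⇒≢ j<m j≡m)
  ... | no  _   = refl

  lookup-top : ∀ i → lookup (T (rsort F) (suc m) ≤-refl) i ≡ part ν i
  lookup-top i = cong (λ v → lookup v i) (top (rsort F))

  lookup-#false : ∀ i → lookup (T (rsort F) m (n≤1+n m)) i ≡ #false (word F (toℕ i))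
  lookup-#false i = trans (lookup-rsort F (n≤1+n m) (part≤width F) i)
    (sym (#false-word F (toℕ i) (m≤n⇒m≤1+n (Fin.toℕ<n i))))

  NE-next : ∀ j .(j<m : j < m) i → NE (rsort F) j (m≤n⇒m≤1+n j<m) i ≡ NE (rsort (next F)) j j<m i
  NE-next j j<m i = cong₂ (λ v w → lookup v (Fin.inject₁ i) ∸ lookup w i)
    (T-next F (suc j) j<m) (T-next F j (<⇒≤ j<m))

  SE-next : ∀ j .(j<m : j < m) i → SE (rsort F) j (m≤n⇒m≤1+n j<m) i ≡ SE (rsort (next F)) j j<m i
  SE-next j j<m i = cong₂ (λ v w → lookup w i ∸ lookup v (suc i))
    (T-next F (suc j) j<m) (T-next F j (<⇒≤ j<m))

  NE-top : ∀ i → #true (word F (toℕ i)) ≡ NE (rsort F) m ≤-refl i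
  NE-top i = begin
    #true w                       ≡⟨ m+n∸n≡m (#true w) (#false w) ⟨
    #true w + #false w ∸ #false w ≡⟨ cong₂ _∸_ (trans (#true+#false w) len) (sym (lookup-#false i)) ⟩
    lookup (T (rsort F) (suc m) ≤-refl) (Fin.inject₁ i) ∸ lookup (T (rsort F) m (n≤1+n m)) i ∎
    where
    open ≡-Reasoning
    w = word F (toℕ i)
    len : length w ≡ lookup (T (rsort F) (suc m) ≤-refl) (Fin.inject₁ i)
    len = trans (length-word F (toℕ i)) (trans (cong (partℕ ν) (sym (Fin.toℕ-inject₁ i)))
      (trans (partℕ-toℕ ν (Fin.inject₁ i)) (sym (lookup-top (Fin.inject₁ i)))))

  SE-top : ∀ i → #false (word F (toℕ i)) ∸ part ν (suc i) ≡ SE (rsort F) m ≤-refl i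
  SE-top i = cong₂ _∸_ (sym (lookup-#false i)) (sym (lookup-top (suc i)))

rawΛ-decreasing : {ν : Partition n} (F : CSF n ν) → ∀ j i {p q} → p ≤ q →
                  nth 0 (rawΛ F j i) q ≤ nth 0 (rawΛ F j i) p
rawΛ-decreasing {zero}  F j i p≤q = z≤n
rawΛ-decreasing {suc m} F j i p≤q with j ≟ m
... | yes _ = boxOf-decreasing (word F i) p≤q
... | no  _ = rawΛ-decreasing (next F) j i p≤q

rawΛ-length : {ν : Partition n} (F : CSF n ν) → ∀ j (j<n : j < n) i →
              length (rawΛ F j (toℕ i)) ≡ NE (rsort F) j j<n i
rawΛ-length {suc m} F j (s≤s j≤m) i with m≤n⇒m<n∨m≡n j≤m
... | inj₁ j<m  = trans (cong length (rawΛ-next F (toℕ i) j<m))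
  (trans (rawΛ-length (next F) j j<m i) (sym (NE-next F j j<m i)))
... | inj₂ refl = trans (cong length (rawΛ-top F (toℕ i)))
  (trans (length-boxOf (word F (toℕ i))) (NE-top F i))

rawΛ-bounded : {ν : Partition n} (F : CSF n ν) → ∀ j (j<n : j < n) i p →
               nth 0 (rawΛ F j (toℕ i)) p ≤ SE (rsort F) j j<n i
rawΛ-bounded {suc m} {ν} F j (s≤s j≤m) i p with m≤n⇒m<n∨m≡n j≤m
... | inj₁ j<m  = subst₂ (λ xs ℓ → nth 0 xs p ≤ ℓ) (sym (rawΛ-next F (toℕ i) j<m))
  (sym (SE-next F j j<m i)) (rawΛ-bounded (next F) j j<m i p)
... | inj₂ refl = subst₂ (λ xs ℓ → nth 0 xs p ≤ ℓ) (sym (rawΛ-top F (toℕ i))) (SE-top F i)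
  (boxOf-bounded (part ν (suc i)) (word F (toℕ i)) (word-prefix F i) p)

ψ-inv : {ν : Partition n} → CSF n ν → POP n ν
ψ-inv {n} F = record
  { pr = rsort F
  ; Λ  = λ j j<n i → record
    { partition = mkPartition (Vec.tabulate (part′ j i)) λ {p} {q} p≤q →
        subst₂ _≤_ (sym (lookup∘tabulate (part′ j i) q)) (sym (lookup∘tabulate (part′ j i) p))
          (rawΛ-decreasing F j (toℕ i) p≤q)
    ; bounded   = λ p → subst (_≤ SE (rsort F) j j<n i) (sym (lookup∘tabulate (part′ j i) p))
        (rawΛ-bounded F j (recompute (j <? n) j<n) i (toℕ p))
    }
  }
  where
  part′ : ∀ {k} j → Fin j → Fin k → ℕ
  part′ j i p = nth 0 (rawΛ F j (toℕ i)) (toℕ p)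

-- The statistics as sums over pairs of columns

χ-* : (P? : Dec P) (k : ℕ) → χ P? * k ≡ (if does P? then k else 0)
χ-* P? k with does P?
... | true  = *-identityˡ k
... | false = refl

∑<-cong : ∀ N {h h′ : ℕ → ℕ → ℕ} → (∀ c d → c < d → d < N → h c d ≡ h′ c d) → ∑< N h ≡ ∑< N h′
∑<-cong N {h} {h′} eq = ∑-cong N λ c _ → ∑-cong N λ d d<N → same c d d<N
  where
  same : ∀ c d → d < N → (if does (c <? d) then h c d else 0) ≡ (if does (c <? d) then h′ c d else 0)
  same c d d<N with c <? d
  ... | yes c<d rewrite dec-true (c <? d) c<d = eq c d c<d d<N
  ... | no  c≮d rewrite dec-false (c <? d) c≮d = refl

∑<-+ : ∀ N (h h′ : ℕ → ℕ → ℕ) → ∑< N (λ c d → h c d + h′ c d) ≡ ∑< N h + ∑< N h′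
∑<-+ N h h′ = trans
  (∑-cong N λ c _ → trans (∑-cong N λ d _ → split (does (c <? d)) (h c d) (h′ c d))
      (∑-+ N (g h c) (g h′ c)))
  (∑-+ N (λ c → ∑ N (g h c)) (λ c → ∑ N (g h′ c)))
  where
  g : (ℕ → ℕ → ℕ) → ℕ → ℕ → ℕ
  g h c d = if does (c <? d) then h c d else 0
  split : ∀ b x y → (if b then x + y else 0) ≡ (if b then x else 0) + (if b then y else 0)
  split true  x y = refl
  split false x y = refl

χ-×ˡ : (P? : Dec P) (Q? : Dec Q) → χ (P? ×-dec Q?) ≡ (if does P? then χ Q? else 0)
χ-×ˡ P? Q? with does P?
... | true  = refl
... | false = refl

-- Moves a term indexed by the upper of two adjacent rows to the lower one. Row 0 has nothing above
-- it and receives 0.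
onSuc : (ℕ → ℕ) → ℕ → ℕ
onSuc f zero    = 0
onSuc f (suc r) = f r

∑-onSuc : ∀ n (f : ℕ → ℕ) → (∀ r → n ≤ suc r → f r ≡ 0) → ∑ n (onSuc f) ≡ ∑ n f
∑-onSuc zero    f h = refl
∑-onSuc (suc n) f h = sym (trans (∑-last n f)
    (trans (cong (_+_ (∑ n f)) (h n ≤-refl)) (+-identityʳ (∑ n f))))

-- The side condition for attacks within a row, with c the attacking column. For attacks on the row
-- above, both statistics use the same relation with the columns exchanged.
Side : Statistic → ℕ → ℕ → Set
Side inv   c d = c < d
Side quinv c d = d < c

side? : ∀ s c d → Dec (Side s c d)
side? inv   c d = c <? d
side? quinv c d = d <? c

armRow : Statistic → ℕ → ℕ
armRow inv   r = suc r
armRow quinv r = r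

shift : Statistic → ℕ
shift inv   = 0
shift quinv = 1

armOf : Statistic → {ν : Partition n} → Cell ν → Cell ν → ℕ
armOf inv   u u↑ = arm u
armOf quinv u u↑ = arm u↑

module _ {ν : Partition n} (F : CSF n ν) where

  grid-≥ : ∀ r {c} → n ≤ r → grid F r c ≡ n
  grid-≥ r {c} n≤r = val-≥ (column F c) (≤-trans (column-length-≤ F c) n≤r)

  grid-rise : ∀ r c → grid F r c < n → grid F r c < grid F (suc r) c
  grid-rise r c v<n = s≤s⁻¹ (E-increasing (column-increasing F c) ≤-refl (val-<⁻¹ (column F c) v<n))

  grid-left : ∀ r {c d} → c < d → grid F r d < n → grid F r c < n
  grid-left r {c} {d} c<d v<n =
    val-< (column F c) (<-≤-trans (val-<⁻¹ (column F d) v<n) (column-shaped F (<⇒≤ c<d)))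

  grid-up : ∀ r c → grid F (suc r) c < n → grid F r c < n
  grid-up r c v<n = val-< (column F c) (<⇒≤ (val-<⁻¹ (column F c) v<n))

  grid-≥-row : ∀ c r → r < n → r ≤ val (column F c) r
  grid-≥-row c r r<n with r <? length (column F c)
  ... | yes r<len = s≤s⁻¹ (E-≥-index (column-increasing F c) (suc r) r<len)
  ... | no  r≮len = ≤-trans (<⇒≤ r<n) (≤-reflexive (sym (val-≥ (column F c) (≮⇒≥ r≮len))))

  armPairs : Statistic → ℕ → ℕ → ℕ → ℕ
  armPairs s c d = onSuc λ r → χ (grid F (suc r) c <? n ×-dec grid F (armRow s r) d <? n)

  -- Bounding the larger of the two entries by n puts both cells inside the diagram.
  rowInv stepInv : ℕ → ℕ → ℕ → ℕ
  rowInv  c d r = χ (grid F r d <? grid F r c ×-dec grid F r c <? n)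
  stepInv c d r = χ (grid F r d <? grid F (suc r) c ×-dec grid F (suc r) c <? n)

module _ {ν : Partition n} (F : CSF n ν) {N : ℕ} (ν≤N : ∀ r → part ν r ≤ N) where

  ∑Cell-∑ : (f : Cell ν → ℕ) (g : ℕ → ℕ → ℕ) → (∀ r c → f (cell r c) ≡ g (toℕ r) (toℕ c)) →
            (∀ r c → ¬ grid F r c < n → g r c ≡ 0) → ∑Cell ν f ≡ ∑ n (λ r → ∑ N (g r))
  ∑Cell-∑ f g f≡g zero′ = sum-cong-≗ {n} λ r → trans (sum-cong-≗ (f≡g r))
    (∑-extend (g (toℕ r)) (ν≤N r) λ c νr≤c _ → zero′ (toℕ r) c λ v<n → <⇒≢ v<n (val-column-≥ F r νr≤c))

  arm-∑ : ∀ r (c : Fin (part ν r)) →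
      arm {ν = ν} (cell r c) ≡ ∑ N (λ d → χ (toℕ c <? d ×-dec grid F (toℕ r) d <? n))
  arm-∑ r c = trans
    (∑Cell-∑ _ (λ r′ d → χ (r′ ≟ toℕ r ×-dec (toℕ c <? d ×-dec grid F r′ d <? n)))
      (λ r′ d → χ-⇔ (r′ Fin.≟ r ×-dec toℕ c <? toℕ d)
          (toℕ r′ ≟ toℕ r ×-dec (toℕ c <? toℕ d ×-dec grid F (toℕ r′) (toℕ d) <? n))
        (λ (eq , c<d) → cong toℕ eq , c<d , val-column-< F r′ (Fin.toℕ<n d))
        (λ (eq , c<d , _) → Fin.toℕ-injective eq , c<d))
      (λ r′ d v≮n → χ-no (r′ ≟ toℕ r ×-dec (toℕ c <? d ×-dec grid F r′ d <? n)) (v≮n ∘ proj₂ ∘ proj₂)))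
    (trans (∑-single (toℕ r) _ (Fin.toℕ<n r)
      λ r′ r′≢r → ∑-zero N λ d _ → χ-no (r′ ≟ toℕ r ×-dec (toℕ c <? d ×-dec grid F r′ d <? n))
          (r′≢r ∘ proj₁))
      (∑-cong N λ d _ → χ-⇔ (toℕ r ≟ toℕ r ×-dec (toℕ c <? d ×-dec grid F (toℕ r) d <? n))
          (toℕ c <? d ×-dec grid F (toℕ r) d <? n)
        proj₂ (refl ,_)))

  ∑Des-∑< : ∀ s → ∑Des F (armOf s {ν}) ≡ ∑< N (λ c d → ∑ n (armPairs F s c d))
  ∑Des-∑< s = begin
    ∑Des F (armOf s {ν})
      ≡⟨ ∑Cell-∑ _ g inside-g outside-g ⟩
    ∑ n (λ r → ∑ N (g r))
      ≡⟨ ∑-swap n N g ⟩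
    ∑ N (λ c → ∑ n (λ r → g r c))
      ≡⟨ ∑-cong N (λ c _ → trans (∑-swap n N (λ r d → h r c d))
          (∑-cong N λ d _ → ∑-if n (does (c <? d)) (armPairs F s c d))) ⟩
    ∑< N (λ c d → ∑ n (armPairs F s c d)) ∎
    where
    open ≡-Reasoning
    h : ℕ → ℕ → ℕ → ℕ
    h r c d = if does (c <? d) then armPairs F s c d r else 0

    g : ℕ → ℕ → ℕ
    g r c = ∑ N (h r c)

    h-χ : ∀ r c d → h (suc r) c d ≡
        χ (c <? d ×-dec (grid F (suc r) c <? n ×-dec grid F (armRow s r) d <? n))
    h-χ r c d = sym (χ-×ˡ (c <? d) (grid F (suc r) c <? n ×-dec grid F (armRow s r) d <? n))

    outside-g : ∀ r c → ¬ grid F r c < n → g r c ≡ 0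
    outside-g zero    c v≮n = ∑-zero N λ d _ → if-zero (does (c <? d))
    outside-g (suc r) c v≮n = ∑-zero N λ d _ → trans (h-χ r c d)
      (χ-no (c <? d ×-dec (grid F (suc r) c <? n ×-dec grid F (armRow s r) d <? n)) (v≮n ∘ proj₁ ∘ proj₂))

    inside-g : ∀ r c → maybe (λ u↑ → if does (entry F u↑ Fin.<? entry F (cell r c)) then armOf s {ν}
        (cell r c) u↑ else 0) 0
                         (_↑ {ν = ν} (cell r c)) ≡ g (toℕ r) (toℕ c)
    inside-g zero    c = sym (∑-zero N λ d _ → if-zero (does (toℕ c <? d)))
    inside-g (suc r) c = trans (cong (λ b → if b then armOf s {ν} (cell (suc r) c) u↑ else 0)
        (dec-true (entry F u↑ Fin.<? entry F (cell (suc r) c)) (increasing F (Fin.toℕ-inject≤ c p) r<)))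
      (trans (arms s) (∑-cong N λ d _ → trans
        (χ-⇔ (toℕ c <? d ×-dec grid F (armRow s (toℕ r)) d <? n)
             (toℕ c <? d ×-dec (grid F (suc (toℕ r)) (toℕ c) <? n ×-dec grid F (armRow s (toℕ r)) d <? n))
          (λ (c<d , q) → c<d , val-column-< F (suc r) (Fin.toℕ<n c) , q) (λ (c<d , _ , q) → c<d , q))
        (sym (h-χ (toℕ r) (toℕ c) d))))
      where
      r< : Fin.inject₁ r Fin.< suc r
      r< = s≤s (≤-reflexive (Fin.toℕ-inject₁ r))
      p : part ν (suc r) ≤ part ν (Fin.inject₁ r)
      p = part-mono ν (<⇒≤ r<)
      u↑ : Cell ν
      u↑ = cell (Fin.inject₁ r) (Fin.inject≤ c p)
      arms : ∀ s → armOf s {ν} (cell (suc r) c) u↑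
          ≡ ∑ N (λ d → χ (toℕ c <? d ×-dec grid F (armRow s (toℕ r)) d <? n))
      arms inv   = arm-∑ (suc r) c
      arms quinv = trans (arm-∑ (Fin.inject₁ r) (Fin.inject≤ c p))
        (cong₂ (λ x y → ∑ N (λ d → χ (x <? d ×-dec grid F y d <? n))) (Fin.toℕ-inject≤ c p)
            (Fin.toℕ-inject₁ r))

  -- The pairs (u , v) are grouped by their columns c and d. An attack forces v into the row of u or
  -- the row above it; these cases give `rowInv` and `stepInv`, the latter indexed by the row of v.
  #Inversions-∑ : ∀ s → #Inversions s F ≡
    ∑ N (λ c → ∑ N (λ d → ∑ n (λ r → χ (side? s c d) * rowInv F c d r) +
                          ∑ n (λ r → χ (side? s d c) * stepInv F c d r)))
  #Inversions-∑ s = begin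
    #Inversions s F
      ≡⟨ ∑Cell-∑ _ (λ r c → ∑ n λ r′ → ∑ N (g r c r′))
           (λ r c → ∑Cell-∑ _ (g (toℕ r) (toℕ c)) (λ r′ d → inner r c r′ d)
             λ r′ d v≮n → g-no (toℕ r) (toℕ c) r′ d λ (_ , p , q) → v≮n (<-trans p q))
           (λ r c v≮n → ∑-zero n λ r′ _ → ∑-zero N λ d _ → g-no r c r′ d (v≮n ∘ proj₂ ∘ proj₂)) ⟩
    ∑ n (λ r → ∑ N λ c → ∑ n λ r′ → ∑ N λ d → g r c r′ d)
      ≡⟨ ∑-swap n N (λ r c → ∑ n λ r′ → ∑ N λ d → g r c r′ d) ⟩
    ∑ N (λ c → ∑ n λ r → ∑ n λ r′ → ∑ N λ d → g r c r′ d)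
      ≡⟨ ∑-cong N (λ c _ → trans (∑-cong n λ r _ → ∑-swap n N (λ r′ d → g r c r′ d))
                             (∑-swap n N (λ r d → ∑ n λ r′ → g r c r′ d))) ⟩
    ∑ N (λ c → ∑ N λ d → ∑ n λ r → ∑ n λ r′ → g r c r′ d)
      ≡⟨ ∑-cong N (λ c _ → ∑-cong N λ d _ → rows c d) ⟩
    ∑ N (λ c → ∑ N (λ d → ∑ n (λ r → χ (side? s c d) * rowInv F c d r) +
                          ∑ n (λ r → χ (side? s d c) * stepInv F c d r))) ∎
    where
    open ≡-Reasoning
    att? : ∀ r c r′ d → Dec ((r ≡ r′ × Side s c d) ⊎ (r ≡ suc r′ × Side s d c))
    att? r c r′ d = (r ≟ r′ ×-dec side? s c d) ⊎-dec (r ≟ suc r′ ×-dec side? s d c)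

    g? : ∀ r c r′ d → Dec (((r ≡ r′ × Side s c d) ⊎ (r ≡ suc r′ × Side s d c)) × grid F r′ d < grid F r c
        × grid F r c < n)
    g? r c r′ d = att? r c r′ d ×-dec (grid F r′ d <? grid F r c ×-dec grid F r c <? n)

    g : ℕ → ℕ → ℕ → ℕ → ℕ
    g r c r′ d = χ (g? r c r′ d)

    g-no : ∀ r c r′ d → ¬ _ → g r c r′ d ≡ 0
    g-no r c r′ d = χ-no (g? r c r′ d)

    to : ∀ s {u w : Cell ν} → Attacks s u w →
        (toℕ (row u) ≡ toℕ (row w) × Side s (toℕ (col u)) (toℕ (col w))) ⊎
                              (toℕ (row u) ≡ suc (toℕ (row w)) × Side s (toℕ (col w)) (toℕ (col u)))
    to inv   (inj₁ (p , q)) = inj₁ (cong toℕ p , q)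
    to inv   (inj₂ p)       = inj₂ p
    to quinv (inj₁ (p , q)) = inj₁ (cong toℕ p , q)
    to quinv (inj₂ p)       = inj₂ p

    from : ∀ s {u w : Cell ν} → (toℕ (row u) ≡ toℕ (row w) × Side s (toℕ (col u)) (toℕ (col w))) ⊎
                                (toℕ (row u) ≡ suc (toℕ (row w)) × Side s (toℕ (col w)) (toℕ (col u))) →
                                    Attacks s u w
    from inv   (inj₁ (p , q)) = inj₁ (Fin.toℕ-injective p , q)
    from inv   (inj₂ p)       = inj₂ p
    from quinv (inj₁ (p , q)) = inj₁ (Fin.toℕ-injective p , q)
    from quinv (inj₂ p)       = inj₂ p

    inner : ∀ r c r′ d → χ (attacks? s (cell r c) (cell r′ d) ×-dec entry F (cell r′ d) Fin.<? entry F
        (cell r c)) ≡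
                         g (toℕ r) (toℕ c) (toℕ r′) (toℕ d)
    inner r c r′ d = χ-⇔ (attacks? s (cell r c) (cell r′ d) ×-dec entry F (cell r′ d) Fin.<? entry F
        (cell r c))
      (g? (toℕ r) (toℕ c) (toℕ r′) (toℕ d))
      (λ (p , q) → to s p , subst₂ _<_ (sym (val-column-cell F r′ d)) (sym (val-column-cell F r c)) q ,
          val-column-< F r (Fin.toℕ<n c))
      (λ (p , q , _) → from s p , subst₂ _<_ (val-column-cell F r′ d) (val-column-cell F r c) q)

    split : ∀ c d r r′ → g r c r′ d ≡ χ (r ≟ r′) * (χ (side? s c d) * rowInv F c d r) +
                                      χ (r ≟ suc r′) * (χ (side? s d c) * stepInv F c d r′)
    split c d r r′ with r ≟ r′ | r ≟ suc r′
    ... | yes refl | yes ()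
    ... | yes refl | no r≢ = begin
      g r c r d ≡⟨ χ-⇔ (g? r c r d) (side? s c d ×-dec (grid F r d <? grid F r c ×-dec grid F r c <? n))
                     (λ { (inj₁ (_ , p) , q) → p , q ; (inj₂ (p , _) , _) → ⊥-elim (r≢ p) })
                     (λ (p , q) → inj₁ (refl , p) , q) ⟩
      χ (side? s c d ×-dec (grid F r d <? grid F r c ×-dec grid F r c <? n))
                ≡⟨ trans (χ-×ˡ (side? s c d) (grid F r d <? grid F r c ×-dec grid F r c <? n))
                    (sym (χ-* (side? s c d) _)) ⟩
      χ (side? s c d) * rowInv F c d r ≡⟨ lemma₁ (χ-yes (r ≟ r) refl) (χ-no (r ≟ suc r) r≢) _ _ ⟨
      χ (r ≟ r) * (χ (side? s c d) * rowInv F c d r)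
          + χ (r ≟ suc r) * (χ (side? s d c) * stepInv F c d r) ∎
      where
      lemma₁ : ∀ {x y} → x ≡ 1 → y ≡ 0 → ∀ a b → x * a + y * b ≡ a
      lemma₁ refl refl a b = trans (+-identityʳ _) (*-identityˡ a)
    ... | no r≢ | yes refl = begin
      g r c r′ d ≡⟨ χ-⇔ (g? r c r′ d)
          (side? s d c ×-dec (grid F r′ d <? grid F r c ×-dec grid F r c <? n))
                     (λ { (inj₁ (p , _) , _) → ⊥-elim (r≢ p) ; (inj₂ (_ , p) , q) → p , q })
                     (λ (p , q) → inj₂ (refl , p) , q) ⟩
      χ (side? s d c ×-dec (grid F r′ d <? grid F r c ×-dec grid F r c <? n))
                ≡⟨ trans (χ-×ˡ (side? s d c) (grid F r′ d <? grid F r c ×-dec grid F r c <? n))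
                    (sym (χ-* (side? s d c) _)) ⟩
      χ (side? s d c) * stepInv F c d r′ ≡⟨ lemma₂ (χ-no (r ≟ r′) r≢) (χ-yes (r ≟ suc r′) refl) _ _ ⟨
      χ (r ≟ r′) * (χ (side? s c d) * rowInv F c d r)
          + χ (r ≟ suc r′) * (χ (side? s d c) * stepInv F c d r′) ∎
      where
      lemma₂ : ∀ {x y} → x ≡ 0 → y ≡ 1 → ∀ a b → x * a + y * b ≡ b
      lemma₂ refl refl a b = *-identityˡ b
    ... | no r≢ | no r≢′ = trans
      (g-no r c r′ d λ { (inj₁ (p , _) , _) → r≢ p ; (inj₂ (p , _) , _) → r≢′ p })
      (sym (lemma₃ (χ-no (r ≟ r′) r≢) (χ-no (r ≟ suc r′) r≢′) _ _))
      where
      lemma₃ : ∀ {x y} → x ≡ 0 → y ≡ 0 → ∀ a b → x * a + y * b ≡ 0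
      lemma₃ refl refl a b = refl

    rows : ∀ c d → ∑ n (λ r → ∑ n λ r′ → g r c r′ d) ≡
                   ∑ n (λ r → χ (side? s c d) * rowInv F c d r)
                       + ∑ n (λ r → χ (side? s d c) * stepInv F c d r)
    rows c d = begin
      ∑ n (λ r → ∑ n λ r′ → g r c r′ d)
        ≡⟨ ∑-cong n (λ r _ → trans (∑-cong n λ r′ _ → split c d r r′)
            (∑-+ n (λ r′ → χ (r ≟ r′) * α r) (λ r′ → χ (r ≟ suc r′) * β r′))) ⟩
      ∑ n (λ r → ∑ n (λ r′ → χ (r ≟ r′) * α r) + ∑ n (λ r′ → χ (r ≟ suc r′) * β r′))
        ≡⟨ ∑-+ n (λ r → ∑ n (λ r′ → χ (r ≟ r′) * α r)) (λ r → ∑ n (λ r′ → χ (r ≟ suc r′) * β r′)) ⟩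
      ∑ n (λ r → ∑ n (λ r′ → χ (r ≟ r′) * α r)) + ∑ n (λ r → ∑ n (λ r′ → χ (r ≟ suc r′) * β r′))
        ≡⟨ cong₂ _+_ (∑-cong n pickα) (trans (∑-swap n n (λ r r′ → χ (r ≟ suc r′) * β r′))
            (∑-cong n pickβ)) ⟩
      ∑ n α + ∑ n β ∎
      where
      α β : ℕ → ℕ
      α r = χ (side? s c d) * rowInv F c d r
      β r = χ (side? s d c) * stepInv F c d r

      one : ∀ {x} a → x ≡ 1 → x * a ≡ a
      one a refl = *-identityˡ a

      pickα : ∀ r → r < n → ∑ n (λ r′ → χ (r ≟ r′) * α r) ≡ α r
      pickα r r<n = trans (∑-single r _ r<n λ r′ r′≢r → cong (_* α r) (χ-no (r ≟ r′) (r′≢r ∘ sym)))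
        (one (α r) (χ-yes (r ≟ r) refl))

      pickβ : ∀ r′ → r′ < n → ∑ n (λ r → χ (r ≟ suc r′) * β r′) ≡ β r′
      pickβ r′ r′<n with suc r′ <? n
      ... | yes 1+r′<n = trans (∑-single (suc r′) _ 1+r′<n λ r r≢ → cong (_* β r′) (χ-no (r ≟ suc r′) r≢))
        (one (β r′) (χ-yes (suc r′ ≟ suc r′) refl))
      -- No row lies below the last one, so the sum is empty there; the term vanishes as well,
      -- because the larger value would be ∞.
      ... | no  1+r′≮n = trans (∑-zero n
          λ r _ → trans (cong (χ (r ≟ suc r′) *_) β≡0) (*-zeroʳ (χ (r ≟ suc r′)))) (sym β≡0)
        where
        β≡0 : β r′ ≡ 0
        β≡0 = trans (cong (χ (side? s d c) *_)
            (χ-no (grid F r′ d <? grid F (suc r′) c ×-dec grid F (suc r′) c <? n)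
          λ (_ , q) → <⇒≢ q (grid-≥ F (suc r′) (≮⇒≥ 1+r′≮n)))) (*-zeroʳ (χ (side? s d c)))

choose : Statistic → A → A → A
choose inv   x y = x
choose quinv x y = y

∑-*ˡ : ∀ n k (f : ℕ → ℕ) → ∑ n (λ i → k * f i) ≡ k * ∑ n f
∑-*ˡ zero    k f = sym (*-zeroʳ k)
∑-*ˡ (suc n) k f = trans (cong (k * f 0 +_) (∑-*ˡ n k (f ∘ suc))) (sym (*-distribˡ-+ k (f 0) _))

∑-χ<-* : ∀ N (h : ℕ → ℕ → ℕ) → ∑ N (λ c → ∑ N (λ d → χ (c <? d) * h c d)) ≡ ∑< N h
∑-χ<-* N h = ∑-cong N λ c _ → ∑-cong N λ d _ → χ-* (c <? d) (h c d)

∑-χ>-* : ∀ N (h : ℕ → ℕ → ℕ) → ∑ N (λ c → ∑ N (λ d → χ (d <? c) * h c d)) ≡ ∑< N (λ c d → h d c)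
∑-χ>-* N h = trans (∑-swap N N (λ c d → χ (d <? c) * h c d)) (∑-χ<-* N (λ c d → h d c))

-- The constant 1 is the share of this pair of columns in an arm, which the sum over descents
-- cancels.
between-split : ∀ {p a b} → p < a → χ (b <? a) + χ (p <? b) ≡ 1 + between (suc p) (suc b) (suc a)
between-split {p} {a} {b} p<a with b <? a | p <? b
... | yes b<a | yes p<b = trans (cong₂ _+_ (χ-yes (b <? a) b<a) (χ-yes (p <? b) p<b))
  (cong suc (sym (between-yes (s≤s p<b) (s≤s b<a))))
... | yes b<a | no  p≮b = trans (cong₂ _+_ (χ-yes (b <? a) b<a) (χ-no (p <? b) p≮b))
  (cong suc (sym (between-no (p≮b ∘ s≤s⁻¹ ∘ proj₁))))
... | no  b≮a | yes p<b = trans (cong₂ _+_ (χ-no (b <? a) b≮a) (χ-yes (p <? b) p<b))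
  (cong suc (sym (between-no (b≮a ∘ s≤s⁻¹ ∘ proj₂))))
... | no  b≮a | no  p≮b = ⊥-elim (p≮b (<-≤-trans p<a (≮⇒≥ b≮a)))

χ-×-yes : (P? : Dec P) (Q? : Dec Q) → Q → χ (P? ×-dec Q?) ≡ χ P?
χ-×-yes P? Q? q = χ-⇔ (P? ×-dec Q?) P? proj₁ (_, q)

+-cong₄ : ∀ {a b c d a′ b′ c′ d′ : ℕ} → a ≡ a′ → b ≡ b′ → c ≡ c′ → d ≡ d′ →
          a′ + b′ ≡ c′ + d′ → a + b ≡ c + d
+-cong₄ refl refl refl refl eq = eq

-- Here p lies directly above a, and b lies to the right of a in its row: a attacks b, b attacks p,
-- and b belongs to the arm of a.
inv-cell : ∀ {n p a b} → p < a → a < n → b < n →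
  χ (b <? a ×-dec a <? n) + χ (p <? b ×-dec b <? n) ≡
  χ (a <? n ×-dec b <? n) + between (suc p) (suc b) (suc a)
inv-cell {n} {p} {a} {b} p<a a<n b<n = +-cong₄
  (χ-×-yes (b <? a) (a <? n) a<n) (χ-×-yes (p <? b) (b <? n) b<n)
  (χ-yes (a <? n ×-dec b <? n) (a<n , b<n)) refl (between-split p<a)

-- Now b lies to the right of p in its row: b attacks p, a attacks b, and b belongs to the arm of p.
-- The left column may end at p, so that a = ∞; then there is no descent, and the upper bound b < a
-- is automatic.
quinv-cell : ∀ {n p a b} → a ≤ n → p < a ⊎ n ≤ a → b < n →
  χ (p <? b ×-dec b <? n) + χ (b <? a ×-dec a <? n) ≡
  χ (a <? n ×-dec b <? n) + between (suc p) (suc b) (suc a)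
quinv-cell {n} {p} {a} {b} a≤n p<a b<n with a <? n
quinv-cell {n} {p} {a} {b} a≤n (inj₁ p<a) b<n | yes a<n = +-cong₄
  (χ-×-yes (p <? b) (b <? n) b<n) (χ-×-yes (b <? a) (a <? n) a<n)
  (χ-yes (a <? n ×-dec b <? n) (a<n , b<n)) refl
  (trans (+-comm (χ (p <? b)) _) (between-split p<a))
quinv-cell {n} {p} {a} {b} a≤n (inj₂ n≤a) b<n | yes a<n = ⊥-elim (<⇒≱ a<n n≤a)
quinv-cell {n} {p} {a} {b} a≤n _ b<n | no a≮n = +-cong₄
  (χ-×-yes (p <? b) (b <? n) b<n) (χ-no (b <? a ×-dec a <? n) (a≮n ∘ proj₂))
  (χ-no (a <? n ×-dec b <? n) (a≮n ∘ proj₁)) refl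
  (trans (+-identityʳ _) (same (p <? b)))
  where
  same : Dec (p < b) → χ (p <? b) ≡ between (suc p) (suc b) (suc a)
  same (yes p<b) = trans (χ-yes (p <? b) p<b)
      (sym (between-yes (s≤s p<b) (s≤s (<-≤-trans b<n (≮⇒≥ a≮n)))))
  same (no  p≮b) = trans (χ-no (p <? b) p≮b) (sym (between-no (p≮b ∘ s≤s⁻¹ ∘ proj₁)))

module _ {ν : Partition n} (F : CSF n ν) {N : ℕ} (ν≤N : ∀ r → part ν r ≤ N) where

  #Inversions-∑< : ∀ s → (h : ℕ → ℕ → ℕ) →
    (∀ c d → h c d ≡ (choose s (∑ n (rowInv F c d)) (∑ n (rowInv F d c)) +
                      choose s (∑ n (stepInv F d c)) (∑ n (stepInv F c d)))) →
    #Inversions s F ≡ ∑< N h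
  #Inversions-∑< s h h≡ = trans (#Inversions-∑ F ν≤N s) (trans
    (∑-cong N λ c _ → trans (∑-cong N λ d _ → cong₂ _+_ (∑-*ˡ n (χ (side? s c d)) (rowInv F c d))
                                                  (∑-*ˡ n (χ (side? s d c)) (stepInv F c d)))
      (∑-+ N (λ d → χ (side? s c d) * X c d) (λ d → χ (side? s d c) * Y c d)))
    (trans (∑-+ N (λ c → ∑ N λ d → χ (side? s c d) * X c d) (λ c → ∑ N λ d → χ (side? s d c) * Y c d))
      (collect s h≡)))
    where
    X Y : ℕ → ℕ → ℕ
    X c d = ∑ n (rowInv F c d)
    Y c d = ∑ n (stepInv F c d)

    collect : ∀ s → (∀ c d → h c d ≡ (choose s (X c d) (X d c) + choose s (Y d c) (Y c d))) →
      ∑ N (λ c → ∑ N λ d → χ (side? s c d) * X c d) + ∑ N (λ c → ∑ N λ d → χ (side? s d c) * Y c d)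
          ≡ ∑< N h
    collect inv   h≡ = trans (cong₂ _+_ (∑-χ<-* N X) (∑-χ>-* N Y))
      (trans (sym (∑<-+ N X (λ c d → Y d c))) (∑<-cong N λ c d _ _ → sym (h≡ c d)))
    collect quinv h≡ = trans (cong₂ _+_ (∑-χ>-* N X) (∑-χ<-* N Y))
      (trans (sym (∑<-+ N (λ c d → X d c) Y)) (∑<-cong N λ c d _ _ → sym (h≡ c d)))

  cells : ∀ s c d → c < d →
    choose s (∑ n (rowInv F c d)) (∑ n (rowInv F d c)) +
    choose s (∑ n (stepInv F d c)) (∑ n (stepInv F c d)) ≡
    ∑ n (armPairs F s c d) + pairStat (shift s) (column F c) (column F d)
  cells inv c d c<d = begin
    ∑ n (rowInv F c d) + ∑ n (stepInv F d c)
      ≡⟨ cong (∑ n (rowInv F c d) +_) (∑-onSuc n (stepInv F d c) λ r n≤1+r →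
           χ-no (grid F r c <? grid F (suc r) d ×-dec grid F (suc r) d <? n)
               λ (_ , q) → <⇒≢ q (grid-≥ F (suc r) n≤1+r)) ⟨
    ∑ n (rowInv F c d) + ∑ n (onSuc (stepInv F d c))
      ≡⟨ ∑-+ n (rowInv F c d) (onSuc (stepInv F d c)) ⟨
    ∑ n (λ r → rowInv F c d r + onSuc (stepInv F d c) r)
      ≡⟨ ∑-cong n (λ r _ → rows r) ⟩
    ∑ n (λ r → armPairs F inv c d r + between (E (column F c) r) (suc (grid F r d)) (suc (grid F r c)))
      ≡⟨ ∑-+ n (armPairs F inv c d) (λ r → between (E (column F c) r) (suc (grid F r d))
          (suc (grid F r c))) ⟩
    ∑ n (armPairs F inv c d) + pairStat 0 (column F c) (column F d) ∎
    where
    open ≡-Reasoning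
    rows : ∀ r → rowInv F c d r + onSuc (stepInv F d c) r ≡
                 armPairs F inv c d r + between (E (column F c) r) (suc (grid F r d)) (suc (grid F r c))
    -- Row 0 has no entry above it. The convention a_0 = 0 makes the lower bound vacuous, so the
    -- interval condition is the row inversion alone.
    rows zero = trans (+-identityʳ _) (trans
      (χ-⇔ (grid F 0 d <? grid F 0 c ×-dec grid F 0 c <? n)
          (0 <? suc (grid F 0 d) ×-dec suc (grid F 0 d) <? suc (grid F 0 c))
        (λ (p , _) → s≤s z≤n , s≤s p)
        (λ (_ , q) → s≤s⁻¹ q , grid-left F 0 c<d (<-≤-trans (s≤s⁻¹ q) (val-≤ (column F c) 0))))
      (sym (between-≡ 0 (suc (grid F 0 d)) (suc (grid F 0 c)))))
    rows (suc r) with grid F (suc r) d <? n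
    ... | yes b<n = inv-cell (grid-rise F r c (grid-up F r c a<n)) a<n b<n
      where a<n = grid-left F (suc r) c<d b<n
    ... | no  b≮n = +-cong₄
      (χ-no (grid F (suc r) d <? grid F (suc r) c ×-dec grid F (suc r) c <? n)
          λ (p , q) → b≮n (<-trans p q))
      (χ-no (grid F r c <? grid F (suc r) d ×-dec grid F (suc r) d <? n) (b≮n ∘ proj₂))
      (χ-no (grid F (suc r) c <? n ×-dec grid F (suc r) d <? n) (b≮n ∘ proj₂))
      (between-no λ (_ , q) → b≮n (<-≤-trans (s≤s⁻¹ q) (val-≤ (column F c) (suc r)))) refl
  cells quinv c d c<d = begin
    ∑ n (rowInv F d c) + ∑ n (stepInv F c d)
      ≡⟨ ∑-+ n (rowInv F d c) (stepInv F c d) ⟨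
    ∑ n (λ r → rowInv F d c r + stepInv F c d r)
      ≡⟨ ∑-cong n (λ r _ → rows r) ⟩
    ∑ n (λ r → D r + between (suc (grid F r c)) (suc (grid F r d)) (suc (grid F (suc r) c)))
      ≡⟨ ∑-+ n D (λ r → between (suc (grid F r c)) (suc (grid F r d)) (suc (grid F (suc r) c))) ⟩
    ∑ n D + pairStat 1 (column F c) (column F d)
      ≡⟨ cong (_+ pairStat 1 (column F c) (column F d)) (∑-onSuc n D λ r n≤1+r →
           χ-no (grid F (suc r) c <? n ×-dec grid F r d <? n)
               λ (q , _) → <⇒≢ q (grid-≥ F (suc r) n≤1+r)) ⟨
    ∑ n (armPairs F quinv c d) + pairStat 1 (column F c) (column F d) ∎
    where
    open ≡-Reasoning
    D : ℕ → ℕ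
    D r = χ (grid F (suc r) c <? n ×-dec grid F r d <? n)

    rows : ∀ r → rowInv F d c r + stepInv F c d r ≡
                 D r + between (suc (grid F r c)) (suc (grid F r d)) (suc (grid F (suc r) c))
    rows r with grid F r d <? n
    ... | yes b<n = quinv-cell (val-≤ (column F c) (suc r))
        (inj₁ (grid-rise F r c (grid-left F r c<d b<n))) b<n
    ... | no  b≮n = +-cong₄
      (χ-no (grid F r c <? grid F r d ×-dec grid F r d <? n) (b≮n ∘ proj₂))
      (χ-no (grid F r d <? grid F (suc r) c ×-dec grid F (suc r) c <? n) λ (p , q) → b≮n (<-trans p q))
      (χ-no (grid F (suc r) c <? n ×-dec grid F r d <? n) (b≮n ∘ proj₂))
      (between-no λ (_ , q) → b≮n (<-≤-trans (s≤s⁻¹ q) (val-≤ (column F c) (suc r)))) refl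

  statistic-pairs : ∀ s → statistic s F ≡ ℤ.+ pairs (pairStat (shift s)) (applyUpTo (column F) N)
  statistic-pairs s = trans (difference s) (trans
    (cong₂ (λ x y → ℤ.+ x ℤ.- ℤ.+ y) total (∑Des-∑< F ν≤N s))
        (cancel (∑< N λ c d → ∑ n (armPairs F s c d)) _))
    where
    difference : ∀ s → statistic s F ≡ ℤ.+ #Inversions s F ℤ.- ℤ.+ ∑Des F (armOf s {ν})
    difference inv   = refl
    difference quinv = refl

    total : #Inversions s F ≡ ∑< N (λ c d → ∑ n (armPairs F s c d))
        + pairs (pairStat (shift s)) (applyUpTo (column F) N)
    total = trans (#Inversions-∑< s _ λ _ _ → refl) (trans (∑<-cong N λ c d c<d _ → cells s c d c<d)
      (trans (∑<-+ N (λ c d → ∑ n (armPairs F s c d))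
          (λ c d → pairStat (shift s) (column F c) (column F d)))
        (cong (∑< N (λ c d → ∑ n (armPairs F s c d)) +_)
            (sym (pairs-applyUpTo (pairStat (shift s)) (column F) N)))))

    cancel : ∀ a b → ℤ.+ (a + b) ℤ.- ℤ.+ a ≡ ℤ.+ b
    cancel a b = trans (ℤ.[+m]-[+n]≡m⊖n (a + b) a)
      (trans (ℤ.⊖-≥ (m≤m+n a b)) (cong ℤ.+_ (m+n∸m≡n a b)))

-- One step of delete-and-splice

Vec-sum : (v : Vec ℕ n) → Vec.sum v ≡ sum (lookup v)
Vec-sum Vec.[]      = refl
Vec-sum (x Vec.∷ v) = cong (x +_) (Vec-sum v)

module _ {ν : Partition n} (F : CSF n ν) {N : ℕ} (ν≤N : ∀ r → part ν r ≤ N) where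

  rowCount : ℕ → ℕ → ℕ
  rowCount j r = ∑ N λ c → χ (val (column F c) r <? j)

  sum-T : ∀ {j} (j≤n : j ≤ n) → Vec.sum (T (rsort F) j j≤n) ≡ ∑ n (rowCount j)
  sum-T {j} j≤n = trans (Vec-sum (T (rsort F) j j≤n)) (trans (sum-cong-≗ {j} (lookup-rsort F j≤n ν≤N))
    -- Columns increase strictly, so an entry in row r is at least r; the rows r ≥ j have no entry
    -- below j.
    (∑-extend (rowCount j) j≤n λ r j≤r r<n → ∑-zero N λ c _ → χ-no (val (column F c) r <? j)
      λ v<j → <⇒≱ v<j (≤-trans j≤r (grid-≥-row F c r r<n))))

  weight-rsort : ∀ k → weight F k ≡ weightGT (rsort F) k
  weight-rsort k = sym (trans
    (cong₂ _∸_ (trans (sum-T (Fin.toℕ<n k)) split) (sum-T (<⇒≤ (Fin.toℕ<n k))))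
    (m+n∸n≡m (weight F k) (∑ n (rowCount (toℕ k)))))
    where
    K = toℕ k

    cells-k : weight F k ≡ ∑ n (λ r → ∑ N λ c → χ (val (column F c) r ≟ K))
    cells-k = ∑Cell-∑ F ν≤N _ (λ r c → χ (val (column F c) r ≟ K))
      (λ r c → χ-⇔ (entry F (cell r c) Fin.≟ k) (val (column F (toℕ c)) (toℕ r) ≟ K)
        (λ eq → trans (val-column-cell F r c) (cong toℕ eq))
        (λ eq → Fin.toℕ-injective (trans (sym (val-column-cell F r c)) eq)))
      (λ r c v≮n → χ-no (val (column F c) r ≟ K) λ eq → v≮n (subst (_< n) (sym eq) (Fin.toℕ<n k)))

    χ-<suc : ∀ v → χ (v <? suc K) ≡ χ (v ≟ K) + χ (v <? K)
    χ-<suc v with <-cmp v K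
    ... | tri< v<K v≢K _ = trans (χ-yes (v <? suc K) (m≤n⇒m≤1+n v<K))
        (sym (cong₂ _+_ (χ-no (v ≟ K) v≢K) (χ-yes (v <? K) v<K)))
    ... | tri≈ v≮K v≡K _ = trans (χ-yes (v <? suc K) (s≤s (≤-reflexive v≡K)))
        (sym (cong₂ _+_ (χ-yes (v ≟ K) v≡K) (χ-no (v <? K) v≮K)))
    ... | tri> v≮K v≢K K<v = trans (χ-no (v <? suc K) (<⇒≱ K<v ∘ s≤s⁻¹))
        (sym (cong₂ _+_ (χ-no (v ≟ K) v≢K) (χ-no (v <? K) v≮K)))

    split : ∑ n (rowCount (suc K)) ≡ weight F k + ∑ n (rowCount K)
    split = trans (∑-cong n λ r _ → trans (∑-cong N λ c _ → χ-<suc (val (column F c) r))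
        (∑-+ N (λ c → χ (val (column F c) r ≟ K)) (λ c → χ (val (column F c) r <? K))))
      (trans (∑-+ n (λ r → ∑ N λ c → χ (val (column F c) r ≟ K)) (rowCount K))
        (cong (_+ ∑ n (rowCount K)) (sym cells-k)))

if-no : (P? : Dec P) {k : ℕ} → ¬ P → (if does P? then k else 0) ≡ 0
if-no P? ¬p rewrite dec-false P? ¬p = refl

∑<-restrict : ∀ {K N} (h : ℕ → ℕ → ℕ) → K ≤ N → (∀ c d → K ≤ d → h c d ≡ 0) → ∑< N h ≡ ∑< K h
∑<-restrict {K} {N} h K≤N h≡0 = sym (trans
  (∑-cong K λ c _ → ∑-extend (g c) K≤N λ d K≤d _ → g≡0 c d K≤d)
  (∑-extend (λ c → ∑ N (g c)) K≤N λ c K≤c _ → ∑-zero N λ d _ → outside-g c d K≤c))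
  where
  g : ℕ → ℕ → ℕ
  g c d = if does (c <? d) then h c d else 0

  g≡0 : ∀ c d → K ≤ d → g c d ≡ 0
  g≡0 c d K≤d rewrite h≡0 c d K≤d with does (c <? d)
  ... | true  = refl
  ... | false = refl

  outside-g : ∀ c d → K ≤ c → g c d ≡ 0
  outside-g c d K≤c with c <? d
  ... | yes c<d = g≡0 c d (≤-trans K≤c (<⇒≤ c<d))
  ... | no  c≮d = if-no (c <? d) c≮d

∑<-∑ : ∀ N m (f : ℕ → ℕ → ℕ → ℕ) → ∑< N (λ c d → ∑ m (λ i → f i c d)) ≡ ∑ m (λ i → ∑< N (f i))
∑<-∑ N m f = sym (trans (∑-swap m N (λ i c → ∑ N (g i c)))
    (∑-cong N λ c _ → trans (∑-swap m N (λ i d → g i c d))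
  (∑-cong N λ d _ → ∑-if m (does (c <? d)) (λ i → f i c d))))
  where
  g : ℕ → ℕ → ℕ → ℕ
  g i c d = if does (c <? d) then f i c d else 0

-- The hypothesis leaves room for at most one i with k ≤ i < l, namely k itself.
χ-interval : ∀ {k l m} → l ≤ suc k → l ≤ m → χ (k <? l) ≡ ∑ m (λ i → χ (k ≤? i ×-dec i <? l))
χ-interval {k} {l} {m} l≤1+k l≤m with k <? l
... | yes k<l = trans (χ-yes (k <? l) k<l) (sym (trans
  (∑-single k (λ i → χ (k ≤? i ×-dec i <? l)) (<-≤-trans k<l l≤m)
    λ i i≢k → χ-no (k ≤? i ×-dec i <? l) λ (k≤i , i<l) → i≢k (≤-antisym (s≤s⁻¹ (≤-trans i<l l≤1+k)) k≤i))
  (χ-yes (k ≤? k ×-dec k <? l) (≤-refl , k<l))))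
... | no  k≮l = trans (χ-no (k <? l) k≮l) (sym
  (∑-zero m λ i _ → χ-no (k ≤? i ×-dec i <? l) λ (k≤i , i<l) → k≮l (≤-<-trans k≤i i<l)))

module _ {ν : Partition (suc m)} (F : CSF (suc m) ν) where

  deletedColumn : ℕ → Column m
  deletedColumn c = deleteMax (column F c)

  E-deleted : ∀ c i → E (deletedColumn c) i ≡ E (column F c) i ⊓ suc m
  E-deleted c zero    = refl
  E-deleted c (suc i) = cong suc (val-deleted F c i)

  deleted-length-≤ : ∀ c → length (deletedColumn c) ≤ m
  deleted-length-≤ c = increasing-length (deleteMax-increasing (column-pairs F c))

  deleted-<⁺ : ∀ {c i} → i < length (deletedColumn c) → grid F i c < m
  deleted-<⁺ {c} {i} i<len with grid F i c <? m
  ... | yes v<m = v<m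
  ... | no  v≮m = ⊥-elim (<⇒≢ (val-< (deletedColumn c) i<len)
      (trans (val-deleted F c i) (m≥n⇒m⊓n≡n (≮⇒≥ v≮m))))

  deleted-<⁻ : ∀ {c i} → grid F i c < m → i < length (deletedColumn c)
  deleted-<⁻ {c} {i} v<m = val-<⁻¹ (deletedColumn c)
      (subst (_< m) (sym (val-deleted F c i)) (≤-<-trans (m⊓n≤m _ m) v<m))

  partℕ≤width : ∀ i → partℕ ν i ≤ (width F)
  partℕ≤width i with below? (suc m) i
  ... | inside r    = subst (_≤ (width F)) (sym (partℕ-toℕ ν r)) (part≤width F r)
  ... | outside n≤i = subst (_≤ (width F)) (sym (partℕ-≥ ν n≤i)) z≤n

  letter : ℕ → ℕ → Bool
  letter i c = m ≤ᵇ grid F i c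

  letter-true : ∀ {i c} → m ≤ grid F i c → letter i c ≡ true
  letter-true {i} {c} = dec-true (m ≤? grid F i c)

  letter-false : ∀ {i c} → ¬ m ≤ grid F i c → letter i c ≡ false
  letter-false {i} {c} = dec-false (m ≤? grid F i c)

  letter-beyond : ∀ i {d} → partℕ ν i ≤ d → letter i d ≡ true
  letter-beyond i νi≤d = letter-true {i} (subst (m ≤_) (sym (val-column-partℕ F i νi≤d)) (n≤1+n m))

  pairs-word : ∀ i (h : Bool → Bool → ℕ) → (∀ b → h b true ≡ 0) →
               ∑< (width F) (λ c d → h (letter i c) (letter i d)) ≡ pairs h (word F i)
  pairs-word i h h≡0 = trans
    (∑<-restrict (λ c d → h (letter i c) (letter i d)) (partℕ≤width i)
      λ c d νi≤d → trans (cong (h (letter i c)) (letter-beyond i νi≤d)) (h≡0 (letter i c)))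
    (sym (pairs-applyUpTo h (letter i) (partℕ ν i)))

  -- Before the deletion the right column is not the longer one, and each column loses at most one
  -- cell. So afterwards it can be longer by at most one, and the row concerned is the one where the
  -- left letter is `true` and the right letter `false`.
  pairs-longer : pairs longer (deleted F) ≡ ∑ m (λ i → pairs descent (word F i))
  pairs-longer = begin
    pairs longer (deleted F)                     ≡⟨ cong (pairs longer) (deleted-applyUpTo F) ⟩
    pairs longer (applyUpTo deletedColumn (width F))                ≡⟨ pairs-applyUpTo longer
        deletedColumn (width F) ⟩
    ∑< (width F) (λ c d → longer (deletedColumn c) (deletedColumn d))          ≡⟨ ∑<-cong (width F)
        split ⟩
    ∑< (width F) (λ c d → ∑ m λ i → descent (letter i c) (letter i d))
        ≡⟨ ∑<-∑ (width F) m (λ i c d → descent (letter i c) (letter i d)) ⟩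
    ∑ m (λ i → ∑< (width F) (λ c d → descent (letter i c) (letter i d)))
        ≡⟨ ∑-cong m (λ i _ → pairs-word i descent λ { true → refl ; false → refl }) ⟩
    ∑ m (λ i → pairs descent (word F i))         ∎
    where
    open ≡-Reasoning
    split : ∀ c d → c < d → d < width F →
        longer (deletedColumn c) (deletedColumn d) ≡ ∑ m λ i → descent (letter i c) (letter i d)
    split c d c<d _ = trans (χ-interval
        (≤-trans (deleteMax-length≤ (column F d))
            (≤-trans (column-shaped F (<⇒≤ c<d)) (deleteMax-length≥ (column-pairs F c))))
        (deleted-length-≤ d))
      (∑-cong m λ i _ → letters i)
      where
      letters : ∀ i → χ (length (deletedColumn c) ≤? i ×-dec i <? length (deletedColumn d))
          ≡ descent (letter i c) (letter i d)
      letters i with m ≤? grid F i c | m ≤? grid F i d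
      ... | yes p | yes q rewrite letter-true {i} {c} p | letter-true {i} {d} q =
        χ-no (length (deletedColumn c) ≤? i ×-dec i <? length (deletedColumn d))
            λ (_ , i<) → <⇒≱ (deleted-<⁺ i<) q
      ... | yes p | no  q rewrite letter-true {i} {c} p | letter-false {i} {d} q =
        χ-yes (length (deletedColumn c) ≤? i ×-dec i <? length (deletedColumn d))
            (≮⇒≥ (λ i< → <⇒≱ (deleted-<⁺ i<) p) , deleted-<⁻ (≰⇒> q))
      ... | no  p | _ rewrite letter-false {i} {c} p =
        χ-no (length (deletedColumn c) ≤? i ×-dec i <? length (deletedColumn d))
            λ (≤i , _) → <⇒≱ (deleted-<⁻ (≰⇒> p)) ≤i

  private
    uncap : ∀ {x y} → x ⊓ suc m < y → y ≤ suc m → x < y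
    uncap {x} {y} lt y≤ with ⊓-sel x (suc m)
    ... | inj₁ eq = subst (_< y) eq lt
    ... | inj₂ eq = ⊥-elim (<⇒≱ (subst (_< y) eq lt) y≤)

    cap-< : ∀ {x y} → x < y → x < suc m → x < y ⊓ suc m
    cap-< {x} {y} x<y x<1+m with ⊓-sel y (suc m)
    ... | inj₁ eq = subst (x <_) (sym eq) x<y
    ... | inj₂ eq = subst (x <_) (sym eq) x<1+m

    -- A capped value that lies strictly below another capped value was below the cap already.
    capped⁻ : ∀ {a x y} → a ⊓ suc m < x ⊓ suc m × x ⊓ suc m < y ⊓ suc m → (a < x × x < y) × x < suc m
    capped⁻ {a} {x} {y} (p , q) with ⊓-sel x (suc m)
    ... | inj₂ eq = ⊥-elim (<⇒≱ (subst (_< y ⊓ suc m) eq q) (m⊓n≤n y (suc m)))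
    ... | inj₁ eq = (uncap (subst (a ⊓ suc m <_) eq p) (<⇒≤ x<1+m) , <-≤-trans x<y′ (m⊓n≤m y (suc m))) ,
        x<1+m
      where
      x<y′ = subst (_< y ⊓ suc m) eq q
      x<1+m = <-≤-trans x<y′ (m⊓n≤n y (suc m))

    capped⁺ : ∀ {a x y} → a < x → x < y → x < suc m → a ⊓ suc m < x ⊓ suc m × x ⊓ suc m < y ⊓ suc m
    capped⁺ {a} {x} {y} a<x x<y x<1+m = subst (a ⊓ suc m <_) (sym eq) (≤-<-trans (m⊓n≤m a (suc m)) a<x) ,
      subst (_< y ⊓ suc m) (sym eq) (cap-< x<y x<1+m)
      where eq = m≤n⇒m⊓n≡m (<⇒≤ x<1+m)

  new : ℕ → ℕ → ℕ → ℕ → ℕ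
  new δ c d r = between (E (deletedColumn c) (δ + r)) (E (deletedColumn d) (suc r))
      (E (deletedColumn c) (suc (δ + r)))

  pairStat-deleted : ∀ δ c d → pairStat δ (deletedColumn c) (deletedColumn d) ≡ ∑ (suc m) (new δ c d)
  pairStat-deleted δ c d = ∑-extend (new δ c d) (n≤1+n m) λ r m≤r _ → between-no λ (_ , q) →
    <⇒≱ q (≤-trans (E-≤ (deletedColumn c) _)
        (≤-reflexive (sym (E-≥ (deletedColumn d) (s≤s (≤-trans (deleted-length-≤ d) m≤r))))))

  -- The middle value lies below an entry of its own row, hence below m. Truncation at m cannot
  -- disturb a comparison with such a value.
  pairStat-delete-inv : ∀ c d → c < d →
      pairStat 0 (column F c) (column F d) ≡ pairStat 0 (deletedColumn c) (deletedColumn d)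
  pairStat-delete-inv c d c<d = trans (∑-cong (suc m) λ r _ → term r) (sym (pairStat-deleted 0 c d))
    where
    term : ∀ r → between (E (column F c) r) (suc (grid F r d)) (suc (grid F r c)) ≡ new 0 c d r
    term r = trans (between-⇔
        (λ (p , q) → capped⁺ p q (s≤s (small (s≤s⁻¹ q))))
        (proj₁ ∘ capped⁻))
      (sym (between-cong (E-deleted c r) (E-deleted d (suc r)) (E-deleted c (suc r))))
      where
      small : grid F r d < grid F r c → grid F r d < m
      small d<c = <-≤-trans d<c (s≤s⁻¹ (grid-left F r c<d (<-≤-trans d<c (val-≤ (column F c) r))))

  -- What quinv loses in row r when the maximal entries are deleted.

  fresh : ℕ → ℕ → ℕ → ℕ
  fresh c d r = χ (grid F r c <? m ×-dec (grid F r d ≟ m ×-dec grid F (suc r) c ≟ suc m))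

  -- Truncation identifies m with ∞ = m + 1. An interval is lost exactly when its middle value is m
  -- and its right end is ∞.
  pairStat-delete-quinv : ∀ c d → c < d →
    pairStat 1 (column F c) (column F d)
        ≡ ∑ (suc m) (fresh c d) + pairStat 1 (deletedColumn c) (deletedColumn d)
  pairStat-delete-quinv c d c<d = trans
      (trans (∑-cong (suc m) λ r _ → term r) (∑-+ (suc m) (fresh c d) (new 1 c d)))
    (cong (∑ (suc m) (fresh c d) +_) (sym (pairStat-deleted 1 c d)))
    where
    term : ∀ r → between (suc (grid F r c)) (suc (grid F r d)) (suc (grid F (suc r) c))
        ≡ fresh c d r + new 1 c d r
    term r = trans (pointwise (grid F r c) (grid F r d) (grid F (suc r) c) (val-≤ (column F d) r)
        (val-≤ (column F c) (suc r)))
      (cong (fresh c d r +_) (sym (between-cong (E-deleted c (suc r)) (E-deleted d (suc r))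
          (E-deleted c (suc (suc r))))))
      where
      pointwise : ∀ a x y → x ≤ suc m → y ≤ suc m → between (suc a) (suc x) (suc y) ≡
        χ (a <? m ×-dec (x ≟ m ×-dec y ≟ suc m)) + between (suc a ⊓ suc m) (suc x ⊓ suc m) (suc y ⊓ suc m)
      pointwise a x y x≤ y≤ with x <? m
      ... | yes x<m = trans (between-⇔ (λ (p , q) → capped⁺ p q (s≤s x<m)) (proj₁ ∘ capped⁻))
        (cong (_+ between (suc a ⊓ suc m) (suc x ⊓ suc m) (suc y ⊓ suc m))
          (sym (χ-no (a <? m ×-dec (x ≟ m ×-dec y ≟ suc m)) λ (_ , x≡m , _) → <⇒≢ x<m x≡m)))
      ... | no  x≮m = trans (trans (between-⇔′ (a <? m ×-dec (x ≟ m ×-dec y ≟ suc m))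
            (λ (p , q) → let x≡m = ≤-antisym (s≤s⁻¹ (<-≤-trans (s≤s⁻¹ q) y≤)) (≮⇒≥ x≮m) in
              subst (a <_) x≡m (s≤s⁻¹ p) , x≡m , ≤-antisym y≤ (subst (_< y) x≡m (s≤s⁻¹ q)))
            (λ { (a<m , refl , refl) → s≤s a<m , ≤-refl }))
          (sym (+-identityʳ _)))
        (cong (χ (a <? m ×-dec (x ≟ m ×-dec y ≟ suc m)) +_)
          (sym (between-no {suc a ⊓ suc m} (x≮m ∘ s≤s⁻¹ ∘ proj₂ ∘ capped⁻))))
        where
        between-⇔′ : ∀ {a x b} {Q : Set} (Q? : Dec Q) → (a < x × x < b → Q) → (Q → a < x × x < b) →
            between a x b ≡ χ Q?
        between-⇔′ {a} {x} {b} Q? to from = trans (between-≡ a x b) (χ-⇔ (a <? x ×-dec x <? b) Q? to from)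

-- Complementary boxes and the change of the statistics in one step

ascent : Bool → Bool → ℕ
ascent false b = if b then 1 else 0
ascent true  b = 0

-- Each `true` and each `false` occur in one of the two orders.
descent+ascent : ∀ w → pairs descent w + pairs ascent w ≡ #true w * #false w
descent+ascent []          = refl
descent+ascent (true  ∷ w) = begin
  #false w + pairs descent w + (∑ᴸ (ascent true) w + pairs ascent w)
    ≡⟨ cong (λ k → #false w + pairs descent w + (k + pairs ascent w)) (∑ᴸ-zero (λ _ → refl) w) ⟩
  #false w + pairs descent w + pairs ascent w
    ≡⟨ +-assoc (#false w) (pairs descent w) (pairs ascent w) ⟩
  #false w + (pairs descent w + pairs ascent w)
    ≡⟨ cong (#false w +_) (descent+ascent w) ⟩
  #false w + #true w * #false w ∎
  where
  open ≡-Reasoning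
descent+ascent (false ∷ w) = begin
  ∑ᴸ (descent false) w + pairs descent w + (#true w + pairs ascent w)
    ≡⟨ cong (λ k → k + pairs descent w + (#true w + pairs ascent w)) (∑ᴸ-zero (λ _ → refl) w) ⟩
  pairs descent w + (#true w + pairs ascent w)
    ≡⟨ rearrange (pairs descent w) (#true w) (pairs ascent w) ⟩
  #true w + (pairs descent w + pairs ascent w)
    ≡⟨ cong (#true w +_) (descent+ascent w) ⟩
  #true w + #true w * #false w
    ≡⟨ *-suc (#true w) (#false w) ⟨
  #true w * suc (#false w) ∎
  where
  open ≡-Reasoning
  rearrange : ∀ a b c → a + (b + c) ≡ b + (a + c)
  rearrange = solve-∀

prefix-≤-#false : ∀ a w → (∀ c → c < a → nth true w c ≡ false) → a ≤ #false w
prefix-≤-#false zero    w           h = z≤n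
prefix-≤-#false (suc a) []          h with () ← h 0 (s≤s z≤n)
prefix-≤-#false (suc a) (true  ∷ w) h with () ← h 0 (s≤s z≤n)
prefix-≤-#false (suc a) (false ∷ w) h = s≤s (prefix-≤-#false a w λ c c<a → h (suc c) (s≤s c<a))

module _ {ν : Partition (suc m)} (F : CSF (suc m) ν) where

  -- A `false` followed by a `true` is fresh exactly when its column stops in row i. The other
  -- columns are the first `part ν (suc i)`; their letters are `false` and precede every `true`,
  -- which gives the product.
  fresh-count : ∀ (i : Fin m) → let w = word F (toℕ i) in
    ∑< (width F) (λ c d → fresh F c d (toℕ i)) + part ν (suc i) * #true w ≡ pairs ascent w
  fresh-count i = begin
    ∑< (width F) h + a * #true w   ≡⟨ cong₂ _+_ (∑<-restrict h (partℕ≤width F r) beyond) (sym prefix) ⟩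
    ∑< K h + ∑< K g                ≡⟨ ∑<-+ K h g ⟨
    ∑< K (λ c d → h c d + g c d)   ≡⟨ ∑<-cong K (λ c d _ → merge c d) ⟩
    ∑< K (λ c d → ascent (ℓ c) (ℓ d)) ≡⟨ pairs-applyUpTo ascent ℓ K ⟨
    pairs ascent w                 ∎
    where
    open ≡-Reasoning
    r a K : ℕ
    r = toℕ i
    a = part ν (suc i)
    K = partℕ ν r
    w = word F r
    ℓ : ℕ → Bool
    ℓ = letter F r
    t : ℕ → ℕ
    t d = if ℓ d then 1 else 0
    h g : ℕ → ℕ → ℕ
    h c d = fresh F c d r
    g c d = χ (c <? a) * t d

    K≡ : K ≡ part ν (Fin.inject₁ i)
    K≡ = trans (cong (partℕ ν) (sym (Fin.toℕ-inject₁ i))) (partℕ-toℕ ν (Fin.inject₁ i))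

    a≤K : a ≤ K
    a≤K = subst (a ≤_) (sym K≡) (part-mono ν (<⇒≤ (s≤s (≤-reflexive (Fin.toℕ-inject₁ i)))))

    h-no : ∀ c d → ¬ (grid F r c < m × grid F r d ≡ m × grid F (suc r) c ≡ suc m) → h c d ≡ 0
    h-no c d = χ-no (grid F r c <? m ×-dec (grid F r d ≟ m ×-dec grid F (suc r) c ≟ suc m))

    beyond : ∀ c d → K ≤ d → h c d ≡ 0
    beyond c d K≤d = h-no c d λ (_ , eq , _) →
      <⇒≢ {m} {suc m} ≤-refl (trans (sym eq) (val-column-partℕ F r K≤d))

    early : ∀ {c} → c < a → grid F (suc r) c < suc m
    early c<a = val-column-< F (suc i) c<a

    early-letter : ∀ {c} → c < a → grid F r c < m
    early-letter {c} c<a = s≤s⁻¹ (≤-trans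
      (s≤s (grid-rise F r c (grid-up F r c (early c<a)))) (early c<a))

    late : ∀ {c} → ¬ c < a → grid F (suc r) c ≡ suc m
    late c≮a = val-column-≥ F (suc i) (≮⇒≥ c≮a)

    merge : ∀ c d → d < K → h c d + g c d ≡ ascent (ℓ c) (ℓ d)
    merge c d d<K with m ≤? grid F r d | m ≤? grid F r c
    ... | no  d<m | _ rewrite letter-false F {r} {d} d<m = trans
      (cong₂ _+_ (h-no c d λ (_ , eq , _) → d<m (≤-reflexive (sym eq))) (*-zeroʳ (χ (c <? a))))
      (sym (ascent-false (ℓ c)))
      where
      ascent-false : ∀ b → ascent b false ≡ 0
      ascent-false true  = refl
      ascent-false false = refl
    ... | yes m≤d | yes m≤c rewrite letter-true F {r} {d} m≤d | letter-true F {r} {c} m≤c = cong₂ _+_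
      (h-no c d λ (p , _) → <⇒≱ p m≤c)
      (trans (*-identityʳ _) (χ-no (c <? a) λ c<a → <⇒≱ (early-letter c<a) m≤c))
    ... | yes m≤d | no  c<m rewrite letter-true F {r} {d} m≤d | letter-false F {r} {c} c<m = trans
      (cong₂ _+_ (χ-⇔ (grid F r c <? m ×-dec (grid F r d ≟ m ×-dec grid F (suc r) c ≟ suc m)) (a ≤? c)
          (λ (_ , _ , eq) → ≮⇒≥ λ c<a → <⇒≢ (early c<a) eq)
          (λ a≤c → ≰⇒> c<m , v≡m , late (≤⇒≯ a≤c)))
        (*-identityʳ (χ (c <? a))))
      (either c)
      where
      v≡m : grid F r d ≡ m
      v≡m = ≤-antisym (s≤s⁻¹ (subst (λ k → grid F k d < suc m) (Fin.toℕ-inject₁ i)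
        (val-column-< F (Fin.inject₁ i) (subst (d <_) K≡ d<K)))) m≤d
      either : ∀ c → χ (a ≤? c) + χ (c <? a) ≡ 1
      either c with a ≤? c
      ... | yes a≤c = cong₂ _+_ (χ-yes (a ≤? c) a≤c) (χ-no (c <? a) (≤⇒≯ a≤c))
      ... | no  a≰c = cong₂ _+_ (χ-no (a ≤? c) a≰c) (χ-yes (c <? a) (≰⇒> a≰c))

    prefix : ∑< K g ≡ a * #true w
    prefix = begin
      ∑< K g                                    ≡⟨ ∑-cong K (λ c _ → ∑-cong K λ d _ → drop-< c d) ⟩
      ∑ K (λ c → ∑ K (λ d → χ (c <? a) * t d))  ≡⟨ ∑-cong K
          (λ c _ → trans (∑-*ˡ K (χ (c <? a)) t) (*-comm (χ (c <? a)) (∑ K t))) ⟩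
      ∑ K (λ c → ∑ K t * χ (c <? a))            ≡⟨ ∑-*ˡ K (∑ K t) (λ c → χ (c <? a)) ⟩
      ∑ K t * ∑ K (λ c → χ (c <? a))            ≡⟨ cong₂ _*_
          (sym (∑ᴸ-applyUpTo (λ b → if b then 1 else 0) ℓ K)) (∑-χ< a≤K) ⟩
      #true w * a                               ≡⟨ *-comm (#true w) a ⟩
      a * #true w                               ∎
      where
      -- For d ≤ c < a the letter of column d is `false`, so the dropped condition c < d excludes
      -- only zero terms.
      drop-< : ∀ c d → (if does (c <? d) then g c d else 0) ≡ g c d
      drop-< c d with c <? d
      ... | yes c<d rewrite dec-true (c <? d) c<d = refl
      ... | no  c≮d rewrite dec-false (c <? d) c≮d with c <? a
      ...   | no  c≮a = sym (cong (_* t d) (χ-no (c <? a) c≮a))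
      ...   | yes c<a = sym (trans (cong (λ b → χ (c <? a) * (if b then 1 else 0))
        (letter-false F {r} {d} (<⇒≱ (early-letter (≤-<-trans (≮⇒≥ c≮d) c<a))))) (*-zeroʳ (χ (c <? a))))

sum-tabulate-nth : (xs : List ℕ) {k : ℕ} → length xs ≡ k →
                   Vec.sum (Vec.tabulate {n = k} (λ p → nth 0 xs (toℕ p))) ≡ ∑ᴸ id xs
sum-tabulate-nth []       refl = refl
sum-tabulate-nth (x ∷ xs) refl = cong (x +_) (sum-tabulate-nth xs refl)

Vec-sum-tabulate : (f : Fin n → ℕ) → Vec.sum (Vec.tabulate f) ≡ sum f
Vec-sum-tabulate f = trans (Vec-sum (Vec.tabulate f)) (sum-cong-≗ (lookup∘tabulate f))

size-complement : ∀ {k ℓ} (π : Box k ℓ) → size (partition (complement π)) + size (partition π) ≡ k * ℓ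
size-complement {k} {ℓ} π = begin
  size (partition (complement π)) + size (partition π)
    ≡⟨ cong₂ _+_ (Vec-sum-tabulate (λ i → ℓ ∸ f (Fin.opposite i)))
         (trans (Vec-sum (parts (partition π))) (sum-permute f reverse)) ⟩
  sum (λ i → ℓ ∸ f (Fin.opposite i)) + sum (f ∘ Fin.opposite)
    ≡⟨ ∑-distrib-+ (λ i → ℓ ∸ f (Fin.opposite i)) (f ∘ Fin.opposite) ⟨
  sum (λ i → ℓ ∸ f (Fin.opposite i) + f (Fin.opposite i))
    ≡⟨ sum-cong-≗ (λ i → m∸n+n≡m (bounded π (Fin.opposite i))) ⟩
  sum {k} (λ _ → ℓ)
    ≡⟨ const k ⟩
  k * ℓ ∎
  where
  open ≡-Reasoning
  f : Fin k → ℕ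
  f = part (partition π)
  const : ∀ k → sum {k} (λ _ → ℓ) ≡ k * ℓ
  const zero    = refl
  const (suc k) = cong (ℓ +_) (const k)

ψ : Statistic → {ν : Partition n} → CSF n ν → POP n ν
ψ inv   F = ψ-inv F
ψ quinv F = boxcomp (ψ-inv F)

topSize : {ν : Partition (suc m)} → POP (suc m) ν → ℕ
topSize {m} P = sum λ i → size (partition (Λ P m ≤-refl i))

module _ {ν : Partition (suc m)} (F : CSF (suc m) ν) where

  size-top : ∀ i → size (partition (Λ (ψ-inv F) m ≤-refl i)) ≡ pairs descent (word F (toℕ i))
  size-top i = trans (sum-tabulate-nth (rawΛ F m (toℕ i)) (rawΛ-length F m ≤-refl i))
    (trans (cong (∑ᴸ id) (rawΛ-top F (toℕ i))) (∑ᴸ-boxOf (word F (toℕ i))))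

  -- With t, f, a, d, h as below, the box has area t (f - a), of which d is taken by the partition.
  -- All unequal pairs of letters number t f = d + (h + a t), so h is what remains.
  cosize-top : ∀ i → size (partition (complement (Λ (ψ-inv F) m ≤-refl i))) ≡
                     ∑< (width F) (λ c d → fresh F c d (toℕ i))
  cosize-top i = +-cancelʳ-≡ (d + a * t) _ _ (begin
    size (partition (complement π)) + (d + a * t)
      ≡⟨ +-assoc (size (partition (complement π))) d (a * t) ⟨
    size (partition (complement π)) + d + a * t
      ≡⟨ cong (λ k → size (partition (complement π)) + k + a * t) (size-top i) ⟨
    size (partition (complement π)) + size (partition π) + a * t
      ≡⟨ cong (_+ a * t) (size-complement π) ⟩
    NE (rsort F) m ≤-refl i * SE (rsort F) m ≤-refl i + a * t
      ≡⟨ cong₂ (λ x y → x * y + a * t) (NE-top F i) (SE-top F i) ⟨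
    t * (f ∸ a) + a * t
      ≡⟨ cong (t * (f ∸ a) +_) (*-comm a t) ⟩
    t * (f ∸ a) + t * a
      ≡⟨ *-distribˡ-+ t (f ∸ a) a ⟨
    t * (f ∸ a + a)
      ≡⟨ cong (t *_) (m∸n+n≡m (prefix-≤-#false a w (word-prefix F i))) ⟩
    t * f
      ≡⟨ descent+ascent w ⟨
    d + pairs ascent w
      ≡⟨ cong (d +_) (fresh-count F i) ⟨
    d + (h + a * t)
      ≡⟨ rearrange d h (a * t) ⟩
    h + (d + a * t) ∎)
    where
    open ≡-Reasoning
    π = Λ (ψ-inv F) m ≤-refl i
    w = word F (toℕ i)
    a t f d h : ℕ
    a = part ν (suc i)
    t = #true w
    f = #false w
    d = pairs descent w
    h = ∑< (width F) (λ c d → fresh F c d (toℕ i))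
    rearrange : ∀ a b c → a + (b + c) ≡ b + (a + c)
    rearrange = solve-∀

  pairs-next : ∀ s → pairs (pairStat (shift s)) (applyUpTo (column F) (width F)) ≡
    topSize (ψ s F) + pairs (pairStat (shift s)) (applyUpTo (column (next F)) (width F))
  pairs-next inv = begin
    pairs (pairStat 0) (applyUpTo (column F) N)
      ≡⟨ pairs-applyUpTo (pairStat 0) (column F) N ⟩
    ∑< N (λ c d → pairStat 0 (column F c) (column F d))
      ≡⟨ ∑<-cong N (λ c d c<d _ → pairStat-delete-inv F c d c<d) ⟩
    ∑< N (λ c d → pairStat 0 (a′ c) (a′ d))
      ≡⟨ pairs-applyUpTo (pairStat 0) a′ N ⟨
    pairs (pairStat 0) (applyUpTo a′ N)
      ≡⟨ cong (pairs (pairStat 0)) (deleted-applyUpTo F) ⟨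
    pairs (pairStat 0) (deleted F)
      ≡⟨ pairs-spliceAll 0 1 pairStat-splice-inv (deleted F) (deleted-increasing F) ⟩
    1 * pairs longer (deleted F) + pairs (pairStat 0) (spliced F)
      ≡⟨ cong₂ _+_ (trans (*-identityˡ _) (trans (pairs-longer F) (sum-cong-≗ {m} (sym ∘ size-top))))
           (cong (pairs (pairStat 0)) (columns-next F)) ⟩
    topSize (ψ-inv F) + pairs (pairStat 0) (applyUpTo (column (next F)) N) ∎
    where
    open ≡-Reasoning
    N = width F
    a′ = deleteMax ∘ column F
  pairs-next quinv = begin
    pairs (pairStat 1) (applyUpTo (column F) N)
      ≡⟨ pairs-applyUpTo (pairStat 1) (column F) N ⟩
    ∑< N (λ c d → pairStat 1 (column F c) (column F d))
      ≡⟨ ∑<-cong N (λ c d c<d _ → pairStat-delete-quinv F c d c<d) ⟩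
    ∑< N (λ c d → ∑ (suc m) (fresh F c d) + pairStat 1 (a′ c) (a′ d))
      ≡⟨ ∑<-+ N (λ c d → ∑ (suc m) (fresh F c d)) (λ c d → pairStat 1 (a′ c) (a′ d)) ⟩
    ∑< N (λ c d → ∑ (suc m) (fresh F c d)) + ∑< N (λ c d → pairStat 1 (a′ c) (a′ d))
      ≡⟨ cong₂ _+_ fresh-total (trans (sym (pairs-applyUpTo (pairStat 1) a′ N))
          (cong (pairs (pairStat 1)) (sym (deleted-applyUpTo F)))) ⟩
    topSize (boxcomp (ψ-inv F)) + pairs (pairStat 1) (deleted F)
      ≡⟨ cong (topSize (boxcomp (ψ-inv F)) +_) (trans
           (pairs-spliceAll 1 0 pairStat-splice-quinv (deleted F) (deleted-increasing F))
           (cong (pairs (pairStat 1)) (columns-next F))) ⟩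
    topSize (boxcomp (ψ-inv F)) + pairs (pairStat 1) (applyUpTo (column (next F)) N) ∎
    where
    open ≡-Reasoning
    N = width F
    a′ = deleteMax ∘ column F

    fresh-total : ∑< N (λ c d → ∑ (suc m) (fresh F c d)) ≡ topSize (boxcomp (ψ-inv F))
    fresh-total = trans (∑<-∑ N (suc m) (λ i c d → fresh F c d i)) (trans
      (∑-last m (λ i → ∑< N (λ c d → fresh F c d i)))
      (trans (cong₂ _+_ (sum-cong-≗ {m} (sym ∘ cosize-top))
        -- In row m every value is at least m, so the extra row contributes no fresh pair.
        (trans (∑<-cong N {h′ = λ _ _ → 0} λ c d _ _ →
            χ-no (val (column F c) m <? m ×-dec (val (column F d) m ≟ m ×-dec val (column F c)
                (suc m) ≟ suc m))
              λ (p , _) → <⇒≱ p (grid-≥-row F c m ≤-refl))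
          (∑-zero N λ c _ → ∑-zero N λ d _ → if-zero (does (c <? d)))))
        (+-identityʳ _)))

-- Equality of overlaid patterns, branching and complementation

≡⇒≋ : ∀ {k} {v w : Vec ℕ k} → v ≡ w → v ≋ w
≡⇒≋ refl = ≋-refl

≋-sum : ∀ {k l} {v : Vec ℕ k} {w : Vec ℕ l} → v ≋ w → Vec.sum v ≡ Vec.sum w
≋-sum []         = refl
≋-sum (refl ∷ p) = cong (_ +_) (≋-sum p)

≈POP-sym : {ν ν′ : Partition n} {P : POP n ν} {P′ : POP n ν′} → P ≈POP P′ → P′ ≈POP P
≈POP-sym (S , L) = (λ j j≤n → sym (S j j≤n)) , λ j j<n i → ≋-sym (L j j<n i)

≈POP-trans : {ν ν′ ν″ : Partition n} {P : POP n ν} {P′ : POP n ν′} {P″ : POP n ν″} →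
             P ≈POP P′ → P′ ≈POP P″ → P ≈POP P″
≈POP-trans (S , L) (S′ , L′) =
  (λ j j≤n → trans (S j j≤n) (S′ j j≤n)) , λ j j<n i → ≋-trans (L j j<n i) (L′ j j<n i)

∣∣Λ-cong : {ν ν′ : Partition n} (P : POP n ν) (P′ : POP n ν′) → P ≈POP P′ → ∣ P ∣Λ ≡ ∣ P′ ∣Λ
∣∣Λ-cong {n} P P′ (_ , L) = sum-cong-≗ {n} λ j → sum-cong-≗ {toℕ j}
    λ i → ≋-sum (L (toℕ j) (Fin.toℕ<n j) i)

restrict : {ν : Partition (suc m)} (P : POP (suc m) ν) → POP m (⨆≺.index (br P))
restrict P = ⨆≺.component (br P)

∣∣Λ-br : {ν : Partition (suc m)} (P : POP (suc m) ν) → ∣ P ∣Λ ≡ ∣ restrict P ∣Λ + topSize P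
∣∣Λ-br {m} P = trans (sum-init-last {m} (λ j → S (toℕ j) (Fin.toℕ<n j)))
  (cong₂ _+_ (sum-cong-≗ {m} λ j → S-cong (Fin.toℕ-inject₁ j)) (S-cong (Fin.toℕ-fromℕ m)))
  where
  S : ∀ j → .(j < suc m) → ℕ
  S j j<n = sum {j} λ i → size (partition (Λ P j j<n i))

  S-cong : ∀ {j k} .{p : j < suc m} .{q : k < suc m} → j ≡ k → S j p ≡ S k q
  S-cong refl = refl

restrict-cong : {ν ν′ : Partition (suc m)} {P : POP (suc m) ν} {P′ : POP (suc m) ν′} →
                P ≈POP P′ → restrict P ≈POP restrict P′
restrict-cong (S , L) = (λ j j≤m → S j (m≤n⇒m≤1+n j≤m)) , λ j j<m i → L j (m≤n⇒m≤1+n j<m) i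

complement-cong : ∀ {k k′ ℓ ℓ′} (π : Box k ℓ) (π′ : Box k′ ℓ′) → k ≡ k′ → ℓ ≡ ℓ′ →
                  parts (partition π) ≋ parts (partition π′) →
                  parts (partition (complement π)) ≋ parts (partition (complement π′))
complement-cong {ℓ = ℓ} π π′ refl refl π≋π′ =
  ≡⇒≋ (cong (λ v → Vec.tabulate (λ i → ℓ ∸ lookup v (Fin.opposite i))) (≋⇒≡ π≋π′))

NE-cong : {ν ν′ : Partition n} (S : GT n ν) (S′ : GT n ν′) → S ≈GT S′ →
          ∀ j .(j<n : j < n) i → NE S j j<n i ≡ NE S′ j j<n i
NE-cong S S′ S≈S′ j j<n i = cong₂ (λ v w → lookup v (Fin.inject₁ i) ∸ lookup w i) (S≈S′ (suc j) j<n)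
    (S≈S′ j (<⇒≤ j<n))

SE-cong : {ν ν′ : Partition n} (S : GT n ν) (S′ : GT n ν′) → S ≈GT S′ →
          ∀ j .(j<n : j < n) i → SE S j j<n i ≡ SE S′ j j<n i
SE-cong S S′ S≈S′ j j<n i = cong₂ (λ v w → lookup w i ∸ lookup v (suc i)) (S≈S′ (suc j) j<n)
    (S≈S′ j (<⇒≤ j<n))

boxcomp-cong : {ν ν′ : Partition n} (P : POP n ν) (P′ : POP n ν′) → P ≈POP P′ → boxcomp P ≈POP boxcomp P′
boxcomp-cong P P′ (S , L) = S , λ j j<n i → complement-cong (Λ P j j<n i) (Λ P′ j j<n i)
  (NE-cong (pr P) (pr P′) S j j<n i) (SE-cong (pr P) (pr P′) S j j<n i) (L j j<n i)

boxcomp-involutive : {ν : Partition n} (P : POP n ν) → boxcomp (boxcomp P) ≈POP P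
boxcomp-involutive P = (λ _ _ → refl) , λ j j<n i → ≡⇒≋ (complement-involutive (Λ P j j<n i))
  where
  complement-involutive : ∀ {k ℓ} (π : Box k ℓ) →
      parts (partition (complement (complement π))) ≡ parts (partition π)
  complement-involutive {k} {ℓ} π = lookup-injective _ _ λ i → begin
    lookup (parts (partition (complement (complement π)))) i
      ≡⟨ lookup∘tabulate _ i ⟩
    ℓ ∸ part (partition (complement π)) (Fin.opposite i)
      ≡⟨ cong (ℓ ∸_) (lookup∘tabulate _ (Fin.opposite i)) ⟩
    ℓ ∸ (ℓ ∸ part (partition π) (Fin.opposite (Fin.opposite i)))
      ≡⟨ m∸[m∸n]≡n (bounded π _) ⟩
    part (partition π) (Fin.opposite (Fin.opposite i))
      ≡⟨ cong (part (partition π)) (Fin.opposite-involutive i) ⟩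
    part (partition π) i ∎
    where open ≡-Reasoning

mkPartition-cong : {μ ν : Partition n} → parts μ ≡ parts ν → μ ≡ ν
mkPartition-cong refl = refl

tabulate-nth-≋ : ∀ {k l} {xs ys : List ℕ} → k ≡ l → xs ≡ ys →
  Vec.tabulate {n = k} (λ p → nth 0 xs (toℕ p)) ≋ Vec.tabulate {n = l} (λ p → nth 0 ys (toℕ p))
tabulate-nth-≋ refl refl = ≋-refl

module _ {ν : Partition (suc m)} (F : CSF (suc m) ν) where

  T-index : T (rsort F) m (n≤1+n m) ≡ parts (⨆≺.index (dsplice F))
  T-index = trans (T-next F m ≤-refl) (top (rsort (next F)))

  restrict-ψ-inv : restrict (ψ-inv F) ≈POP ψ-inv (next F)
  restrict-ψ-inv = T-next F , λ j j<m i → tabulate-nth-≋ (NE-next F j j<m i)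
    (rawΛ-next F (toℕ i) (recompute (j <? m) j<m))

  br-ψ : ∀ s → br (ψ s F) ≈⨆ ⨆-map (λ _ → ψ s) (dsplice F)
  br-ψ inv   = mkPartition-cong T-index , restrict-ψ-inv
  br-ψ quinv = mkPartition-cong T-index , boxcomp-cong (restrict (ψ-inv F)) (ψ-inv (next F))
      restrict-ψ-inv

-- Passing to `next F` lowers both sides by `topSize`: the left one by `pairs-next`, the right one
-- by branching.
statistic-ψ : ∀ s {ν : Partition n} (F : CSF n ν) → statistic s F ≡ ℤ.+ ∣ ψ s F ∣Λ
statistic-ψ {zero}  s F = trans (statistic-pairs F {0} (λ ()) s) refl
statistic-ψ {suc m} s F = trans (statistic-pairs F (part≤width F) s) (cong ℤ.+_ (begin
  pairs (pairStat (shift s)) (applyUpTo (column F) (width F))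
    ≡⟨ pairs-next F s ⟩
  topSize (ψ s F) + pairs (pairStat (shift s)) (applyUpTo (column (next F)) (width F))
    ≡⟨ cong (topSize (ψ s F) +_) (ℤ.+-injective
        (trans (sym (statistic-pairs (next F) (next-part≤width F) s)) (statistic-ψ s (next F)))) ⟩
  topSize (ψ s F) + ∣ ψ s (next F) ∣Λ
    ≡⟨ +-comm (topSize (ψ s F)) _ ⟩
  ∣ ψ s (next F) ∣Λ + topSize (ψ s F)
    ≡⟨ cong (_+ topSize (ψ s F)) (∣∣Λ-cong (restrict (ψ s F)) (ψ s (next F)) (proj₂ (br-ψ F s))) ⟨
  ∣ restrict (ψ s F) ∣Λ + topSize (ψ s F)
    ≡⟨ ∣∣Λ-br (ψ s F) ⟨
  ∣ ψ s F ∣Λ ∎))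
  where open ≡-Reasoning

rowBound : (ν : Partition n) → Σ[ N ∈ ℕ ] (∀ r → part ν r ≤ N)
rowBound {zero}  ν = 0 , λ ()
rowBound {suc m} ν = part ν zero , λ r → part-mono ν {zero} {r} z≤n

rsort-cong : {ν ν′ : Partition n} (F : CSF n ν) (G : CSF n ν′) → F ≗ᶜ G → rsort F ≈GT rsort G
rsort-cong {n} {ν} {ν′} F G F≗G j j≤n = lookup-injective _ _ λ i → trans
  (lookup-rsort F j≤n′ (λ r → ≤-trans (proj₂ (rowBound ν) r) (m≤m⊔n N N′)) i)
  (trans (∑-cong (N ⊔ N′) λ c _ → cong (λ a → χ (val a (toℕ i) <? j)) (F≗G c))
    (sym (lookup-rsort G j≤n′ (λ r → ≤-trans (proj₂ (rowBound ν′) r) (m≤n⊔m N N′)) i)))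
  where
  j≤n′ = recompute (j ≤? n) j≤n
  N  = proj₁ (rowBound ν)
  N′ = proj₁ (rowBound ν′)

-- The top row of `rsort` is the shape, and it is counted from the columns.
≗ᶜ⇒shape : {ν ν′ : Partition n} (F : CSF n ν) (G : CSF n ν′) → F ≗ᶜ G → ν ≡ ν′
≗ᶜ⇒shape {n} F G F≗G = mkPartition-cong
  (trans (sym (top (rsort F))) (trans (rsort-cong F G F≗G n ≤-refl) (top (rsort G))))

module _ {ν : Partition (suc m)} (F G : CSF (suc m) ν) (F≗G : F ≗ᶜ G) where

  spliced-cong : spliced F ≡ spliced G
  spliced-cong = cong (λ cs → spliceAll (List.map deleteMax cs))
    (applyUpTo-cong (column F) (column G) (part ν zero) λ c _ → F≗G c)

  next-cong : next F ≗ᶜ next G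
  next-cong c = trans (column-next F c)
      (trans (cong (λ cs → nth [] cs c) spliced-cong) (sym (column-next G c)))

rawΛ-cong : {ν ν′ : Partition n} (F : CSF n ν) (G : CSF n ν′) → F ≗ᶜ G → ∀ j i → rawΛ F j i ≡ rawΛ G j i
rawΛ-cong {zero}  F G F≗G j i = refl
rawΛ-cong {suc m} {ν} F G F≗G j i with refl ← ≗ᶜ⇒shape F G F≗G | j ≟ m
... | yes _ = cong boxOf (applyUpTo-cong _ _ (partℕ ν i) λ c _ → cong (λ a → m ≤ᵇ val a i) (F≗G c))
... | no  _ = rawΛ-cong (next F) (next G) (next-cong F G F≗G) j i

ψ-inv-cong : {ν ν′ : Partition n} (F : CSF n ν) (G : CSF n ν′) → F ≗ᶜ G → ψ-inv F ≈POP ψ-inv G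
ψ-inv-cong F G F≗G = rsort-cong F G F≗G , λ j j<n i → tabulate-nth-≋
  (NE-cong (rsort F) (rsort G) (rsort-cong F G F≗G) j j<n i) (rawΛ-cong F G F≗G j (toℕ i))

-- Injectivity

splice-injective : (σ τ σ′ τ′ : Column n) → length σ < length τ → length σ′ < length τ′ →
  Increasing σ → Increasing τ → Increasing σ′ → Increasing τ′ →
  splice σ τ ≡ splice σ′ τ′ → σ ≡ σ′ × τ ≡ τ′
splice-injective σ τ σ′ τ′ k<ℓ k<ℓ′ p q p′ q′ eq = cong proj₂ eq′ , cong proj₁ eq′
  where
  eq′ : (τ , σ) ≡ (τ′ , σ′)
  eq′ = trans (sym (Splice.splice-involutive σ τ k<ℓ p q))
    (trans (cong (λ (x , y) → splice y x) eq) (Splice.splice-involutive σ′ τ′ k<ℓ′ p′ q′))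

insert-lengths : (σ σ′ : Column n) (cs cs′ : List (Column n)) → length σ ≡ length σ′ →
  List.map length cs ≡ List.map length cs′ →
  List.map length (insert σ cs) ≡ List.map length (insert σ′ cs′)
insert-lengths σ σ′ []       []         eq eqs = cong (_∷ []) eq
insert-lengths σ σ′ (τ ∷ cs) (τ′ ∷ cs′) eq eqs with ∷-injective eqs | length σ <? length τ | length
    σ′ <? length τ′
... | e , es | yes k<ℓ | yes k<ℓ′ = cong₂ _∷_
  (trans (splice-length₁ σ τ k<ℓ) (trans e (sym (splice-length₁ σ′ τ′ k<ℓ′))))
  (insert-lengths _ _ cs cs′ (trans (splice-length₂ σ τ k<ℓ)
      (trans eq (sym (splice-length₂ σ′ τ′ k<ℓ′)))) es)
... | e , es | yes k<ℓ | no k≮ℓ′ = ⊥-elim (k≮ℓ′ (subst₂ _<_ eq e k<ℓ))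
... | e , es | no k≮ℓ | yes k<ℓ′ = ⊥-elim (k≮ℓ (subst₂ _<_ (sym eq) (sym e) k<ℓ′))
... | e , es | no _   | no _     = cong₂ _∷_ eq eqs

spliceAll-lengths : (cs cs′ : List (Column n)) → List.map length cs ≡ List.map length cs′ →
                    List.map length (spliceAll cs) ≡ List.map length (spliceAll cs′)
spliceAll-lengths []       []         _   = refl
spliceAll-lengths (σ ∷ cs) (σ′ ∷ cs′) eqs = let e , es = ∷-injective eqs in
  insert-lengths σ σ′ (spliceAll cs) (spliceAll cs′) e (spliceAll-lengths cs cs′ es)

-- Equal lengths send both insertions through the same branches, so the splices can be undone one by
-- one. Without them the result would not reveal which columns had been spliced.
insert-injective : (σ σ′ : Column n) (cs cs′ : List (Column n)) →
  Increasing σ → Increasing σ′ → All Increasing cs → All Increasing cs′ →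
  length σ ≡ length σ′ → List.map length cs ≡ List.map length cs′ →
  insert σ cs ≡ insert σ′ cs′ → σ ≡ σ′ × cs ≡ cs′
insert-injective σ σ′ [] [] _ _ _ _ _ _ eq = ∷-injective eq
insert-injective σ σ′ (τ ∷ cs) (τ′ ∷ cs′) p p′ (q ∷ qs) (q′ ∷ qs′) eqˡ eqsˡ eq
  with ∷-injective eqsˡ | length σ <? length τ | length σ′ <? length τ′
... | e , es | yes k<ℓ | no k≮ℓ′ = ⊥-elim (k≮ℓ′ (subst₂ _<_ eqˡ e k<ℓ))
... | e , es | no k≮ℓ | yes k<ℓ′ = ⊥-elim (k≮ℓ (subst₂ _<_ (sym eqˡ) (sym e) k<ℓ′))
... | e , es | no _   | no _     = ∷-injective eq
... | e , es | yes k<ℓ | yes k<ℓ′ =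
  let eq₁ , eqs = ∷-injective eq
      eq₂ , cs≡ = insert-injective _ _ cs cs′
        (splice-increasing₂ σ τ k<ℓ p q) (splice-increasing₂ σ′ τ′ k<ℓ′ p′ q′) qs qs′
        (trans (splice-length₂ σ τ k<ℓ) (trans eqˡ (sym (splice-length₂ σ′ τ′ k<ℓ′)))) es eqs
      σ≡ , τ≡   = splice-injective σ τ σ′ τ′ k<ℓ k<ℓ′ p q p′ q′ (cong₂ _,_ eq₁ eq₂)
  in σ≡ , cong₂ _∷_ τ≡ cs≡

spliceAll-injective : (cs cs′ : List (Column n)) → All Increasing cs → All Increasing cs′ →
  List.map length cs ≡ List.map length cs′ → spliceAll cs ≡ spliceAll cs′ → cs ≡ cs′
spliceAll-injective []       []         _        _          _   _  = refl
spliceAll-injective (σ ∷ cs) (σ′ ∷ cs′) (p ∷ ps) (p′ ∷ ps′) eqs eq =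
  let e , es = ∷-injective eqs
      σ≡ , ds≡ = insert-injective σ σ′ (spliceAll cs) (spliceAll cs′) p p′
        (spliceAll-increasing cs ps) (spliceAll-increasing cs′ ps′) e (spliceAll-lengths cs cs′ es) eq
  in cong₂ _∷_ σ≡ (spliceAll-injective cs cs′ ps ps′ es ds≡)

-- Equal lengths and equally many parts give equally many `false`. A leading `true` yields a first
-- part equal to that number, whereas after a leading `false` all parts are smaller.
boxOf-injective : ∀ w w′ → length w ≡ length w′ → boxOf w ≡ boxOf w′ → w ≡ w′
boxOf-injective []          []           _   _  = refl
boxOf-injective (true  ∷ w) (true  ∷ w′) len eq =
  cong (true ∷_) (boxOf-injective w w′ (suc-injective len) (proj₂ (∷-injective eq)))
boxOf-injective (false ∷ w) (false ∷ w′) len eq =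
  cong (false ∷_) (boxOf-injective w w′ (suc-injective len) eq)
boxOf-injective (true  ∷ w) (false ∷ w′) len eq = ⊥-elim (boxOf-true≢false w w′ len eq)
  where
  boxOf-true≢false : ∀ w w′ → suc (length w) ≡ suc (length w′) → boxOf (true ∷ w) ≢ boxOf (false ∷ w′)
  boxOf-true≢false w w′ len eq = <⇒≱ {#false w′} {#false w}
    (≤-reflexive (sym (#false-≡ (true ∷ w) (false ∷ w′) len eq)))
    (subst (λ xs → nth 0 xs 0 ≤ #false w′) (sym eq) (boxOf-≤ w′ 0))
    where
    #false-≡ : ∀ w w′ → length w ≡ length w′ → boxOf w ≡ boxOf w′ → #false w ≡ #false w′
    #false-≡ w w′ len eq = +-cancelˡ-≡ (#true w) _ _ (trans (#true+#false w) (trans len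
      (trans (sym (#true+#false w′)) (cong (_+ #false w′)
        (trans (sym (length-boxOf w′)) (trans (cong length (sym eq)) (length-boxOf w)))))))
boxOf-injective (false ∷ w) (true  ∷ w′) len eq with () ← boxOf-injective (true ∷ w′) (false ∷ w)
    (sym len) (sym eq)

tabulate-nth-injective : ∀ {k l} (xs ys : List ℕ) → length xs ≡ k → length ys ≡ l →
  Vec.tabulate {n = k} (λ p → nth 0 xs (toℕ p)) ≋ Vec.tabulate {n = l} (λ p → nth 0 ys (toℕ p)) → xs ≡ ys
tabulate-nth-injective []       []       refl refl _       = refl
tabulate-nth-injective (x ∷ xs) (y ∷ ys) refl refl (e ∷ p) = cong₂ _∷_ e
    (tabulate-nth-injective xs ys refl refl p)

≤-from-< : ∀ {a b} → (∀ i → i < a → i < b) → a ≤ b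
≤-from-< {zero}  h = z≤n
≤-from-< {suc a} h = h a ≤-refl

deleted-lengths : {ν : Partition (suc m)} (F : CSF (suc m) ν) →
  List.map length (deleted F) ≡ applyUpTo (λ c → length (deleteMax (column F c))) (width F)
deleted-lengths F = trans (cong (List.map length) (deleted-applyUpTo F))
  (map-applyUpTo (deleteMax ∘ column F) length (width F))

module _ {ν : Partition (suc m)} (F G : CSF (suc m) ν)
         (words : ∀ i → i < m → word F i ≡ word G i) (nexts : next F ≗ᶜ next G) where

  private
    letters : ∀ {i} c → i < m → letter F i c ≡ letter G i c
    letters {i} c i<m = trans (sym (nth-word F i c))
        (trans (cong (λ w → nth true w c) (words i i<m)) (nth-word G i c))

    row-< : ∀ (F G : CSF (suc m) ν) → (∀ {i} c → i < m → letter F i c ≡ letter G i c) → ∀ c i →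
      i < length (deleteMax (column F c)) → i < length (deleteMax (column G c))
    row-< F G eq c i i<len with m ≤? val (column G c) i
    ... | no  m≰v = deleted-<⁻ G (≰⇒> m≰v)
    ... | yes m≤v with () ← trans (sym (letter-false F {i} {c} (<⇒≱ (deleted-<⁺ F i<len))))
                              (trans (eq c (<-≤-trans i<len (deleted-length-≤ F c)))
                                  (letter-true G {i} {c} m≤v))

    lengths : List.map length (deleted F) ≡ List.map length (deleted G)
    lengths = trans (deleted-lengths F) (trans
      (applyUpTo-cong _ _ (part ν zero) λ c _ → ≤-antisym
        (≤-from-< (row-< F G letters c)) (≤-from-< (row-< G F (λ c i<m → sym (letters c i<m)) c)))
      (sym (deleted-lengths G)))

    deleted≡ : deleted F ≡ deleted G
    deleted≡ = spliceAll-injective (deleted F) (deleted G) (deleted-increasing F) (deleted-increasing G)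
        lengths
      (trans (columns-next F) (trans (applyUpTo-cong _ _ (part ν zero) λ c _ → nexts c)
          (sym (columns-next G))))

  -- The words give the column lengths after deletion, and with these the splices can be undone. The
  -- deleted cells are then recovered from the common shape ν.
  next-injective : F ≗ᶜ G
  next-injective c = val-injective _ _ λ i → same (below? (suc m) i)
    where
    same : ∀ {i} → Below (suc m) i → val (column F c) i ≡ val (column G c) i
    same (outside n≤i) = trans (val-≥ (column F c) (≤-trans (column-length-≤ F c) n≤i))
      (sym (val-≥ (column G c) (≤-trans (column-length-≤ G c) n≤i)))
    same (inside r) with c <? part ν r
    ... | no  c≮νr = trans (val-column-≥ F r (≮⇒≥ c≮νr)) (sym (val-column-≥ G r (≮⇒≥ c≮νr)))
    -- Inside the shape truncation at m changes no entry: a deleted cell held m, which is also the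
    -- value read below the shortened column.
    ... | yes c<νr = trans (sym (small F)) (trans (cong (λ a → val a (toℕ r)) column≡) (small G))
      where
      small : ∀ F → val (deleteMax (column F c)) (toℕ r) ≡ val (column F c) (toℕ r)
      small F = trans (val-deleted F c (toℕ r)) (m≤n⇒m⊓n≡m (s≤s⁻¹ (val-column-< F r c<νr)))

      c<N : c < part ν zero
      c<N = <-≤-trans c<νr (part≤width F r)

      column≡ : deleteMax (column F c) ≡ deleteMax (column G c)
      column≡ = trans (sym (nth-applyUpTo [] (deleteMax ∘ column F) c<N))
        (trans (cong (λ cs → nth [] cs c)
            (trans (sym (deleted-applyUpTo F)) (trans deleted≡ (deleted-applyUpTo G))))
          (nth-applyUpTo [] (deleteMax ∘ column G) c<N))

rawΛ-injective : {ν ν′ : Partition n} (F : CSF n ν) (G : CSF n ν′) → ψ-inv F ≈POP ψ-inv G →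
                 ∀ j → j < n → (i : Fin j) → rawΛ F j (toℕ i) ≡ rawΛ G j (toℕ i)
rawΛ-injective F G (_ , L) j j<n i = tabulate-nth-injective (rawΛ F j (toℕ i)) (rawΛ G j (toℕ i))
  (rawΛ-length F j j<n i) (rawΛ-length G j j<n i) (L j j<n i)

-- Two shapes with an equation between them, because the induction passes to `next F` and `next G`,
-- whose shapes are equal only by a theorem.
ψ-inv-injective : {ν ν′ : Partition n} (F : CSF n ν) (G : CSF n ν′) → ν ≡ ν′ → ψ-inv F ≈POP ψ-inv G →
    F ≗ᶜ G
ψ-inv-injective {zero}  F G ν≡ν′ F≈G c = refl
ψ-inv-injective {suc m} {ν} F G refl F≈G = next-injective F G words
  (ψ-inv-injective (next F) (next G)
    (mkPartition-cong (trans (sym (T-index F)) (trans (proj₁ F≈G m (n≤1+n m)) (T-index G))))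
    (≈POP-trans {P = ψ-inv (next F)} {P′ = restrict (ψ-inv F)} {P″ = ψ-inv (next G)}
      (≈POP-sym {P = restrict (ψ-inv F)} {P′ = ψ-inv (next F)} (restrict-ψ-inv F))
      (≈POP-trans {P = restrict (ψ-inv F)} {P′ = restrict (ψ-inv G)} {P″ = ψ-inv (next G)}
        (restrict-cong {P = ψ-inv F} {P′ = ψ-inv G} F≈G) (restrict-ψ-inv G))))
  where
  words : ∀ i → i < m → word F i ≡ word G i
  words i i<m = boxOf-injective (word F i) (word G i) (trans (length-word F i) (sym (length-word G i)))
    (subst (λ i → boxOf (word F i) ≡ boxOf (word G i)) (Fin.toℕ-fromℕ< i<m)
      (trans (sym (rawΛ-top F _)) (trans (rawΛ-injective F G F≈G m ≤-refl (Fin.fromℕ< i<m))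
          (rawΛ-top G _))))

-- Surjectivity

-- For all r together these numbers encode the multiset of column lengths.
#≥ : ℕ → List (Column n) → ℕ
#≥ r = ∑ᴸ (λ c → χ (r ≤? length c))

#≥-zero : ∀ r (cs : List (Column n)) → All (λ c → length c < r) cs → #≥ r cs ≡ 0
#≥-zero r []       _        = refl
#≥-zero r (c ∷ cs) (p ∷ ps) = cong₂ _+_ (χ-no (r ≤? length c) (<⇒≱ p)) (#≥-zero r cs ps)

insert-≥ : (σ : Column n) (cs : List (Column n)) → All (λ c → length c ≤ length σ) cs →
    insert σ cs ≡ σ ∷ cs
insert-≥ σ []       _       = refl
insert-≥ σ (τ ∷ cs) (p ∷ _) with length σ <? length τ
... | yes k<ℓ = ⊥-elim (<⇒≱ k<ℓ p)
... | no  _   = refl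

-- `rest-bound` keeps the remaining columns sorted when a longer one is put in front, and `count`
-- says that exactly one column of length k has been removed from the multiset of lengths.
record Uninsert (k : ℕ) (cs : List (Column n)) : Set where
  field
    head       : Column n
    rest       : List (Column n)
    length≡    : length head ≡ k
    insert≡    : insert head rest ≡ cs
    head-inc   : Increasing head
    rest-inc   : All Increasing rest
    rest-shape : PartitionShaped rest
    rest-bound : ∀ b → All (λ c → length c ≤ b) cs → All (λ c → length c ≤ b) rest
    count      : ∀ r → χ (r ≤? k) + #≥ r rest ≡ #≥ r cs

-- The inequality says that some column has length k. The first such column is where the insertion
-- ended; on the way back it is spliced with each longer column before it, and by
-- `splice-involutive` the insertion undoes these splices.
uninsert : ∀ k (cs : List (Column n)) → PartitionShaped cs → All Increasing cs →
           #≥ (suc k) cs < #≥ k cs → Uninsert k cs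
uninsert k []       _        _        ()
uninsert k (c ∷ cs) (s ∷ ss) (p ∷ ps) lt with <-cmp (length c) k
... | tri< c<k _ _ = ⊥-elim (n≮0 (subst (#≥ (suc k) (c ∷ cs) <_)
        (#≥-zero k (c ∷ cs) (c<k ∷ All.map (λ d≤c → ≤-<-trans d≤c c<k) s)) lt))
... | tri≈ _ refl _ = record
  { head = c ; rest = cs ; length≡ = refl ; insert≡ = insert-≥ c cs s
  ; head-inc = p ; rest-inc = ps ; rest-shape = ss
  ; rest-bound = λ { b (_ ∷ bs) → bs }
  ; count = λ r → refl
  }
... | tri> _ _ k<c = record
  { head = τ̄ ; rest = σ̄ ∷ rest
  ; length≡ = trans (splice-length₂ head c k<c′) length≡
  ; insert≡ = insert-step
  ; head-inc = splice-increasing₂ head c k<c′ head-inc p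
  ; rest-inc = splice-increasing₁ head c k<c′ head-inc p ∷ rest-inc
  ; rest-shape = subst (λ b → All (λ d → length d ≤ b) rest) (sym len₁) (rest-bound (length c) s)
      ∷ rest-shape
  ; rest-bound = λ { b (q ∷ qs) → subst (_≤ b) (sym len₁) q ∷ rest-bound b qs }
  ; count = λ r → trans (cong (λ l → χ (r ≤? k) + (χ (r ≤? l) + #≥ r rest)) len₁)
      (trans (exchange (χ (r ≤? k)) (χ (r ≤? length c)) (#≥ r rest))
          (cong (χ (r ≤? length c) +_) (count r)))
  }
  where
  tail : Uninsert k cs
  tail = uninsert k cs ss ps (+-cancelˡ-< 1 _ _ (subst₂ _<_
    (cong (_+ #≥ (suc k) cs) (χ-yes (suc k ≤? length c) k<c))
    (cong (_+ #≥ k cs) (χ-yes (k ≤? length c) (<⇒≤ k<c))) lt))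
  open Uninsert tail
  k<c′ : length head < length c
  k<c′ = subst (_< length c) (sym length≡) k<c
  open Splice head c k<c′ head-inc p using (σ̄; τ̄; splice-involutive)

  len₁ : length σ̄ ≡ length c
  len₁ = splice-length₁ head c k<c′

  exchange : ∀ a b c → a + (b + c) ≡ b + (a + c)
  exchange = solve-∀

  insert-step : insert τ̄ (σ̄ ∷ rest) ≡ c ∷ cs
  insert-step with length τ̄ <? length σ̄
  ... | no  k≮ℓ = ⊥-elim (k≮ℓ (subst₂ _<_ (sym (splice-length₂ head c k<c′)) (sym len₁) k<c′))
  ... | yes _   = trans (cong (λ (x , y) → x ∷ insert y rest) splice-involutive) (cong (c ∷_) insert≡)

countℕ : ℕ → List ℕ → ℕ
countℕ r = ∑ᴸ (λ k → χ (r ≤? k))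

countℕ-anti : ∀ r ks → countℕ (suc r) ks ≤ countℕ r ks
countℕ-anti r []       = z≤n
countℕ-anti r (k ∷ ks) = +-mono-≤ (step (suc r ≤? k)) (countℕ-anti r ks)
  where
  step : Dec (suc r ≤ k) → χ (suc r ≤? k) ≤ χ (r ≤? k)
  step (yes r<k) = ≤-reflexive (trans (χ-yes (suc r ≤? k) r<k) (sym (χ-yes (r ≤? k) (<⇒≤ r<k))))
  step (no  r≮k) = subst (_≤ χ (r ≤? k)) (sym (χ-no (suc r ≤? k) r≮k)) z≤n

-- The lengths may be prescribed in any order: the head of `ks` is extracted by `uninsert`, and the
-- counts of the other lengths still match.
unspliceAll : ∀ ks (cs : List (Column n)) → PartitionShaped cs → All Increasing cs →
  (∀ r → countℕ r ks ≡ #≥ r cs) →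
  Σ[ bs ∈ List (Column n) ] (List.map length bs ≡ ks × spliceAll bs ≡ cs × All Increasing bs)
unspliceAll []       []       _ _ _  = [] , refl , refl , []
-- At r = 0 the two counts are the numbers of columns.
unspliceAll []       (c ∷ cs) _ _ eq with () ← eq 0
unspliceAll (k ∷ ks) cs       s p eq =
  let open Uninsert u
      bs , lens , splice≡ , inc = unspliceAll ks rest rest-shape rest-inc
        λ r → +-cancelˡ-≡ (χ (r ≤? k)) _ _ (trans (eq r) (sym (count r)))
  in head ∷ bs , cong₂ _∷_ length≡ lens , trans (cong (insert head) splice≡) insert≡ , head-inc ∷ inc
  where
  u : Uninsert k cs
  u = uninsert k cs s p (subst₂ _<_
    (trans (cong (_+ countℕ (suc k) ks) (sym (χ-no (suc k ≤? k) (<⇒≱ ≤-refl)))) (eq (suc k)))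
    (trans (cong (_+ countℕ k ks) (sym (χ-yes (k ≤? k) ≤-refl))) (eq k))
    (s≤s (countℕ-anti k ks)))

-- Words with a given partition

Chain : ℕ → List ℕ → Set
Chain ℓ []       = ⊤
Chain ℓ (x ∷ xs) = x ≤ ℓ × Chain x xs

falses : ℕ → List Bool → List Bool
falses zero    w = w
falses (suc k) w = false ∷ falses k w

-- A part x must have exactly x letters `false` after it, so of the ℓ still to be placed ℓ - x come
-- first.
wordOf : ℕ → List ℕ → List Bool
wordOf ℓ []       = falses ℓ []
wordOf ℓ (x ∷ xs) = falses (ℓ ∸ x) (true ∷ wordOf x xs)

boxOf-falses : ∀ k w → boxOf (falses k w) ≡ boxOf w
boxOf-falses zero    w = refl
boxOf-falses (suc k) w = boxOf-falses k w

#false-falses : ∀ k w → #false (falses k w) ≡ k + #false w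
#false-falses zero    w = refl
#false-falses (suc k) w = cong suc (#false-falses k w)

length-falses : ∀ k w → length (falses k w) ≡ k + length w
length-falses zero    w = refl
length-falses (suc k) w = cong suc (length-falses k w)

nth-falses : ∀ k w {c} → c < k → nth true (falses k w) c ≡ false
nth-falses (suc k) w {zero}  _         = refl
nth-falses (suc k) w {suc c} (s≤s c<k) = nth-falses k w c<k

#false-wordOf : ∀ ℓ xs → Chain ℓ xs → #false (wordOf ℓ xs) ≡ ℓ
#false-wordOf ℓ []       _         = trans (#false-falses ℓ []) (+-identityʳ ℓ)
#false-wordOf ℓ (x ∷ xs) (x≤ℓ , p) = trans (#false-falses (ℓ ∸ x) _)
  (trans (cong (ℓ ∸ x +_) (#false-wordOf x xs p)) (m∸n+n≡m x≤ℓ))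

boxOf-wordOf : ∀ ℓ xs → Chain ℓ xs → boxOf (wordOf ℓ xs) ≡ xs
boxOf-wordOf ℓ []       _         = boxOf-falses ℓ []
boxOf-wordOf ℓ (x ∷ xs) (x≤ℓ , p) = trans (boxOf-falses (ℓ ∸ x) _)
  (cong₂ _∷_ (#false-wordOf x xs p) (boxOf-wordOf x xs p))

length-wordOf : ∀ ℓ xs → Chain ℓ xs → length (wordOf ℓ xs) ≡ length xs + ℓ
length-wordOf ℓ xs p = trans (sym (#true+#false w)) (cong₂ _+_
  (trans (sym (length-boxOf w)) (cong length (boxOf-wordOf ℓ xs p))) (#false-wordOf ℓ xs p))
  where w = wordOf ℓ xs

-- The first part x is at most ℓ - a, so the initial run has ℓ - x ≥ a letters.
wordOf-prefix : ∀ a ℓ xs → a ≤ ℓ → (∀ p → nth 0 xs p ≤ ℓ ∸ a) → ∀ c → c < a →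
    nth true (wordOf ℓ xs) c ≡ false
wordOf-prefix a ℓ []       a≤ℓ h c c<a = nth-falses ℓ [] (<-≤-trans c<a a≤ℓ)
wordOf-prefix a ℓ (x ∷ xs) a≤ℓ h c c<a = nth-falses (ℓ ∸ x) _ (<-≤-trans c<a
  (m+n≤o⇒m≤o∸n a (subst (_≤ ℓ) (+-comm x a) (subst (x + a ≤_) (m∸n+n≡m a≤ℓ) (+-monoˡ-≤ a (h 0))))))

-- Inverting one step of delete-and-splice

countFalse : ℕ → (ℕ → Bool) → ℕ
countFalse m f = ∑ m λ s → if f s then 0 else 1

DownClosed : ℕ → (ℕ → Bool) → Set
DownClosed m f = ∀ s → suc s < m → f (suc s) ≡ false → f s ≡ false

downClosed-true : ∀ m f → DownClosed m f → f 0 ≡ true → ∀ s → s < m → f s ≡ true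
downClosed-true m f down f0 zero    _   = f0
downClosed-true m f down f0 (suc s) s<m with f (suc s) in eq
... | true  = refl
... | false with () ← trans (sym (down s s<m eq)) (downClosed-true m f down f0 s (<⇒≤ s<m))

-- The `false` values form an initial segment, whose length is their number. Applied to the letters
-- of one column, this reads off its length after deletion.
<-countFalse : ∀ m f → DownClosed m f → ∀ s → s < m →
               (s < countFalse m f → f s ≡ false) × (f s ≡ false → s < countFalse m f)
<-countFalse (suc m) f down s s<m with f 0 in eq
... | true = (λ s< → ⊥-elim (n≮0 (subst (s <_) none s<))) , λ fs≡false → case-absurd fs≡false
  where
  none : ∑ m (λ s → if f (suc s) then 0 else 1) ≡ 0
  none = ∑-zero m λ i i<m → cong (if_then 0 else 1) (downClosed-true (suc m) f down eq (suc i) (s≤s i<m))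
  case-absurd : f s ≡ false → s < ∑ m (λ s → if f (suc s) then 0 else 1)
  case-absurd fs with () ← trans (sym fs) (downClosed-true (suc m) f down eq s s<m)
<-countFalse (suc m) f down zero    s<m       | false = (λ _ → eq) , λ _ → s≤s z≤n
<-countFalse (suc m) f down (suc s) (s≤s s<m) | false =
  let to , from = <-countFalse m (f ∘ suc) (λ s s<m → down (suc s) (s≤s s<m)) s s<m
  in to ∘ s≤s⁻¹ , s≤s ∘ from

countFalse-≤ : ∀ m f → countFalse m f ≤ m
countFalse-≤ zero    f = z≤n
countFalse-≤ (suc m) f with f 0
... | true  = m≤n⇒m≤1+n (countFalse-≤ m (f ∘ suc))
... | false = s≤s (countFalse-≤ m (f ∘ suc))

∑-nth : ∀ N w → length w ≤ N → ∑ N (λ c → if nth true w c then 0 else 1) ≡ #false w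
∑-nth N       []      _         = ∑-zero N λ _ _ → refl
∑-nth (suc N) (b ∷ w) (s≤s w≤N) = cong ((if b then 0 else 1) +_) (∑-nth N w w≤N)

nth-map-length : (bs : List (Column n)) (c : ℕ) → nth 0 (List.map length bs) c ≡ length (nth [] bs c)
nth-map-length []       c       = refl
nth-map-length (b ∷ bs) zero    = refl
nth-map-length (b ∷ bs) (suc c) = nth-map-length bs c

partℕ-fromℕ< : (ν : Partition n) {i : ℕ} (i<n : i < n) → partℕ ν i ≡ part ν (Fin.fromℕ< i<n)
partℕ-fromℕ< ν i<n = trans (cong (partℕ ν) (sym (Fin.toℕ-fromℕ< i<n))) (partℕ-toℕ ν (Fin.fromℕ< i<n))

partℕ-anti : (ν : Partition n) {i j : ℕ} → i ≤ j → partℕ ν j ≤ partℕ ν i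
partℕ-anti {n} ν {i} {j} i≤j with j <? n
... | no  j≮n = subst (_≤ partℕ ν i) (sym (partℕ-≥ ν (≮⇒≥ j≮n))) z≤n
... | yes j<n = subst₂ _≤_ (sym (partℕ-fromℕ< ν j<n)) (sym (partℕ-fromℕ< ν i<n))
  (part-mono ν (subst₂ _≤_ (sym (Fin.toℕ-fromℕ< i<n)) (sym (Fin.toℕ-fromℕ< j<n)) i≤j))
  where i<n = ≤-<-trans i≤j j<n

<-column-partℕ : {ν : Partition n} (F : CSF n ν) {c i : ℕ} → i < n →
  (c < partℕ ν i → i < length (column F c)) × (i < length (column F c) → c < partℕ ν i)
<-column-partℕ {ν = ν} F {c} {i} i<n =
  (λ c<ν → subst (_< length (column F c)) r≡i (<-column⁺ F r (subst (c <_) (partℕ-fromℕ< ν i<n) c<ν))) ,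
  λ i<len → subst (c <_) (sym (partℕ-fromℕ< ν i<n))
      (<-column⁻ F r (subst (_< length (column F c)) (sym r≡i) i<len))
  where
  r = Fin.fromℕ< i<n
  r≡i = Fin.toℕ-fromℕ< i<n

-- The hypotheses on `w` are what `length-word`, `#false-word` and `word-prefix` give for the words
-- of a filling whose next shape is μ; they suffice to build such a filling over `G`.
module Lift {ν : Partition (suc m)} {μ : Partition m} (μ≺ν : parts μ ≺ parts ν) (G : CSF m μ)
  (w : ℕ → List Bool)
  (w-length : ∀ i → i < m → length (w i) ≡ partℕ ν i)
  (w-#false : ∀ i → i < m → #false (w i) ≡ partℕ μ i)
  (w-prefix : ∀ i → i < m → ∀ c → c < partℕ ν (suc i) → nth true (w i) c ≡ false)
  where

  private
    N : ℕ
    N = part ν zero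

    μ≤N : ∀ r → part μ r ≤ N
    μ≤N r = ≤-trans (proj₁ (μ≺ν r)) (part-mono ν {zero} {Fin.inject₁ r} z≤n)

    νℕ≤N : ∀ i → partℕ ν i ≤ N
    νℕ≤N i = subst (partℕ ν i ≤_) (partℕ-toℕ ν zero) (partℕ-anti ν {0} {i} z≤n)

    -- As in the words, `false` marks the cells that survive the deletion.
    present : ℕ → ℕ → Bool
    present c i = nth true (w i) c

    ks : ℕ → ℕ
    ks c = countFalse m (present c)

    present-< : ∀ {i c} → i < m → present c i ≡ false → c < partℕ ν i
    present-< {i} {c} i<m eq with c <? partℕ ν i
    ... | yes c<ν = c<ν
    ... | no  c≮ν with () ← trans (sym eq)
        (nth-≥ true (w i) (subst (_≤ c) (sym (w-length i i<m)) (≮⇒≥ c≮ν)))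

    downClosed : ∀ c → DownClosed m (present c)
    downClosed c s s<m eq = w-prefix s (<⇒≤ s<m) c (present-< s<m eq)

    ks-⇔ : ∀ c i → i < m → (i < ks c → present c i ≡ false) × (present c i ≡ false → i < ks c)
    ks-⇔ c = <-countFalse m (present c) (downClosed c)

    cs : List (Column m)
    cs = applyUpTo (column G) N

    cs-shaped : PartitionShaped cs
    cs-shaped = AllPairs.applyUpTo⁺₁ (column G) N λ i<j _ → column-shaped G (<⇒≤ i<j)

    cs-increasing : All Increasing cs
    cs-increasing = All.applyUpTo⁺₂ (column G) N (column-increasing G)

    -- Row by row: the columns meant to reach row s after deletion number `#false (w s)`, and those
    -- of `G` reaching it number the part of μ with index s.
    counts : ∀ r → countℕ r (applyUpTo ks N) ≡ #≥ r cs
    counts r = trans (∑ᴸ-applyUpTo (λ k → χ (r ≤? k)) ks N)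
      (trans (columnwise r) (sym (∑ᴸ-applyUpTo (λ c → χ (r ≤? length c)) (column G) N)))
      where
      columnwise : ∀ r → ∑ N (λ c → χ (r ≤? ks c)) ≡ ∑ N (λ c → χ (r ≤? length (column G c)))
      columnwise zero    = refl
      columnwise (suc s) with s <? m
      ... | no  s≮m = trans
        (∑-zero N λ c _ → χ-no (suc s ≤? ks c) λ s<ks → s≮m (<-≤-trans s<ks (countFalse-≤ m (present c))))
        (sym (∑-zero N λ c _ → χ-no (suc s ≤? length (column G c))
            λ s<len → s≮m (<-≤-trans s<len (column-length-≤ G c))))
      ... | yes s<m = begin
        ∑ N (λ c → χ (suc s ≤? ks c))
          ≡⟨ ∑-cong N (λ c _ → letter-χ c) ⟩
        ∑ N (λ c → if present c s then 0 else 1)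
          ≡⟨ ∑-nth N (w s) (subst (_≤ N) (sym (w-length s s<m)) (νℕ≤N s)) ⟩
        #false (w s)
          ≡⟨ w-#false s s<m ⟩
        partℕ μ s
          ≡⟨ ∑-χ< (subst (_≤ N) (sym (partℕ-fromℕ< μ s<m)) (μ≤N _)) ⟨
        ∑ N (λ c → χ (c <? partℕ μ s))
          ≡⟨ ∑-cong N (λ c _ → χ-⇔ (c <? partℕ μ s) (suc s ≤? length (column G c))
               (proj₁ (<-column-partℕ G s<m)) (proj₂ (<-column-partℕ G s<m))) ⟩
        ∑ N (λ c → χ (suc s ≤? length (column G c))) ∎
        where
        open ≡-Reasoning
        letter-χ : ∀ c → χ (suc s ≤? ks c) ≡ (if present c s then 0 else 1)
        letter-χ c with present c s | ks-⇔ c s s<m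
        ... | true  | to , _ = χ-no (suc s ≤? ks c) λ s<ks → case-absurd (to s<ks)
          where
          case-absurd : true ≢ false
          case-absurd ()
        ... | false | _ , from = χ-yes (suc s ≤? ks c) (from refl)

    uns : Σ[ bs ∈ List (Column m) ]
        (List.map length bs ≡ applyUpTo ks N × spliceAll bs ≡ cs × All Increasing bs)
    uns = unspliceAll (applyUpTo ks N) cs cs-shaped cs-increasing counts

    bs : List (Column m)
    bs = proj₁ uns

    b : ℕ → Column m
    b = nth [] bs

    bs-length : length bs ≡ N
    bs-length = trans (sym (length-map length bs))
        (trans (cong length (proj₁ (proj₂ uns))) (length-applyUpTo ks N))

    b-increasing : ∀ c → Increasing (b c)
    b-increasing = nth-All {P = Increasing} (fromAllPairs []) (proj₂ (proj₂ (proj₂ uns)))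

    b-length : ∀ {c} → c < N → length (b c) ≡ ks c
    b-length {c} c<N = trans (sym (nth-map-length bs c))
      (trans (cong (λ xs → nth 0 xs c) (proj₁ (proj₂ uns))) (nth-applyUpTo 0 ks c<N))

    <-b⁺ : ∀ {c i} → i < m → present c i ≡ false → i < length (b c)
    <-b⁺ {c} {i} i<m eq = subst (i <_) (sym (b-length (<-≤-trans (present-< i<m eq) (νℕ≤N i))))
        (proj₂ (ks-⇔ c i i<m) eq)

    <-b⁻ : ∀ {c i} → i < length (b c) → i < m × present c i ≡ false
    <-b⁻ {c} {i} i<len with c <? N
    ... | no  c≮N = ⊥-elim (n≮0 (subst (λ a → i < length a)
        (nth-≥ [] bs (subst (_≤ c) (sym bs-length) (≮⇒≥ c≮N))) i<len))
    ... | yes c<N = i<m , proj₁ (ks-⇔ c i i<m) i<ks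
      where
      i<ks : i < ks c
      i<ks = subst (i <_) (b-length c<N) i<len
      i<m : i < m
      i<m = <-≤-trans i<ks (countFalse-≤ m (present c))

    value : ∀ c i → val (b c) i < suc m
    value c i = s≤s (val-≤ (b c) i)

  -- Below the end of `b c` the function `val` reads m, so the cells of ν not covered by the
  -- unspliced columns receive the maximal entry.
  F : CSF (suc m) ν
  F = record
    { entry      = λ (cell r c) → Fin.fromℕ< (value (toℕ c) (toℕ r))
    ; increasing = λ {r} {r′} {c} {c′} c≡c′ r<r′ → subst₂ _<_
        (sym (Fin.toℕ-fromℕ< (value (toℕ c) (toℕ r)))) (sym (Fin.toℕ-fromℕ< (value (toℕ c′) (toℕ r′))))
        (subst (λ k → val (b k) (toℕ r) < val (b (toℕ c′)) (toℕ r′)) (sym c≡c′)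
            (rise r<r′ (Fin.toℕ<n c′)))
    }
    where
    rise : ∀ {r r′ c} → r Fin.< r′ → c < part ν r′ → val (b c) (toℕ r) < val (b c) (toℕ r′)
    -- A cell in a lower row r′ puts column c into the `false` prefix of row r. Hence row r lies
    -- inside `b c`, where the value strictly exceeds none of the later ones, the ∞ value m
    -- included.
    rise {r} {r′} {c} r<r′ c<ν = s≤s⁻¹ (E-increasing (b-increasing c) (s≤s r<r′) (<-b⁺ r<m
      (w-prefix (toℕ r) r<m c (<-≤-trans (subst (c <_) (sym (partℕ-toℕ ν r′)) c<ν) (partℕ-anti ν r<r′)))))
      where
      r<m : toℕ r < m
      r<m = <-≤-trans r<r′ (s≤s⁻¹ (Fin.toℕ<n r′))

  private
    val-F : ∀ {c} r → c < part ν r → val (column F c) (toℕ r) ≡ val (b c) (toℕ r)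
    val-F {c} r c<ν = trans (cong (λ c → val (column F c) (toℕ r)) (sym c≡))
      (trans (val-column-cell F r (Fin.fromℕ< c<ν))
        (trans (Fin.toℕ-fromℕ< (value _ (toℕ r))) (cong (λ c → val (b c) (toℕ r)) c≡)))
      where c≡ = Fin.toℕ-fromℕ< c<ν

    deleteMax-F : ∀ c → deleteMax (column F c) ≡ b c
    deleteMax-F c = val-injective _ _ λ i → trans (val-deleted F c i) (same (below? (suc m) i))
      where
      same : ∀ {i} → Below (suc m) i → val (column F c) i ⊓ m ≡ val (b c) i
      same (outside n≤i) = trans (cong (_⊓ m) (val-≥ (column F c) (≤-trans (column-length-≤ F c) n≤i)))
        (trans (m≥n⇒m⊓n≡n (n≤1+n m))
          (sym (val-≥ (b c) (≤-trans (increasing-length (b-increasing c)) (≤-trans (n≤1+n m) n≤i)))))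
      same (inside r) with c <? part ν r
      ... | yes c<ν = trans (cong (_⊓ m) (val-F r c<ν)) (m≤n⇒m⊓n≡m (val-≤ (b c) (toℕ r)))
      -- A surviving cell lies in ν, so outside ν the column `b c` has ended too.
      ... | no  c≮ν = trans (cong (_⊓ m) (val-column-≥ F r (≮⇒≥ c≮ν))) (trans (m≥n⇒m⊓n≡n (n≤1+n m))
        (sym (val-≥ (b c) (≮⇒≥ λ r<len → c≮ν
            (subst (c <_) (partℕ-toℕ ν r) (uncurry present-< (<-b⁻ r<len)))))))

    spliced-F : spliced F ≡ cs
    spliced-F = trans (cong spliceAll (trans (deleted-applyUpTo F)
      (sym (≡-applyUpTo [] bs _ bs-length λ c _ → sym (deleteMax-F c))))) (proj₁ (proj₂ (proj₂ uns)))

  next-F : next F ≗ᶜ G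
  next-F c = trans (column-next F c) (trans (cong (λ cs → nth [] cs c) spliced-F) (last (c <? N)))
    where
    last : Dec (c < N) → nth [] cs c ≡ column G c
    last (yes c<N) = nth-applyUpTo [] (column G) c<N
    last (no  c≮N) = trans (nth-≥ [] cs (subst (_≤ c) (sym (length-applyUpTo (column G) N)) (≮⇒≥ c≮N)))
      (sym (val-injective _ _ λ i → val-column-partℕ G i (≤-trans (μℕ≤N i) (≮⇒≥ c≮N))))
      where
      μℕ≤N : ∀ i → partℕ μ i ≤ N
      μℕ≤N i with i <? m
      ... | yes i<m = subst (_≤ N) (sym (partℕ-fromℕ< μ i<m)) (μ≤N _)
      ... | no  i≮m = subst (_≤ N) (sym (partℕ-≥ μ (≮⇒≥ i≮m))) z≤n

  word-F : ∀ i → i < m → word F i ≡ w i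
  word-F i i<m = sym (≡-applyUpTo true (w i) (letter F i) (w-length i i<m) λ c _ → same c)
    where
    same : ∀ c → nth true (w i) c ≡ letter F i c
    same c with m ≤? val (column F c) i
    ... | no  m≰v = trans (proj₂ (<-b⁻
        (subst (λ a → i < length a) (deleteMax-F c) (deleted-<⁻ F (≰⇒> m≰v)))))
      (sym (letter-false F {i} {c} m≰v))
    ... | yes m≤v with nth true (w i) c in eq
    ...   | true  = sym (letter-true F {i} {c} m≤v)
    ...   | false = ⊥-elim (<⇒≱ (deleted-<⁺ F
        (subst (λ a → i < length a) (sym (deleteMax-F c)) (<-b⁺ i<m eq))) m≤v)

chain-toList : ∀ {k} (v : Vec ℕ k) ℓ → (∀ i → lookup v i ≤ ℓ) →
               (∀ {i j} → i Fin.≤ j → lookup v j ≤ lookup v i) → Chain ℓ (Vec.toList v)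
chain-toList Vec.[]      ℓ h d = tt
chain-toList (x Vec.∷ v) ℓ h d = h zero , chain-toList v x (λ i → d {zero} {suc i} z≤n)
    (λ i≤j → d (s≤s i≤j))

length-toList : ∀ {k} (v : Vec A k) → length (Vec.toList v) ≡ k
length-toList Vec.[]      = refl
length-toList (x Vec.∷ v) = cong suc (length-toList v)

nth-toList-≤ : ∀ {k ℓ} (v : Vec ℕ k) → (∀ i → lookup v i ≤ ℓ) → ∀ p → nth 0 (Vec.toList v) p ≤ ℓ
nth-toList-≤ Vec.[]      h p       = z≤n
nth-toList-≤ (x Vec.∷ v) h zero    = h zero
nth-toList-≤ (x Vec.∷ v) h (suc p) = nth-toList-≤ v (h ∘ suc) p

tabulate-toList-≋ : ∀ {k l} {xs : List ℕ} (v : Vec ℕ l) → k ≡ l → xs ≡ Vec.toList v →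
                    Vec.tabulate {n = k} (λ p → nth 0 xs (toℕ p)) ≋ v
tabulate-toList-≋ v refl refl = ≡⇒≋
    (lookup-injective _ _ λ i → trans (lookup∘tabulate _ i) (nth-toList v 0 i))

module _ {ν : Partition (suc m)} (P : POP (suc m) ν) where

  private
    μ : Partition m
    μ = ⨆≺.index (br P)

    μ≺ν : parts μ ≺ parts ν
    μ≺ν = ⨆≺.index≺ (br P)

    top-lookup : ∀ i → lookup (T (pr P) (suc m) ≤-refl) i ≡ part ν i
    top-lookup i = cong (λ v → lookup v i) (top (pr P))

    module Row (i : Fin m) where

      π : Box (NE (pr P) m ≤-refl i) (SE (pr P) m ≤-refl i)
      π = Λ P m ≤-refl i

      xs : List ℕ
      xs = Vec.toList (parts (partition π))

      SE≡ : SE (pr P) m ≤-refl i ≡ part μ i ∸ part ν (suc i)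
      SE≡ = cong (part μ i ∸_) (top-lookup (suc i))

      bound : ∀ p → lookup (parts (partition π)) p ≤ part μ i ∸ part ν (suc i)
      bound p = subst (lookup (parts (partition π)) p ≤_) SE≡ (bounded π p)

      chain : Chain (part μ i) xs
      chain = chain-toList _ (part μ i) (λ p → ≤-trans (bound p) (m∸n≤m (part μ i) (part ν (suc i))))
        (part-mono (partition π))

      rowWord : List Bool
      rowWord = wordOf (part μ i) xs

      length-rowWord : length rowWord ≡ part ν (Fin.inject₁ i)
      length-rowWord = trans (length-wordOf (part μ i) xs chain)
        (trans (cong (_+ part μ i) (trans (length-toList (parts (partition π)))
            (cong (_∸ part μ i) (top-lookup (Fin.inject₁ i)))))
          (m∸n+n≡m (proj₁ (μ≺ν i))))

      prefix-rowWord : ∀ c → c < part ν (suc i) → nth true rowWord c ≡ false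
      prefix-rowWord = wordOf-prefix (part ν (suc i)) (part μ i) xs (proj₂ (μ≺ν i))
        (nth-toList-≤ (parts (partition π)) bound)

    w : ℕ → List Bool
    w i with i <? m
    ... | yes i<m = Row.rowWord (Fin.fromℕ< i<m)
    ... | no  _   = []

    w-spec : (Q : ℕ → List Bool → Set) → (∀ i → Q (toℕ i) (Row.rowWord i)) → ∀ i → i < m → Q i (w i)
    w-spec Q h i i<m with i <? m
    ... | yes i<m = subst (λ k → Q k (Row.rowWord (Fin.fromℕ< i<m))) (Fin.toℕ-fromℕ< i<m)
        (h (Fin.fromℕ< i<m))
    ... | no  i≮m = ⊥-elim (i≮m i<m)

    w-toℕ : ∀ i → w (toℕ i) ≡ Row.rowWord i
    w-toℕ i with toℕ i <? m
    ... | yes i<m = cong Row.rowWord (Fin.fromℕ<-toℕ i i<m)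
    ... | no  i≮m = ⊥-elim (i≮m (Fin.toℕ<n i))

  -- The words are those of the top row of Λ, each with as many `false` letters as the corresponding
  -- entry of the row below the top of the pattern. Lower rows of `P` are already matched by `G`.
  lift : (G : CSF m μ) → ψ-inv G ≈POP restrict P → Σ[ F ∈ CSF (suc m) ν ] ψ-inv F ≈POP P
  lift G G≈P = F , patterns , λ j j<n i → boxes j (recompute (j <? suc m) j<n) i
    where
    open Lift {ν = ν} {μ = μ} μ≺ν G w
      (w-spec (λ i u → length u ≡ partℕ ν i) λ i → trans (Row.length-rowWord i)
        (trans (sym (partℕ-toℕ ν (Fin.inject₁ i))) (cong (partℕ ν) (Fin.toℕ-inject₁ i))))
      (w-spec (λ i u → #false u ≡ partℕ μ i) λ i → trans
        (#false-wordOf (part μ i) (Row.xs i) (Row.chain i)) (sym (partℕ-toℕ μ i)))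
      (w-spec (λ i u → ∀ c → c < partℕ ν (suc i) → nth true u c ≡ false) λ i c c<ν →
        Row.prefix-rowWord i c (subst (c <_) (partℕ-toℕ ν (suc i)) c<ν))

    patterns : rsort F ≈GT pr P
    patterns j j≤n with j ≟ suc m
    ... | yes refl = trans (top (rsort F)) (sym (top (pr P)))
    ... | no  j≢n  = trans (T-next F j j≤m) (trans (rsort-cong (next F) G next-F j j≤m) (proj₁ G≈P j j≤m))
      where
      j≤m : j ≤ m
      j≤m = s≤s⁻¹ (≤∧≢⇒< (recompute (j ≤? suc m) j≤n) j≢n)

    boxes : ∀ j (j<n : j < suc m) i →
        parts (partition (Λ (ψ-inv F) j j<n i)) ≋ parts (partition (Λ P j j<n i))
    boxes j (s≤s j≤m) i with m≤n⇒m<n∨m≡n j≤m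
    ... | inj₁ j<m  = ≋-trans (proj₂ (restrict-ψ-inv F) j j<m i)
      (≋-trans (proj₂ (ψ-inv-cong (next F) G next-F) j j<m i) (proj₂ G≈P j j<m i))
    ... | inj₂ refl = tabulate-toList-≋ (parts (partition (Row.π i)))
      (NE-cong (rsort F) (pr P) patterns m ≤-refl i)
      (trans (rawΛ-top F (toℕ i)) (trans (cong boxOf (trans (word-F (toℕ i) (Fin.toℕ<n i)) (w-toℕ i)))
        (boxOf-wordOf (part μ i) (Row.xs i) (Row.chain i))))

ψ-inv-surjective : {ν : Partition n} (P : POP n ν) → Σ[ F ∈ CSF n ν ] ψ-inv F ≈POP P
ψ-inv-surjective {zero} P = record { entry = λ { (cell () _) } ; increasing = λ { {()} } } , patterns ,
    λ j ()
  where
  patterns : ∀ j .(j≤0 : j ≤ 0) → _ ≡ T (pr P) j j≤0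
  patterns zero j≤0 with T (pr P) zero j≤0
  ... | Vec.[] = refl
ψ-inv-surjective {suc m} P =
  let G , G≈P = ψ-inv-surjective (restrict P)
  in lift P G G≈P

-- The two bijections

Ψ : Statistic → (n : ℕ) (ν : Partition n) → Bijection (CSF-setoid n ν) (POP-setoid n ν)
Ψ inv n ν = record
  { to        = ψ-inv
  ; cong      = λ {F} {G} F≈G → ψ-inv-cong F G (≈⇒≗ᶜ F G F≈G)
  ; bijective = (λ {F} {G} ψF≈ψG → ≗ᶜ⇒≈ F G (ψ-inv-injective F G refl ψF≈ψG)) ,
      λ P → let F , F≈P = ψ-inv-surjective P in
        F , λ {G} G≈F → ≈POP-trans {P = ψ-inv G} {P′ = ψ-inv F} {P″ = P} (ψ-inv-cong G F (≈⇒≗ᶜ G F G≈F))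
            F≈P
  }
Ψ quinv n ν = record
  { to        = ψ quinv
  ; cong      = λ {F} {G} F≈G → boxcomp-cong (ψ-inv F) (ψ-inv G) (ψ-inv-cong F G (≈⇒≗ᶜ F G F≈G))
  ; bijective = (λ {F} {G} ψF≈ψG → ≗ᶜ⇒≈ F G (ψ-inv-injective F G refl
        (≈POP-trans {P = ψ-inv F} {P′ = boxcomp (ψ quinv F)} {P″ = ψ-inv G}
          (≈POP-sym {P = boxcomp (ψ quinv F)} {P′ = ψ-inv F} (boxcomp-involutive (ψ-inv F)))
          (≈POP-trans {P = boxcomp (ψ quinv F)} {P′ = boxcomp (ψ quinv G)} {P″ = ψ-inv G}
            (boxcomp-cong (ψ quinv F) (ψ quinv G) ψF≈ψG) (boxcomp-involutive (ψ-inv G)))))) ,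
      -- Complementation is an involution up to ≈POP, so a preimage of P is a `ψ-inv` preimage of
      -- its complement.
      λ P → let F , F≈P = ψ-inv-surjective (boxcomp P) in
        F , λ {G} G≈F → ≈POP-trans {P = ψ quinv G} {P′ = boxcomp (boxcomp P)} {P″ = P}
          (boxcomp-cong (ψ-inv G) (boxcomp P)
            (≈POP-trans {P = ψ-inv G} {P′ = ψ-inv F} {P″ = boxcomp P} (ψ-inv-cong G F (≈⇒≗ᶜ G F G≈F))
                F≈P))
          (boxcomp-involutive P)
  }

theorem2 : Σ[ Ψ ∈ (Statistic → (n : ℕ) (ν : Partition n) → Bijection (CSF-setoid n ν) (POP-setoid n ν)) ]
      let ψ : Statistic → {n : ℕ} (ν : Partition n) → CSF n ν → POP n ν
          ψ v {n} ν = Bijection.to (Ψ v n ν)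
      in
      (m : ℕ) → let n = suc m in (ν : Partition n) →
        ((v : Statistic) (F : CSF n ν) →
          ((k : Fin n) → weight F k ≡ weightGT (pr (ψ v ν F)) k)
          × statistic v F ≡ ℤ.+ ∣ ψ v ν F ∣Λ)
        × ((v : Statistic) (F : CSF n ν) → pr (ψ v ν F) ≈GT rsort F)
        × ((v : Statistic) (F : CSF n ν) → br (ψ v ν F) ≈⨆ ⨆-map (ψ v) (dsplice F))
        × ((F : CSF n ν) → ψ quinv ν F ≈POP boxcomp (ψ inv ν F))
theorem2 = Ψ , λ m ν →
  (λ { inv   F → weight-rsort F (part≤width F) , statistic-ψ inv F
     ; quinv F → weight-rsort F (part≤width F) , statistic-ψ quinv F }) ,
  (λ { inv   F j j≤n → refl ; quinv F j j≤n → refl }) ,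
  (λ { inv   F → br-ψ F inv ; quinv F → br-ψ F quinv }) ,
  λ F → (λ j j≤n → refl) , λ j j<n i → ≋-refl
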